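{- For every $\alpha>0$ there is a $\Delta>0$ such that the following holds for every $I\ge1$, every Boolean function $f:\mathcal X\times\mathcal Y\to\{0,1\}$ and every protocol distribution $p(xym)$ with $m=(m_0,m_1,\dots,m_C)$. If $\mathsf M^{\mathsf{ext}}_I(p,f)\le\alpha I$, $\mu(xy)=p(xy)$, and moreover the messages are such that $m_2,\dots,m_C\in\{0,1\}$, then $$\mathsf{adv}_\mu\big(\Delta I\log^2C,\,f\big)\ \ge\ 1/\Delta.$$
   Context: All sets are finite, $xy$ means $(x,y)$, logs are base 2. For joint distributions we write e.g. $q(xy|m)$ for conditionals, $p(xy)$ for marginals. Protocol distribution: a distribution $p(xym)$ on inputs $xy$ and $m=(m_0,m_1,\dots,m_C)$, where $m_0$ is the public randomness and $m_1,\dots,m_C$ are the messages (odd ones sent by Alice, even ones by Bob), such that $$p(xym)=p(xy)\cdot p(m_0)\cdot\prod_{i=1,3,5,\dots}p(m_i|xm_{<i})\cdot p(m_{i+1}|ym_{\le i}).$$ A distribution $q(xym)$ is rectangular with respect to $\mu(xy)$ if $q(xym)=\mu(xy)\cdot A(xm)\cdot B(ym)$ for some functions $A,B$. External marginal information: for $I\ge1$, $\delta=1/15$, $$\mathsf M^{\mathsf{ext}}_I(p,f)=\inf_q\sup_{xym}\log\Big(\frac{q(xy|m)}{p(xy)}\cdot\Big(\frac{q(xym)}{p(xym)}\Big)^I\cdot\Big|\mathbb E_{q(xy|m)}[(-1)^{f(xy)}]\Big|^{ -12I/\delta}\Big),$$ infimum over distributions $q$ rectangular with respect to $p(xy)$,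 supremum over $xym$ in the support of $q$ (division by $0$, or a negative power of $0$, is read as $+\infty$). A randomized two-party communication protocol $\pi$: Alice receives $x$, Bob receives $y$, they have public and private randomness and exchange bits; the output $\pi(xy)$ is determined by the transcript and the public randomness; $\|\pi\|$ is the maximum number of bits exchanged (public randomness not counted). For a distribution $\mu(xy)$ on inputs, $$\mathsf{adv}_\mu(T,f)=\sup_{\|\pi\|\le T}\mathbb E\big[(-1)^{\pi(xy)+f(xy)}\big],$$ the expectation being over $xy\sim\mu$ and the randomness of $\pi$.
   Formalization: The number of messages C is assumed to be at least 2: for C = 0 the logarithm is undefined, and for C = 1 the communication bound is 0 and the claim fails (x a uniform bit, f = x, m_1 = x, q = p, I ≥ max(1, 1/α)). -}

module Defs where

open import Algebra.Bundles using (CommutativeRing; Semiring)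
import Algebra.Definitions.RawSemiring as RawSemiringDefinitions
open import Axiom.ExcludedMiddle using (ExcludedMiddle)
open import Data.Bool.Base using (if_then_else_)
open import Data.Fin.Base using (Fin; zero; suc; toℕ)
import Data.Fin.Properties as Fin
open import Data.Nat.Base as ℕ using (ℕ; parity)
import Data.Nat.Properties as ℕ
open import Data.Parity.Base using (0ℙ; 1ℙ)
open import Data.Product.Base using (Σ; ∃; _×_; _,_; proj₁; proj₂)
open import Data.Sum.Base using (_⊎_; [_,_]′)
open import Data.Vec.Base as Vec using (Vec; []; _∷_)
open import Data.Vec.Functional using (Vector; foldr)
open import Data.Vec.Relation.Unary.All using (All; []; _∷_; lookup)
open import Data.Vec.Membership.Propositional.Properties using (∈-lookup)
open import Level using (0ℓ)
open import Relation.Binary.Core using (Rel)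
import Relation.Binary.Construct.NonStrictToStrict as NonStrictToStrict
open import Relation.Binary.PropositionalEquality.Core using (_≡_)
open import Relation.Binary.Structures using (IsTotalOrder)
open import Relation.Nullary using (¬_; yes; no)
open import Relation.Nullary.Decidable using (does; _×-dec_; _→-dec_)
open import Relation.Unary using (Pred; Decidable)

-- Dedekind-complete ordered fields.  Classically ℝ is, up to isomorphism, the
-- only one.  The operations _⁻¹ and sup are total; 0⁻¹ is 0, and sup P is
-- unspecified unless P is inhabited and bounded above.

record CompleteOrderedField : Set₁ where
  field
    commutativeRing : CommutativeRing 0ℓ 0ℓ

  open CommutativeRing commutativeRing public

  infix  4 _≤_
  infix  9 _⁻¹

  field
    _≤_          : Rel Carrier 0ℓ
    isTotalOrder : IsTotalOrder _≈_ _≤_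
    +-monoʳ-≤    : ∀ x {y z} → y ≤ z → x + y ≤ x + z
    *-nonNeg     : ∀ {x y} → 0# ≤ x → 0# ≤ y → 0# ≤ x * y
    0≉1          : ¬ (0# ≈ 1#)
    _⁻¹          : Carrier → Carrier
    *-inverseʳ   : ∀ {x} → ¬ (x ≈ 0#) → x * x ⁻¹ ≈ 1#
    ⁻¹-zero      : ∀ {x} → x ≈ 0# → x ⁻¹ ≈ 0#

  UpperBound : Pred Carrier 0ℓ → Carrier → Set
  UpperBound P u = ∀ {x} → P x → x ≤ u

  field
    sup          : Pred Carrier 0ℓ → Carrier
    sup-upper    : ∀ {P} → ∃ P → ∃ (UpperBound P) → UpperBound P (sup P)
    sup-least    : ∀ {P} → ∃ P → ∃ (UpperBound P) →
                   ∀ {u} → UpperBound P u → sup P ≤ u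

  open IsTotalOrder isTotalOrder public using (total)
  open NonStrictToStrict _≈_ _≤_ public using (_<_)
  open RawSemiringDefinitions (Semiring.rawSemiring semiring) public
    using (_^_; sum; product) renaming (_×_ to _·_)

  infixl 7 _/_
  _/_ : Carrier → Carrier → Carrier
  x / y = x * y ⁻¹

  ∣_∣ : Carrier → Carrier
  ∣ x ∣ = [ (λ _ → x) , (λ _ → - x) ]′ (total 0# x)

  fromℕ : ℕ → Carrier
  fromℕ n = n · 1#

  -- For x > 0: the supremum of the rationals t = (a - b)/(1 + n) with 2ᵗ ≤ x.
  log₂ : Carrier → Carrier
  log₂ x = sup λ t → ∃ λ a → ∃ λ b → ∃ λ n →
    (fromℕ (ℕ.suc n) * t ≈ fromℕ a - fromℕ b) ×
    (fromℕ 2 ^ a ≤ fromℕ 2 ^ b * x ^ ℕ.suc n)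

  exp₂ : Carrier → Carrier
  exp₂ t = sup λ x → 0# < x × log₂ x ≤ t

  -- Real powers of a positive base.
  infixr 8 _^ʳ_
  _^ʳ_ : Carrier → Carrier → Carrier
  x ^ʳ t = exp₂ (t * log₂ x)

Bit : Set
Bit = Fin 2

-- Deterministic protocol trees; A and B are what Alice and Bob see privately.
-- A node is owned by the player who sends the next bit.

data Tree (A B : Set) : Set where
  output : Bit → Tree A B
  alice  : (A → Bit) → Tree A B → Tree A B → Tree A B
  bob    : (B → Bit) → Tree A B → Tree A B → Tree A B

choose : {T : Set} → Bit → T → T → T
choose zero    t₀ t₁ = t₀
choose (suc _) t₀ t₁ = t₁

run : ∀ {A B} → Tree A B → A → B → Bit
run (output z)     a b = z
run (alice s t₀ t₁) a b = choose (s a) (run t₀ a b) (run t₁ a b)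
run (bob s t₀ t₁)   a b = choose (s b) (run t₀ a b) (run t₁ a b)

depth : ∀ {A B} → Tree A B → ℕ
depth (output _)      = 0
depth (alice _ t₀ t₁) = ℕ.suc (depth t₀ ℕ.⊔ depth t₁)
depth (bob _ t₀ t₁)   = ℕ.suc (depth t₀ ℕ.⊔ depth t₁)

-- The entry k of ks at position i is the size of the alphabet of mᵢ.

Transcript : ∀ {n} → Vec ℕ n → Set
Transcript ks = All Fin ks

message : ∀ {n} {ks : Vec ℕ n} → Transcript ks → (i : Fin n) → Fin (Vec.lookup ks i)
message {ks = ks} m i = lookup m (∈-lookup i ks)

AgreeBelow : ∀ {n} {ks : Vec ℕ n} → ℕ → Rel (Transcript ks) 0ℓ
AgreeBelow i m m′ = ∀ j → toℕ j ℕ.< i → message m j ≡ message m′ j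

agreeBelow? : ∀ {n} {ks : Vec ℕ n} i (m : Transcript ks) → Decidable (AgreeBelow i m)
agreeBelow? i m m′ =
  Fin.all? λ j → (toℕ j ℕ.<? i) →-dec (message m j Fin.≟ message m′ j)

-- Excluded middle serves to define suprema and infima in the extended reals.

module Analysis (em : ExcludedMiddle 0ℓ) (field′ : CompleteOrderedField) where

  open CompleteOrderedField field′ public
  open CompleteOrderedField field′ using () renaming (Carrier to ℝ)

  data ℝ∞ : Set where
    -∞ +∞ : ℝ∞
    [_]   : ℝ → ℝ∞

  infix 4 _≤∞_
  data _≤∞_ : Rel ℝ∞ 0ℓ where
    -∞≤  : ∀ {e} → -∞ ≤∞ e
    ≤+∞  : ∀ {e} → e ≤∞ +∞
    [_]≤ : ∀ {x y} → x ≤ y → [ x ] ≤∞ [ y ]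

  neg : ℝ∞ → ℝ∞
  neg -∞    = +∞
  neg +∞    = -∞
  neg [ x ] = [ - x ]

  ⨆ : {J : Set} → (J → ℝ∞) → ℝ∞
  ⨆ F with em {∃ λ u → ∀ j → F j ≤∞ [ u ]} | em {∃ λ j → ∃ λ x → F j ≡ [ x ]}
  ... | no _  | _     = +∞
  ... | yes _ | no _  = -∞
  ... | yes _ | yes _ = [ sup (λ x → ∃ λ j → F j ≡ [ x ]) ]

  ⨅ : {J : Set} → (J → ℝ∞) → ℝ∞
  ⨅ F = neg (⨆ λ j → neg (F j))

  sign : ℕ → ℝ
  sign n = (- 1#) ^ n

  record IsDistribution {n} (w : Vector ℝ n) : Set where
    field
      nonNeg   : ∀ i → 0# ≤ w i
      sums-to1 : sum w ≈ 1#

  record Protocol (nx ny : ℕ) : Set where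
    field
      {nPub nA nB} : ℕ
      pubCoins     : Vector ℝ nPub
      aliceCoins   : Vector ℝ nA
      bobCoins     : Vector ℝ nB
      pub-dist     : IsDistribution pubCoins
      alice-dist   : IsDistribution aliceCoins
      bob-dist     : IsDistribution bobCoins
      tree         : Fin nPub → Tree (Fin nx × Fin nA) (Fin ny × Fin nB)

    ‖_‖ : ℕ
    ‖_‖ = foldr ℕ._⊔_ 0 (λ r → depth (tree r))

    correlation : (Fin nx → Fin ny → ℝ) → (Fin nx → Fin ny → Bit) → ℝ
    correlation μ f =
      sum λ x → sum λ y → sum λ r → sum λ a → sum λ b →
        μ x y * (pubCoins r * (aliceCoins a * bobCoins b)) *
        sign (toℕ (run (tree r) (x , a) (y , b)) ℕ.+ toℕ (f x y))

  adv : ∀ {nx ny} → (Fin nx → Fin ny → ℝ) → ℝ → (Fin nx → Fin ny → Bit) → ℝ∞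
  adv {nx} {ny} μ T f =
    ⨆ {Σ (Protocol nx ny) λ π → fromℕ (Protocol.‖_‖ π) ≤ T}
      λ (π , _) → [ Protocol.correlation π μ f ]

  sumTranscript : ∀ {n} (ks : Vec ℕ n) → (Transcript ks → ℝ) → ℝ
  sumTranscript []       g = g []
  sumTranscript (k ∷ ks) g = sum λ i → sumTranscript ks λ m → g (i ∷ m)

  module Joint (nx ny : ℕ) {C : ℕ} (ks : Vec ℕ (ℕ.suc C)) where

    X Y M Ω : Set
    X = Fin nx
    Y = Fin ny
    M = Transcript ks
    Ω = X × Y × M

    sumΩ : (Ω → ℝ) → ℝ
    sumΩ g = sum λ x → sum λ y → sumTranscript ks λ m → g (x , y , m)

    record IsJointDistribution (p : Ω → ℝ) : Set where
      field
        nonNeg   : ∀ ω → 0# ≤ p ω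
        sums-to1 : sumΩ p ≈ 1#

    Pr : (Ω → ℝ) → {E : Pred Ω 0ℓ} → Decidable E → ℝ
    Pr p E? = sumΩ λ ω → if does (E? ω) then p ω else 0#

    Prxy : (Ω → ℝ) → X → Y → ℝ
    Prxy p x y = Pr p λ (x′ , y′ , _) → (x Fin.≟ x′) ×-dec (y Fin.≟ y′)

    Prm : (Ω → ℝ) → M → ℝ
    Prm p m = sum λ x → sum λ y → p (x , y , m)

    Prm< : (Ω → ℝ) → ℕ → M → ℝ
    Prm< p i m = Pr p λ (_ , _ , m′) → agreeBelow? i m m′

    Prxm< : (Ω → ℝ) → ℕ → X → M → ℝ
    Prxm< p i x m = Pr p λ (x′ , _ , m′) → (x Fin.≟ x′) ×-dec agreeBelow? i m m′

    Prym< : (Ω → ℝ) → ℕ → Y → M → ℝ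
    Prym< p i y m = Pr p λ (_ , y′ , m′) → (y Fin.≟ y′) ×-dec agreeBelow? i m m′

    -- p(mᵢ | x m_{<i}) for odd i and p(mᵢ | y m_{<i}) for even i.  If the event
    -- conditioned on has probability 0, this is 0, as is p(xym).
    messageFactor : (Ω → ℝ) → Ω → ℕ → ℝ
    messageFactor p (x , y , m) i with parity i
    ... | 1ℙ = Prxm< p (ℕ.suc i) x m / Prxm< p i x m
    ... | 0ℙ = Prym< p (ℕ.suc i) y m / Prym< p i y m

    record IsProtocolDistribution (p : Ω → ℝ) : Set where
      field
        isJointDistribution : IsJointDistribution p
        factors : ∀ x y m → p (x , y , m) ≈
          Prxy p x y * Prm< p 1 m *
          product {C} (λ i → messageFactor p (x , y , m) (ℕ.suc (toℕ i)))

    Rectangular : (X → Y → ℝ) → (Ω → ℝ) → Set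
    Rectangular μ q =
      ∃ λ (A : X → M → ℝ) → ∃ λ (B : Y → M → ℝ) →
        ∀ x y m → q (x , y , m) ≈ μ x y * A x m * B y m

    -- The conditional q(xy|m).
    cond : (Ω → ℝ) → Ω → ℝ
    cond q (x , y , m) = q (x , y , m) / Prm q m

    bias : (X → Y → Bit) → (Ω → ℝ) → M → ℝ
    bias f q m = sum λ x → sum λ y → cond q (x , y , m) * sign (toℕ (f x y))

    δ : ℝ
    δ = 1# / fromℕ 15

    logCost : ℝ → (Ω → ℝ) → (X → Y → Bit) → (Ω → ℝ) → Ω → ℝ∞
    logCost I p f q ω@(x , y , m)
      with em {Prxy p x y ≈ 0# ⊎ p ω ≈ 0# ⊎ bias f q m ≈ 0#}
    ... | yes _ = +∞
    ... | no  _ = [ log₂ ( cond q ω / Prxy p x y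
                         * (q ω / p ω) ^ʳ I
                         * ∣ bias f q m ∣ ^ʳ (- (fromℕ 12 * I / δ)) ) ]

    Mext : ℝ → (Ω → ℝ) → (X → Y → Bit) → ℝ∞
    Mext I p f =
      ⨅ {Σ (Ω → ℝ) λ q → IsJointDistribution q × Rectangular (Prxy p) q} λ (q , _) →
        ⨆ {Σ Ω λ ω → ¬ (q ω ≈ 0#)} λ (ω , _) → logCost I p f q ω

{-# OPTIONS --safe #-}
-- Let q attain the infimum up to a constant.  The cost bound makes q(xym)/p(xym) at most a constant
-- times |E_{q(xy|m)}(-1)^f| on most of q, so a random transcript m of p, accepted with probability
-- proportional to q(xym)/p(xym) and answered by the sign of the bias given m, has constant advantage.
-- As p and q are rectangular, this ratio is a(x)b(y), and random signs compare the scales of a and b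
-- with two bits of communication.  The cost bound also makes the likelihood ratio
-- p(m|xy)/p(m) at most 2^{O(I)} on the accepted transcripts, which allows p to be compressed: the
-- players publicly sample a path of the protocol tree without looking at their inputs and follow it
-- until the likelihood ratio of one of them exceeds 2, a node announced with O(log C) bits, which is
-- then accepted with probability proportional to the product of the ratios.  Every accepted attempt
-- contracts the expectation of the inverse square root of the likelihood ratio by a constant factor,
-- whence O(I) attempts suffice.  Private coins and public sampling are replaced by best choices
-- against the linear functional under consideration.
module Submission where

open import Defs
open import Axiom.ExcludedMiddle using (ExcludedMiddle)
open import Level using (0ℓ)
open import Algebra.Bundles using (CommutativeRing; RawRing)
import Algebra.Properties.CommutativeSemiring.Exp as Exp
import Algebra.Properties.Ring as RingProperties
import Algebra.Properties.AbelianGroup as AbelianGroupProperties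
import Algebra.Properties.Semiring.Exp as SemiringExp
import Algebra.Properties.Semiring.Mult as Mult
import Algebra.Properties.Semiring.Sum as Sum
import Algebra.Solver.Ring as RingSolver
open import Algebra.Solver.Ring.AlmostCommutativeRing using (AlmostCommutativeRing; fromCommutativeRing; _-Raw-AlmostCommutative⟶_)
open import Data.Bool.Base using (if_then_else_)
open import Data.Empty using (⊥; ⊥-elim)
open import Data.Fin.Base as Fin using (Fin; zero; suc; toℕ)
import Data.Fin.Properties as Fin
open import Data.Integer.Base as ℤ using (ℤ; -[1+_])
import Data.Integer.Properties as ℤ
open import Data.Maybe.Base using (Maybe; just; nothing)
open import Data.Nat.Base as ℕ using (ℕ; zero; suc; z≤n; s≤s)
import Data.Nat.Properties as ℕ
open import Data.Product.Base using (Σ; ∃; _×_; _,_; proj₁; proj₂)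
open import Data.Sum.Base using (_⊎_; inj₁; inj₂)
open import Function.Base using (_∘_)
open import Relation.Binary.Bundles using (Poset)
open import Relation.Binary.PropositionalEquality.Core as ≡ using (_≡_)
import Relation.Binary.Reasoning.PartialOrder as PartialOrderReasoning
import Relation.Binary.Reasoning.Setoid as SetoidReasoning
import Data.Sign.Base as Sign
open import Relation.Binary.Structures using (IsTotalOrder)
open import Relation.Nullary using (¬_; Dec; yes; no; does)
open import Data.Parity.Base using (Parity; 0ℙ; 1ℙ)
open import Data.Vec.Base as Vec using (Vec; []; _∷_)
open import Data.Vec.Relation.Unary.All using ([]; _∷_)
open import Relation.Nullary.Decidable using (_×-dec_)
open import Data.Vec.Relation.Unary.All using () renaming (All to VecAll)
open import Data.Sum.Base using (map₁; [_,_]′)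
import Data.Nat.Solver as NatSolvers
open import Data.Vec.Relation.Unary.All.Properties using (lookup⁻)
open import Data.Vec.Base using (lookup)

-- Let R be the likelihood ratio of a node. A payoff g satisfies g² ≤ q/p at its leaf, so the cost
-- bound yields R g² ≤ B there with B = 2^O(I); R itself is unbounded. Hence the expected payoff
-- below a node is at most √(B/R). A child whose ratio grows by r contributes r √(B/(R r)) = √r
-- √(B/R). The prior mean of r is 1, so that of √r is at most 1, and paths running up to ratio 2
-- push it below 1 by a constant: hence the inverse square root. Square roots are never taken; AM-GM
-- bounds stand for them and, being affine in the ratios, average exactly over a node. Acceptance
-- requires a bounded ratio where a path stops. Therefore each bit becomes a chain of nodes of ratio
-- at most 4, after mixing its prior with a fair coin; paths then stop below 2 · 4 = 8, which is the
-- origin of the acceptance probability 1/64. The chains lengthen the tree by a factor O(log C),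
-- which matters little, as only the logarithm of the height is paid for. The first message has an
-- arbitrary alphabet, so chains of bits do not fit it. It is sent by rejection sampling instead,
-- once, with O(I) bits.

module Compression (em : ExcludedMiddle 0ℓ) (field′ : CompleteOrderedField) where

  open Analysis em field′ public hiding (zero)
  open CompleteOrderedField field′ public using () renaming (Carrier to ℝ)

  open IsTotalOrder isTotalOrder public using (antisym; isPartialOrder)
    renaming (refl to ≤-refl; reflexive to ≤-reflexive; trans to ≤-trans; ≤-respˡ-≈ to ≤-respˡ; ≤-respʳ-≈ to ≤-respʳ)
  open Mult semiring public using (×-homo-+; ×1-homo-*)
  open SemiringExp semiring public using (^-homo-*; ^-congˡ; ^-assocʳ)
  open Exp commutativeSemiring public using (^-distrib-*)
  open Sum semiring public using (sum-cong-≋; *-distribˡ-sum; *-distribʳ-sum; sum-replicate-zero) renaming (∑-distrib-+ to sum-distrib-+; ∑-comm to sum-comm)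
  open RingProperties (CommutativeRing.ring commutativeRing) public using (-‿distribˡ-*; -‿distribʳ-*; -0#≈0#; -‿involutive)
  open AbelianGroupProperties +-abelianGroup public using () renaming (⁻¹-∙-comm to -‿+-comm)

  poset : Poset _ _ _
  poset = record { isPartialOrder = isPartialOrder }

  module ≤R = PartialOrderReasoning poset

  dec : (P : Set) → Dec P
  dec P = em {P}

  -- Separate clauses for 0, 1 and -1 make the solver numerals `# 0` and `# 1` equal to `0#` and
  -- `1#` definitionally, whereas `fromℕ 1` is `1# + 0#`; larger numerals are `fromℕ` on the nose.
  ⟦_⟧ᶻ : ℤ → ℝ
  ⟦ ℤ.+ 0 ⟧ᶻ = 0#
  ⟦ ℤ.+ 1 ⟧ᶻ = 1#
  ⟦ ℤ.+ suc (suc n) ⟧ᶻ = fromℕ (suc (suc n))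
  ⟦ -[1+ 0 ] ⟧ᶻ = - 1#
  ⟦ -[1+ suc n ] ⟧ᶻ = - fromℕ (suc (suc n))

  fromℕ-homo-+ : ∀ m n → fromℕ (m ℕ.+ n) ≈ fromℕ m + fromℕ n
  fromℕ-homo-+ m n = ×-homo-+ 1# m n

  fromℕ-homo-* : ∀ m n → fromℕ (m ℕ.* n) ≈ fromℕ m * fromℕ n
  fromℕ-homo-* = ×1-homo-*

  ⟦⟧-pos : ∀ n → ⟦ ℤ.+ n ⟧ᶻ ≈ fromℕ n
  ⟦⟧-pos 0 = refl
  ⟦⟧-pos 1 = sym (+-identityʳ 1#)
  ⟦⟧-pos (suc (suc n)) = refl

  ⟦⟧-negsuc : ∀ n → ⟦ -[1+ n ] ⟧ᶻ ≈ - fromℕ (suc n)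
  ⟦⟧-negsuc 0 = -‿cong (sym (+-identityʳ 1#))
  ⟦⟧-negsuc (suc n) = refl

  ⟦⟧-⊖ : ∀ m n → ⟦ m ℤ.⊖ n ⟧ᶻ ≈ fromℕ m - fromℕ n
  ⟦⟧-⊖ m zero = trans (⟦⟧-pos m) (sym (trans (+-congˡ -0#≈0#) (+-identityʳ _)))
  ⟦⟧-⊖ zero (suc n) = trans (⟦⟧-negsuc n) (sym (+-identityˡ _))
  ⟦⟧-⊖ (suc m) (suc n) = begin
    ⟦ suc m ℤ.⊖ suc n ⟧ᶻ                      ≈⟨ reflexive (≡.cong ⟦_⟧ᶻ (ℤ.[1+m]⊖[1+n]≡m⊖n m n)) ⟩
    ⟦ m ℤ.⊖ n ⟧ᶻ                              ≈⟨ ⟦⟧-⊖ m n ⟩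
    fromℕ m - fromℕ n                        ≈⟨ +-congʳ (sym (+-identityˡ _)) ⟩
    0# + fromℕ m - fromℕ n                   ≈⟨ +-congʳ (+-congʳ (sym (-‿inverseʳ 1#))) ⟩
    (1# - 1#) + fromℕ m - fromℕ n            ≈⟨ +-congʳ (trans (+-assoc _ _ _) (trans (+-congˡ (+-comm _ _)) (sym (+-assoc _ _ _)))) ⟩
    (1# + fromℕ m) - 1# - fromℕ n            ≈⟨ +-assoc _ _ _ ⟩
    (1# + fromℕ m) + (- 1# - fromℕ n)        ≈⟨ +-congˡ (-‿+-comm _ _) ⟩
    fromℕ (suc m) - fromℕ (suc n)            ∎
    where open SetoidReasoning setoid

  ⟦⟧-◃⁺ : ∀ n → ⟦ Sign.+ ℤ.◃ n ⟧ᶻ ≈ fromℕ n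
  ⟦⟧-◃⁺ zero = refl
  ⟦⟧-◃⁺ (suc n) = ⟦⟧-pos (suc n)

  ⟦⟧-◃⁻ : ∀ n → ⟦ Sign.- ℤ.◃ n ⟧ᶻ ≈ - fromℕ n
  ⟦⟧-◃⁻ zero = sym -0#≈0#
  ⟦⟧-◃⁻ (suc n) = ⟦⟧-negsuc n

  ℤ-homo-+ : ∀ i j → ⟦ i ℤ.+ j ⟧ᶻ ≈ ⟦ i ⟧ᶻ + ⟦ j ⟧ᶻ
  ℤ-homo-+ (ℤ.+ m) (ℤ.+ n) = trans (⟦⟧-pos (m ℕ.+ n)) (trans (fromℕ-homo-+ m n) (sym (+-cong (⟦⟧-pos m) (⟦⟧-pos n))))
  ℤ-homo-+ (ℤ.+ m) -[1+ n ] = trans (⟦⟧-⊖ m (suc n)) (sym (+-cong (⟦⟧-pos m) (⟦⟧-negsuc n)))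
  ℤ-homo-+ -[1+ m ] (ℤ.+ n) = trans (⟦⟧-⊖ n (suc m)) (trans (+-comm _ _) (sym (+-cong (⟦⟧-negsuc m) (⟦⟧-pos n))))
  ℤ-homo-+ -[1+ m ] -[1+ n ] =
    trans (-‿cong (trans (reflexive (≡.cong (λ k → fromℕ (suc k)) (≡.sym (ℕ.+-suc m n)))) (fromℕ-homo-+ (suc m) (suc n))))
      (trans (sym (-‿+-comm _ _)) (sym (+-cong (⟦⟧-negsuc m) (⟦⟧-negsuc n))))

  ℤ-homo-* : ∀ i j → ⟦ i ℤ.* j ⟧ᶻ ≈ ⟦ i ⟧ᶻ * ⟦ j ⟧ᶻ
  ℤ-homo-* (ℤ.+ m) (ℤ.+ n) = trans (⟦⟧-◃⁺ (m ℕ.* n)) (trans (fromℕ-homo-* m n) (sym (*-cong (⟦⟧-pos m) (⟦⟧-pos n))))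
  ℤ-homo-* (ℤ.+ m) -[1+ n ] = trans (⟦⟧-◃⁻ (m ℕ.* suc n)) (trans (-‿cong (fromℕ-homo-* m (suc n)))
    (trans (-‿distribʳ-* _ _) (sym (*-cong (⟦⟧-pos m) (⟦⟧-negsuc n)))))
  ℤ-homo-* -[1+ m ] (ℤ.+ n) = trans (⟦⟧-◃⁻ (suc m ℕ.* n)) (trans (-‿cong (fromℕ-homo-* (suc m) n))
    (trans (-‿distribˡ-* _ _) (sym (*-cong (⟦⟧-negsuc m) (⟦⟧-pos n)))))
  ℤ-homo-* -[1+ m ] -[1+ n ] = trans (⟦⟧-◃⁺ (suc m ℕ.* suc n)) (trans (fromℕ-homo-* (suc m) (suc n))
    (trans (trans (sym (-‿involutive _)) (trans (-‿cong (-‿distribˡ-* _ _)) (-‿distribʳ-* _ _))) (sym (*-cong (⟦⟧-negsuc m) (⟦⟧-negsuc n)))))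

  ℤ-homo-neg : ∀ i → ⟦ ℤ.- i ⟧ᶻ ≈ - ⟦ i ⟧ᶻ
  ℤ-homo-neg (ℤ.+ zero) = sym -0#≈0#
  ℤ-homo-neg (ℤ.+ suc n) = trans (⟦⟧-negsuc n) (-‿cong (sym (⟦⟧-pos (suc n))))
  ℤ-homo-neg -[1+ n ] = trans (⟦⟧-pos (suc n)) (trans (sym (-‿involutive _)) (-‿cong (sym (⟦⟧-negsuc n))))

  ℤ-rawRing : RawRing _ _
  ℤ-rawRing = record { Carrier = ℤ ; _≈_ = _≡_ ; _+_ = ℤ._+_ ; _*_ = ℤ._*_ ; -_ = ℤ.-_ ; 0# = ℤ.+ 0 ; 1# = ℤ.+ 1 }

  ℝ-ring : AlmostCommutativeRing 0ℓ 0ℓ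
  ℝ-ring = fromCommutativeRing commutativeRing

  ℤ-morphism : ℤ-rawRing -Raw-AlmostCommutative⟶ ℝ-ring
  ℤ-morphism = record { ⟦_⟧ = ⟦_⟧ᶻ ; +-homo = ℤ-homo-+ ; *-homo = ℤ-homo-* ; -‿homo = ℤ-homo-neg ; 0-homo = refl ; 1-homo = refl }

  _coeff≟_ : ∀ i j → Maybe (⟦ i ⟧ᶻ ≈ ⟦ j ⟧ᶻ)
  i coeff≟ j with i ℤ.≟ j
  ... | yes i≡j = just (reflexive (≡.cong ⟦_⟧ᶻ i≡j))
  ... | no _ = nothing

  open RingSolver ℤ-rawRing ℝ-ring ℤ-morphism _coeff≟_ using (Polynomial; con; solve; _:+_; _:*_; _:-_; :-_; _:=_) public

  # : ∀ {n} → ℕ → Polynomial n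
  # k = con (ℤ.+ k)

  -- Ordered-field arithmetic

  -- Most inequalities below take this route: the difference is written as a visibly nonnegative
  -- `d`, and the ring solver checks the identity.
  ≤-via : ∀ {x y d} → 0# ≤ d → y ≈ x + d → x ≤ y
  ≤-via {x} 0≤d y≈x+d = ≤-respʳ (sym y≈x+d) (≤-respˡ (+-identityʳ x) (+-monoʳ-≤ x 0≤d))

  +-monoˡ-≤ : ∀ z {x y} → x ≤ y → x + z ≤ y + z
  +-monoˡ-≤ z {x} {y} x≤y = ≤-respʳ (+-comm z y) (≤-respˡ (+-comm z x) (+-monoʳ-≤ z x≤y))

  +-mono-≤ : ∀ {a b c d} → a ≤ b → c ≤ d → a + c ≤ b + d
  +-mono-≤ {a} {b} {c} a≤b c≤d = ≤-trans (+-monoˡ-≤ c a≤b) (+-monoʳ-≤ b c≤d)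

  0≤diff : ∀ {x y} → x ≤ y → 0# ≤ y - x
  0≤diff {x} x≤y = ≤-respˡ (-‿inverseʳ x) (+-monoˡ-≤ (- x) x≤y)

  +-nonNeg : ∀ {x y} → 0# ≤ x → 0# ≤ y → 0# ≤ x + y
  +-nonNeg 0≤x 0≤y = ≤-respˡ (+-identityʳ 0#) (+-mono-≤ 0≤x 0≤y)

  *-monoˡ-≤ : ∀ {a b} c → 0# ≤ c → a ≤ b → c * a ≤ c * b
  *-monoˡ-≤ {a} {b} c 0≤c a≤b = ≤-via (*-nonNeg 0≤c (0≤diff a≤b)) (solve 3 (λ a b c → c :* b := c :* a :+ c :* (b :- a)) refl a b c)

  *-monoʳ-≤ : ∀ {a b} c → 0# ≤ c → a ≤ b → a * c ≤ b * c
  *-monoʳ-≤ {a} {b} c 0≤c a≤b = ≤-respʳ (*-comm c b) (≤-respˡ (*-comm c a) (*-monoˡ-≤ c 0≤c a≤b))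

  *-mono-≤ : ∀ {a b c d} → 0# ≤ a → a ≤ b → 0# ≤ c → c ≤ d → a * c ≤ b * d
  *-mono-≤ {a} {b} {c} 0≤a a≤b 0≤c c≤d = ≤-trans (*-monoʳ-≤ c 0≤c a≤b) (*-monoˡ-≤ b (≤-trans 0≤a a≤b) c≤d)

  neg-mono-≤ : ∀ {a b} → a ≤ b → - b ≤ - a
  neg-mono-≤ {a} {b} a≤b = ≤-via (0≤diff a≤b) (solve 2 (λ a b → :- a := :- b :+ (b :- a)) refl a b)

  neg-nonPos : ∀ {a} → 0# ≤ a → - a ≤ 0#
  neg-nonPos 0≤a = ≤-respʳ -0#≈0# (neg-mono-≤ 0≤a)

  nonPos-neg : ∀ {a} → a ≤ 0# → 0# ≤ - a
  nonPos-neg a≤0 = ≤-respˡ -0#≈0# (neg-mono-≤ a≤0)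

  square-nonNeg : ∀ x → 0# ≤ x * x
  square-nonNeg x with total 0# x
  ... | inj₁ 0≤x = *-nonNeg 0≤x 0≤x
  ... | inj₂ x≤0 = ≤-respʳ (solve 1 (λ x → :- x :* :- x := x :* x) refl x) (*-nonNeg (nonPos-neg x≤0) (nonPos-neg x≤0))

  0≤1 : 0# ≤ 1#
  0≤1 = ≤-respʳ (*-identityʳ 1#) (square-nonNeg 1#)

  0<1 : 0# < 1#
  0<1 = 0≤1 , 0≉1

  ≰⇒≥ : ∀ {x y} → ¬ x ≤ y → y ≤ x
  ≰⇒≥ {x} {y} x≰y with total x y
  ... | inj₁ x≤y = ⊥-elim (x≰y x≤y)
  ... | inj₂ y≤x = y≤x

  ≰⇒> : ∀ {x y} → ¬ x ≤ y → y < x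
  ≰⇒> x≰y = ≰⇒≥ x≰y , λ y≈x → x≰y (≤-reflexive (sym y≈x))

  <⇒≱ : ∀ {x y} → x < y → ¬ y ≤ x
  <⇒≱ (x≤y , x≉y) y≤x = x≉y (antisym x≤y y≤x)

  <-≤-trans : ∀ {x y z} → x < y → y ≤ z → x < z
  <-≤-trans (x≤y , x≉y) y≤z = ≤-trans x≤y y≤z , λ x≈z → x≉y (antisym x≤y (≤-trans y≤z (≤-reflexive (sym x≈z))))

  ≤-<-trans : ∀ {x y z} → x ≤ y → y < z → x < z
  ≤-<-trans x≤y (y≤z , y≉z) = ≤-trans x≤y y≤z , λ x≈z → y≉z (antisym y≤z (≤-trans (≤-reflexive (sym x≈z)) x≤y))

  <-respʳ : ∀ {x y z} → y ≈ z → x < y → x < z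
  <-respʳ y≈z x<y = <-≤-trans x<y (≤-reflexive y≈z)

  >⇒≉ : ∀ {x} → 0# < x → ¬ x ≈ 0#
  >⇒≉ (_ , 0≉x) x≈0 = 0≉x (sym x≈0)

  nonNeg≉⇒> : ∀ {x} → 0# ≤ x → ¬ x ≈ 0# → 0# < x
  nonNeg≉⇒> 0≤x x≉0 = 0≤x , λ 0≈x → x≉0 (sym 0≈x)

  x⁻¹*x≈1 : ∀ {x} → ¬ x ≈ 0# → x ⁻¹ * x ≈ 1#
  x⁻¹*x≈1 {x} x≉0 = trans (*-comm (x ⁻¹) x) (*-inverseʳ x≉0)

  *-cancelˡ : ∀ {c a b} → ¬ c ≈ 0# → c * a ≈ c * b → a ≈ b
  *-cancelˡ {c} {a} {b} c≉0 ca≈cb = begin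
    a              ≈⟨ sym (*-identityˡ a) ⟩
    1# * a         ≈⟨ *-congʳ (sym (x⁻¹*x≈1 c≉0)) ⟩
    c ⁻¹ * c * a   ≈⟨ *-assoc _ _ _ ⟩
    c ⁻¹ * (c * a) ≈⟨ *-congˡ ca≈cb ⟩
    c ⁻¹ * (c * b) ≈⟨ sym (*-assoc _ _ _) ⟩
    c ⁻¹ * c * b   ≈⟨ *-congʳ (x⁻¹*x≈1 c≉0) ⟩
    1# * b         ≈⟨ *-identityˡ b ⟩
    b              ∎
    where open SetoidReasoning setoid

  ⁻¹-cong : ∀ {x y} → x ≈ y → x ⁻¹ ≈ y ⁻¹
  ⁻¹-cong {x} {y} x≈y with dec (x ≈ 0#)
  ... | yes x≈0 = trans (⁻¹-zero x≈0) (sym (⁻¹-zero (trans (sym x≈y) x≈0)))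
  ... | no x≉0 = *-cancelˡ x≉0 (trans (*-inverseʳ x≉0)
    (trans (sym (*-inverseʳ (λ y≈0 → x≉0 (trans x≈y y≈0)))) (*-congʳ (sym x≈y))))

  integral : ∀ {x y} → x * y ≈ 0# → ¬ x ≈ 0# → y ≈ 0#
  integral {x} xy≈0 x≉0 = *-cancelˡ x≉0 (trans xy≈0 (sym (zeroʳ x)))

  *-nonZero : ∀ {x y} → ¬ x ≈ 0# → ¬ y ≈ 0# → ¬ x * y ≈ 0#
  *-nonZero x≉0 y≉0 xy≈0 = y≉0 (integral xy≈0 x≉0)

  *-pos : ∀ {x y} → 0# < x → 0# < y → 0# < x * y
  *-pos 0<x@(0≤x , _) 0<y@(0≤y , _) = nonNeg≉⇒> (*-nonNeg 0≤x 0≤y) (*-nonZero (>⇒≉ 0<x) (>⇒≉ 0<y))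

  +-pos : ∀ {x y} → 0# < x → 0# ≤ y → 0# < x + y
  +-pos {x} {y} 0<x 0≤y = <-≤-trans 0<x (≤-via 0≤y refl)

  ⁻¹-nonNeg : ∀ {x} → 0# ≤ x → 0# ≤ x ⁻¹
  ⁻¹-nonNeg {x} 0≤x with dec (x ≈ 0#)
  ... | yes x≈0 = ≤-reflexive (sym (⁻¹-zero x≈0))
  ... | no x≉0 = ≤-respʳ (trans (sym (*-assoc _ _ _)) (trans (*-congʳ (*-inverseʳ x≉0)) (*-identityˡ _)))
                   (*-nonNeg 0≤x (square-nonNeg (x ⁻¹)))

  ⁻¹-nonZero : ∀ {x} → ¬ x ≈ 0# → ¬ x ⁻¹ ≈ 0#
  ⁻¹-nonZero x≉0 x⁻¹≈0 = 0≉1 (trans (sym (zeroʳ _)) (trans (*-congˡ (sym x⁻¹≈0)) (*-inverseʳ x≉0)))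

  ⁻¹-pos : ∀ {x} → 0# < x → 0# < x ⁻¹
  ⁻¹-pos 0<x@(0≤x , _) = nonNeg≉⇒> (⁻¹-nonNeg 0≤x) (⁻¹-nonZero (>⇒≉ 0<x))

  /-cancel : ∀ {x y} → ¬ y ≈ 0# → x / y * y ≈ x
  /-cancel {x} {y} y≉0 = trans (*-assoc _ _ _) (trans (*-congˡ (x⁻¹*x≈1 y≉0)) (*-identityʳ x))

  /-cong : ∀ {x x′ y y′} → x ≈ x′ → y ≈ y′ → x / y ≈ x′ / y′
  /-cong x≈x′ y≈y′ = *-cong x≈x′ (⁻¹-cong y≈y′)

  /-nonNeg : ∀ {x y} → 0# ≤ x → 0# ≤ y → 0# ≤ x / y
  /-nonNeg 0≤x 0≤y = *-nonNeg 0≤x (⁻¹-nonNeg 0≤y)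

  /-unique : ∀ {x y z} → ¬ y ≈ 0# → z * y ≈ x → z ≈ x / y
  /-unique {x} {y} {z} y≉0 zy≈x = *-cancelˡ y≉0 (trans (*-comm y z) (trans zy≈x (sym (trans (*-comm y _) (/-cancel y≉0)))))

  *-cancelˡ-≤ : ∀ {c a b} → 0# < c → c * a ≤ c * b → a ≤ b
  *-cancelˡ-≤ {c} {a} {b} 0<c ca≤cb with total a b
  ... | inj₁ a≤b = a≤b
  ... | inj₂ b≤a = ≤-reflexive (*-cancelˡ (>⇒≉ 0<c) (antisym ca≤cb (*-monoˡ-≤ c (proj₁ 0<c) b≤a)))

  *-cancelʳ-≤ : ∀ {c a b} → 0# < c → a * c ≤ b * c → a ≤ b
  *-cancelʳ-≤ {c} {a} {b} 0<c ac≤bc = *-cancelˡ-≤ 0<c (≤-respˡ (*-comm a c) (≤-respʳ (*-comm b c) ac≤bc))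

  ≤/ : ∀ {x y z} → 0# < y → z * y ≤ x → z ≤ x / y
  ≤/ {x} {y} {z} 0<y zy≤x = *-cancelʳ-≤ 0<y (≤-respʳ (sym (/-cancel (>⇒≉ 0<y))) zy≤x)

  /≤ : ∀ {x y z} → 0# < y → x ≤ z * y → x / y ≤ z
  /≤ {x} {y} {z} 0<y x≤zy = *-cancelʳ-≤ 0<y (≤-respˡ (sym (/-cancel (>⇒≉ 0<y))) x≤zy)

  square-cancel-≤ : ∀ {x y} → 0# ≤ y → x * x ≤ y * y → x ≤ y
  square-cancel-≤ {x} {y} 0≤y xx≤yy with total x y
  ... | inj₁ x≤y = x≤y
  ... | inj₂ y≤x with dec (x + y ≈ 0#)
  ... | yes x+y≈0 = ≤-trans (≤-via 0≤y (sym x+y≈0)) 0≤y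
  ... | no x+y≉0 = *-cancelˡ-≤ (nonNeg≉⇒> (+-nonNeg (≤-trans 0≤y y≤x) 0≤y) x+y≉0)
    (≤-via (0≤diff xx≤yy) (solve 2 (λ x y → (x :+ y) :* y := (x :+ y) :* x :+ (y :* y :- x :* x)) refl x y))

  -- Natural numbers, powers of two and of one half

  fromℕ-nonNeg : ∀ n → 0# ≤ fromℕ n
  fromℕ-nonNeg zero = ≤-refl
  fromℕ-nonNeg (suc n) = +-nonNeg 0≤1 (fromℕ-nonNeg n)

  fromℕ-mono : ∀ {m n} → m ℕ.≤ n → fromℕ m ≤ fromℕ n
  fromℕ-mono {n = n} z≤n = fromℕ-nonNeg n
  fromℕ-mono (s≤s m≤n) = +-monoʳ-≤ 1# (fromℕ-mono m≤n)

  fromℕ-pos : ∀ n → 0# < fromℕ (suc n)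
  fromℕ-pos n = +-pos 0<1 (fromℕ-nonNeg n)

  fromℕ-1 : fromℕ 1 ≈ 1#
  fromℕ-1 = +-identityʳ 1#

  ^-nonNeg : ∀ {x} n → 0# ≤ x → 0# ≤ x ^ n
  ^-nonNeg zero 0≤x = 0≤1
  ^-nonNeg (suc n) 0≤x = *-nonNeg 0≤x (^-nonNeg n 0≤x)

  ^-pos : ∀ {x} n → 0# < x → 0# < x ^ n
  ^-pos zero 0<x = 0<1
  ^-pos (suc n) 0<x = *-pos 0<x (^-pos n 0<x)

  1≤^ : ∀ {x} n → 1# ≤ x → 1# ≤ x ^ n
  1≤^ zero 1≤x = ≤-refl
  1≤^ {x} (suc n) 1≤x = ≤-respˡ (*-identityˡ 1#) (*-mono-≤ 0≤1 1≤x 0≤1 (1≤^ n 1≤x))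

  ^≤1 : ∀ {x} n → 0# ≤ x → x ≤ 1# → x ^ n ≤ 1#
  ^≤1 zero 0≤x x≤1 = ≤-refl
  ^≤1 {x} (suc n) 0≤x x≤1 = ≤-respʳ (*-identityˡ 1#) (*-mono-≤ 0≤x x≤1 (^-nonNeg n 0≤x) (^≤1 n 0≤x x≤1))

  ^-mono-≤ : ∀ {x y} n → 0# ≤ x → x ≤ y → x ^ n ≤ y ^ n
  ^-mono-≤ zero 0≤x x≤y = ≤-refl
  ^-mono-≤ (suc n) 0≤x x≤y = *-mono-≤ 0≤x x≤y (^-nonNeg n 0≤x) (^-mono-≤ n 0≤x x≤y)

  1^n : ∀ n → 1# ^ n ≈ 1#
  1^n zero = refl
  1^n (suc n) = trans (*-identityˡ _) (1^n n)

  2^ : ℕ → ℝ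
  2^ n = fromℕ 2 ^ n

  0<2 : 0# < fromℕ 2
  0<2 = fromℕ-pos 1

  1≤2 : 1# ≤ fromℕ 2
  1≤2 = ≤-via 0≤1 (solve 0 (# 2 := # 1 :+ # 1) refl)

  2^-pos : ∀ n → 0# < 2^ n
  2^-pos n = ^-pos n 0<2

  1≤2^ : ∀ n → 1# ≤ 2^ n
  1≤2^ n = 1≤^ n 1≤2

  2^-mono : ∀ {m n} → m ℕ.≤ n → 2^ m ≤ 2^ n
  2^-mono {m} {n} m≤n = ≤-respʳ (trans (sym (^-homo-* (fromℕ 2) m (n ℕ.∸ m))) (reflexive (≡.cong 2^ (ℕ.m+[n∸m]≡n m≤n))))
    (≤-respˡ (*-identityʳ _) (*-monoˡ-≤ (2^ m) (proj₁ (2^-pos m)) (1≤2^ (n ℕ.∸ m))))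

  fromℕ-2^ : ∀ n → fromℕ (2 ℕ.^ n) ≈ 2^ n
  fromℕ-2^ zero = fromℕ-1
  fromℕ-2^ (suc n) = trans (fromℕ-homo-* 2 (2 ℕ.^ n)) (*-congˡ (fromℕ-2^ n))

  fromℕ-homo-^ : ∀ m n → fromℕ (m ℕ.^ n) ≈ fromℕ m ^ n
  fromℕ-homo-^ m zero = fromℕ-1
  fromℕ-homo-^ m (suc n) = trans (fromℕ-homo-* m (m ℕ.^ n)) (*-congˡ (fromℕ-homo-^ m n))

  fromℕ≤2^ : ∀ n → fromℕ n ≤ 2^ n
  fromℕ≤2^ zero = 0≤1
  fromℕ≤2^ (suc n) = ≤-trans (+-mono-≤ (1≤2^ n) (fromℕ≤2^ n)) (≤-reflexive (solve 1 (λ x → x :+ x := # 2 :* x) refl (2^ n)))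

  ½ : ℝ
  ½ = fromℕ 2 ⁻¹

  2*½ : fromℕ 2 * ½ ≈ 1#
  2*½ = *-inverseʳ (>⇒≉ 0<2)

  0<½ : 0# < ½
  0<½ = ⁻¹-pos 0<2

  0≤½ : 0# ≤ ½
  0≤½ = proj₁ 0<½

  ½+½ : ½ + ½ ≈ 1#
  ½+½ = trans (solve 1 (λ x → x :+ x := # 2 :* x) refl ½) 2*½

  ½≤1 : ½ ≤ 1#
  ½≤1 = ≤-via 0≤½ (sym ½+½)

  2^*½^ : ∀ n → 2^ n * ½ ^ n ≈ 1#
  2^*½^ n = trans (sym (^-distrib-* (fromℕ 2) ½ n)) (trans (^-congˡ n 2*½) (1^n n))

  ½^-pos : ∀ n → 0# < ½ ^ n
  ½^-pos n = ^-pos n 0<½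

  ½^≤1 : ∀ n → ½ ^ n ≤ 1#
  ½^≤1 n = ^≤1 n 0≤½ ½≤1

  -- Were the naturals bounded by `x`, their supremum s would satisfy n + 1 ≤ s for all n, making s
  -- - 1 a smaller upper bound.
  archimedean : ∀ x → ∃ λ n → x ≤ fromℕ n
  archimedean x with dec (∃ λ n → x ≤ fromℕ n)
  ... | yes p = p
  ... | no ∄n = ⊥-elim (<⇒≱ 0<1 (≤-via {d = s - 1# - s} (0≤diff s≤s-1) (solve 1 (λ s → # 0 := # 1 :+ (s :- # 1 :- s)) refl s)))
    where
    N : ℝ → Set
    N y = ∃ λ n → y ≈ fromℕ n
    inhabited : ∃ N
    inhabited = 0# , 0 , refl
    bounded : ∃ (UpperBound N)
    bounded = x , λ (n , y≈n) → ≤-respˡ (sym y≈n) (≰⇒≥ λ x≤n → ∄n (n , x≤n))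
    s : ℝ
    s = sup N
    s≤s-1 : s ≤ s - 1#
    s≤s-1 = sup-least inhabited bounded λ {y} (n , y≈n) →
      ≤-via (0≤diff (sup-upper inhabited bounded (suc n , refl)))
        (trans (solve 2 (λ s n → s :- # 1 := n :+ (s :- (# 1 :+ n))) refl s (fromℕ n)) (+-congʳ (sym y≈n)))

  bernoulli : ∀ {x} n → 0# ≤ x → 1# + fromℕ n * x ≤ (1# + x) ^ n
  bernoulli {x} zero 0≤x = ≤-reflexive (solve 1 (λ x → # 1 :+ # 0 :* x := # 1) refl x)
  bernoulli {x} (suc n) 0≤x = ≤-trans
    (≤-via (*-nonNeg (*-nonNeg (fromℕ-nonNeg n) 0≤x) 0≤x)
      (solve 2 (λ x n → (# 1 :+ x) :* (# 1 :+ n :* x) := # 1 :+ (# 1 :+ n) :* x :+ n :* x :* x) refl x (fromℕ n)))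
    (*-monoˡ-≤ (1# + x) (+-nonNeg 0≤1 0≤x) (bernoulli n 0≤x))

  bernoulli⁻ : ∀ {x} n → 0# ≤ x → x ≤ 1# → 1# - fromℕ n * x ≤ (1# - x) ^ n
  bernoulli⁻ {x} zero 0≤x x≤1 = ≤-reflexive (solve 1 (λ x → # 1 :- # 0 :* x := # 1) refl x)
  bernoulli⁻ {x} (suc n) 0≤x x≤1 = ≤-trans
    (≤-via (*-nonNeg (*-nonNeg (fromℕ-nonNeg n) 0≤x) 0≤x)
      (solve 2 (λ x n → (# 1 :- x) :* (# 1 :- n :* x) := # 1 :- (# 1 :+ n) :* x :+ n :* x :* x) refl x (fromℕ n)))
    (*-monoˡ-≤ (1# - x) (0≤diff x≤1) (bernoulli⁻ n 0≤x x≤1))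

  -- (1-x)ⁿ (1+nx) ≤ (1-x²)ⁿ ≤ 1
  decay : ∀ {x} n → 0# ≤ x → x ≤ 1# → (1# - x) ^ n * (1# + fromℕ n * x) ≤ 1#
  decay {x} n 0≤x x≤1 = ≤-trans (*-monoˡ-≤ _ (^-nonNeg n (0≤diff x≤1)) (bernoulli n 0≤x))
    (≤-respˡ (^-distrib-* (1# - x) (1# + x) n)
      (^≤1 n (*-nonNeg (0≤diff x≤1) (+-nonNeg 0≤1 0≤x)) (≤-via (square-nonNeg x) (solve 1 (λ x → # 1 := (# 1 :- x) :* (# 1 :+ x) :+ x :* x) refl x))))

  -- An opaque copy of sum: unlike sum, it lets Agda infer the summand by unification.

  opaque

    ∑ : ∀ {n} → (Fin n → ℝ) → ℝ
    ∑ = sum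

    sum≈∑ : ∀ {n} (f : Fin n → ℝ) → sum f ≈ ∑ f
    sum≈∑ f = refl

    ∑-empty : ∀ {f : Fin 0 → ℝ} → ∑ f ≈ 0#
    ∑-empty = refl

    ∑-suc : ∀ {n} (f : Fin (suc n) → ℝ) → ∑ f ≈ f zero + ∑ (f ∘ suc)
    ∑-suc f = refl

    ∑-cong : ∀ {n} {f g : Fin n → ℝ} → (∀ i → f i ≈ g i) → ∑ f ≈ ∑ g
    ∑-cong = sum-cong-≋

    ∑-zero : ∀ {n} {f : Fin n → ℝ} → (∀ i → f i ≈ 0#) → ∑ f ≈ 0#
    ∑-zero {n} f≈0 = trans (∑-cong f≈0) (sum-replicate-zero n)

    ∑-mono : ∀ {n} {f g : Fin n → ℝ} → (∀ i → f i ≤ g i) → ∑ f ≤ ∑ g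
    ∑-mono {zero} f≤g = ≤-refl
    ∑-mono {suc n} f≤g = +-mono-≤ (f≤g zero) (∑-mono (f≤g ∘ suc))

    ∑-nonNeg : ∀ {n} {f : Fin n → ℝ} → (∀ i → 0# ≤ f i) → 0# ≤ ∑ f
    ∑-nonNeg {n} 0≤f = ≤-respˡ (sum-replicate-zero n) (∑-mono 0≤f)

    term≤∑ : ∀ {n} {f : Fin n → ℝ} → (∀ i → 0# ≤ f i) → ∀ i → f i ≤ ∑ f
    term≤∑ 0≤f zero = ≤-via (∑-nonNeg (0≤f ∘ suc)) refl
    term≤∑ {f = f} 0≤f (suc i) = ≤-trans (term≤∑ (0≤f ∘ suc) i) (≤-via (0≤f zero) (+-comm _ _))

    ∑-zero⇒ : ∀ {n} {f : Fin n → ℝ} → (∀ i → 0# ≤ f i) → ∑ f ≈ 0# → ∀ i → f i ≈ 0#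
    ∑-zero⇒ 0≤f Σ≈0 i = antisym (≤-respʳ Σ≈0 (term≤∑ 0≤f i)) (0≤f i)

    *-∑ˡ : ∀ {n} c (f : Fin n → ℝ) → c * ∑ f ≈ ∑ λ i → c * f i
    *-∑ˡ = *-distribˡ-sum

    *-∑ʳ : ∀ {n} c (f : Fin n → ℝ) → ∑ f * c ≈ ∑ λ i → f i * c
    *-∑ʳ = *-distribʳ-sum

    ∑-+ : ∀ {n} (f g : Fin n → ℝ) → ∑ (λ i → f i + g i) ≈ ∑ f + ∑ g
    ∑-+ f g = sum-distrib-+ f g

    ∑-comm : ∀ {m n} (f : Fin m → Fin n → ℝ) → ∑ (λ i → ∑ λ j → f i j) ≈ ∑ (λ j → ∑ λ i → f i j)
    ∑-comm f = sum-comm f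

    ∑-neg : ∀ {n} (f : Fin n → ℝ) → - ∑ f ≈ ∑ λ i → - f i
    ∑-neg {zero} f = -0#≈0#
    ∑-neg {suc n} f = trans (sym (-‿+-comm _ _)) (+-congˡ (∑-neg (f ∘ suc)))

  -- Bounds on absolute values

  infix 4 _within_
  -- Two linear inequalities in place of an absolute value: sums and nonnegative multiples need no
  -- case distinction.
  _within_ : ℝ → ℝ → Set
  x within e = x ≤ e × - x ≤ e

  within-cong : ∀ {x y e} → x ≈ y → x within e → y within e
  within-cong x≈y (p , q) = ≤-respˡ x≈y p , ≤-respˡ (-‿cong x≈y) q

  within-mono : ∀ {x d e} → d ≤ e → x within d → x within e
  within-mono d≤e (p , q) = ≤-trans p d≤e , ≤-trans q d≤e

  within-0 : ∀ {e} → 0# ≤ e → 0# within e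
  within-0 0≤e = 0≤e , ≤-respˡ (sym -0#≈0#) 0≤e

  within-+ : ∀ {x y d e} → x within d → y within e → (x + y) within (d + e)
  within-+ (p , q) (r , s) = +-mono-≤ p r , ≤-respˡ (-‿+-comm _ _) (+-mono-≤ q s)

  within-* : ∀ {x e} c → 0# ≤ c → x within e → (c * x) within (c * e)
  within-* c 0≤c (p , q) = *-monoˡ-≤ c 0≤c p , ≤-respˡ (sym (-‿distribʳ-* c _)) (*-monoˡ-≤ c 0≤c q)

  within-neg : ∀ {x e} → x within e → (- x) within e
  within-neg (p , q) = q , ≤-respˡ (sym (-‿involutive _)) p

  opaque
    unfolding ∑

    within-∑ : ∀ {n} {f e : Fin n → ℝ} → (∀ i → f i within e i) → ∑ f within ∑ e
    within-∑ {zero} w = within-0 ≤-refl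
    within-∑ {suc n} w = within-+ (w zero) (within-∑ (w ∘ suc))

  square≤⇒within : ∀ {x e} → 0# ≤ e → x * x ≤ e * e → x within e
  square≤⇒within {x} 0≤e xx≤ee = square-cancel-≤ 0≤e xx≤ee ,
    square-cancel-≤ 0≤e (≤-respˡ (solve 1 (λ x → x :* x := :- x :* :- x) refl x) xx≤ee)

  within-product : ∀ {x y} → x within 1# → y within 1# → (x * y) within 1#
  within-product {x} {y} (x≤1 , -x≤1) (y≤1 , -y≤1) = square≤⇒within 0≤1
    (≤-respˡ (solve 2 (λ x y → x :* x :* (y :* y) := x :* y :* (x :* y)) refl x y) (*-mono-≤ (square-nonNeg x) (sq x≤1 -x≤1) (square-nonNeg y) (sq y≤1 -y≤1)))
    where
    sq : ∀ {z} → z ≤ 1# → - z ≤ 1# → z * z ≤ 1#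
    sq {z} z≤1 -z≤1 = ≤-via (*-nonNeg (0≤diff z≤1) (0≤diff -z≤1)) (solve 1 (λ z → # 1 := z :* z :+ (# 1 :- z) :* (# 1 :- :- z)) refl z)

  -- Functions dominated by deterministic protocols

  ∑∑-cong : ∀ {m n} {f g : Fin m → Fin n → ℝ} → (∀ i j → f i j ≈ g i j) → (∑ λ i → ∑ λ j → f i j) ≈ (∑ λ i → ∑ λ j → g i j)
  ∑∑-cong f≈g = ∑-cong λ i → ∑-cong λ j → f≈g i j

  ∑∑-mono : ∀ {m n} {f g : Fin m → Fin n → ℝ} → (∀ i j → f i j ≤ g i j) → (∑ λ i → ∑ λ j → f i j) ≤ (∑ λ i → ∑ λ j → g i j)
  ∑∑-mono f≤g = ∑-mono λ i → ∑-mono λ j → f≤g i j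

  ∑∑-+ : ∀ {m n} (f g : Fin m → Fin n → ℝ) →
    (∑ λ i → ∑ λ j → f i j + g i j) ≈ (∑ λ i → ∑ λ j → f i j) + (∑ λ i → ∑ λ j → g i j)
  ∑∑-+ f g = trans (∑-cong {f = λ i → ∑ λ j → f i j + g i j} {λ i → ∑ (f i) + ∑ (g i)} λ i → ∑-+ (f i) (g i))
    (∑-+ (λ i → ∑ (f i)) (λ i → ∑ (g i)))

  ∑∑-*ˡ : ∀ {m n} c (f : Fin m → Fin n → ℝ) → c * (∑ λ i → ∑ λ j → f i j) ≈ (∑ λ i → ∑ λ j → c * f i j)
  ∑∑-*ˡ c f = trans (*-∑ˡ c (λ i → ∑ (f i))) (∑-cong {f = λ i → c * ∑ (f i)} {λ i → ∑ λ j → c * f i j} λ i → *-∑ˡ c (f i))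

  ∑₂ : (f : Fin 2 → ℝ) → ∑ f ≈ f zero + f (suc zero)
  ∑₂ f = trans (∑-suc f) (+-congˡ (trans (∑-suc (f ∘ suc)) (trans (+-congˡ ∑-empty) (+-identityʳ _))))

  ∑-affine : ∀ {n} (α f g : Fin n → ℝ) → ∑ (λ i → α i * f i + (1# - α i) * g i) ≈ ∑ (λ i → α i * f i) + ∑ (λ i → (1# - α i) * g i)
  ∑-affine α f g = ∑-+ (λ i → α i * f i) (λ i → (1# - α i) * g i)

  -- Maxima, averages and indicator functions

  maximum : ∀ {n} (z : Fin (suc n) → ℝ) → ∃ λ i → ∀ j → z j ≤ z i
  maximum {zero} z = zero , λ { zero → ≤-refl }
  maximum {suc n} z with maximum (z ∘ suc)
  ... | i , max with total (z zero) (z (suc i))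
  ... | inj₁ z₀≤zᵢ = suc i , λ { zero → z₀≤zᵢ ; (suc j) → max j }
  ... | inj₂ zᵢ≤z₀ = zero , λ { zero → ≤-refl ; (suc j) → ≤-trans (max j) zᵢ≤z₀ }

  -- This is how public coins are fixed: against a linear functional some outcome does at least as
  -- well as the average.
  average≤some : ∀ {n} (v z : Fin n → ℝ) → (∀ i → 0# ≤ v i) → ∑ v ≈ 1# → ∃ λ i → ∑ (λ j → v j * z j) ≤ z i
  average≤some {zero} v z 0≤v Σv≈1 = ⊥-elim (0≉1 (trans (sym ∑-empty) Σv≈1))
  average≤some {suc n} v z 0≤v Σv≈1 with maximum z
  ... | i , max = i , ≤-trans (∑-mono λ j → *-monoˡ-≤ (v j) (0≤v j) (max j))
    (≤-reflexive (trans (sym (*-∑ʳ (z i) v)) (trans (*-congʳ Σv≈1) (*-identityˡ _))))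

  average₂≤max : ∀ {c a b m} → 0# ≤ c → c ≤ 1# → a ≤ m → b ≤ m → c * a + (1# - c) * b ≤ m
  average₂≤max {c} {m = m} 0≤c c≤1 a≤m b≤m =
    ≤-trans (+-mono-≤ (*-monoˡ-≤ c 0≤c a≤m) (*-monoˡ-≤ _ (0≤diff c≤1) b≤m)) (≤-reflexive (solve 2 (λ c m → c :* m :+ (# 1 :- c) :* m := m) refl c m))

  bounded : ∀ {n} (f : Fin n → ℕ) → ∃ λ b → ∀ i → f i ℕ.≤ b
  bounded {zero} f = 0 , λ ()
  bounded {suc n} f with bounded (f ∘ suc)
  ... | b , f≤b = f zero ℕ.⊔ b , λ { zero → ℕ.m≤m⊔n _ _ ; (suc i) → ℕ.≤-trans (f≤b i) (ℕ.m≤n⊔m _ _) }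

  indicator : ∀ {P : Set} → Dec P → ℝ
  indicator (yes _) = 1#
  indicator (no _) = 0#

  indicator-nonNeg : ∀ {P : Set} (P? : Dec P) → 0# ≤ indicator P?
  indicator-nonNeg (yes _) = 0≤1
  indicator-nonNeg (no _) = ≤-refl

  indicator≤1 : ∀ {P : Set} (P? : Dec P) → indicator P? ≤ 1#
  indicator≤1 (yes _) = ≤-refl
  indicator≤1 (no _) = 0≤1

  extended : ∀ {ε} → ε within 1# → ∀ n i (e : ℝ) → e within 1# → (n ℕ.≤ i → e ≈ 0#) → (e + ε * indicator (n ℕ.≟ i)) within 1#
  extended {ε} ε≤1 n i e e≤1 e-zero with n ℕ.≟ i
  ... | yes ≡.refl = within-cong (sym (trans (+-congʳ (e-zero ℕ.≤-refl)) (solve 1 (λ x → # 0 :+ x :* # 1 := x) refl ε))) ε≤1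
  ... | no _ = within-cong (sym (solve 2 (λ e x → e :+ x :* # 0 := e) refl e ε)) e≤1

  extended-zero : ∀ ε n i (e : ℝ) → (n ℕ.≤ i → e ≈ 0#) → suc n ℕ.≤ i → e + ε * indicator (n ℕ.≟ i) ≈ 0#
  extended-zero ε n i e e-zero n<i with n ℕ.≟ i
  ... | yes ≡.refl = ⊥-elim (ℕ.n≮n _ n<i)
  ... | no _ = trans (+-congʳ (e-zero (ℕ.<⇒≤ n<i))) (solve 1 (λ x → # 0 :+ x :* # 0 := # 0) refl ε)

  -- The equality matrix restricted to indices below `n`, which the greedy choice of signs extends
  -- one index at a time.
  diagonal : ℕ → ℕ → ℕ → ℝ
  diagonal n i k = indicator (i ℕ.≟ k) * indicator (i ℕ.<? n)

  diagonal-suc : ∀ n i k → diagonal (suc n) i k ≈ diagonal n i k + indicator (n ℕ.≟ i) * indicator (n ℕ.≟ k)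
  diagonal-suc n i k with n ℕ.≟ i | i ℕ.<? suc n | i ℕ.<? n
  ... | yes ≡.refl | _ | yes n<n = ⊥-elim (ℕ.n≮n _ n<n)
  ... | yes ≡.refl | no n≮ | _ = ⊥-elim (n≮ ℕ.≤-refl)
  ... | yes ≡.refl | yes _ | no _ = solve 1 (λ a → a :* # 1 := a :* # 0 :+ # 1 :* a) refl (indicator (n ℕ.≟ k))
  ... | no _ | yes _ | yes _ = solve 2 (λ a b → a :* # 1 := a :* # 1 :+ # 0 :* b) refl (indicator (i ℕ.≟ k)) (indicator (n ℕ.≟ k))
  ... | no _ | no _ | no _ = solve 2 (λ a b → a :* # 0 := a :* # 0 :+ # 0 :* b) refl (indicator (i ℕ.≟ k)) (indicator (n ℕ.≟ k))
  ... | no n≢i | yes p | no ¬p = ⊥-elim (n≢i (ℕ.≤-antisym (ℕ.≮⇒≥ ¬p) (ℕ.s≤s⁻¹ p)))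
  ... | no _ | no ¬p | yes p = ⊥-elim (¬p (ℕ.m≤n⇒m≤1+n p))

  diagonal-large : ∀ {n i} k → i ℕ.< n → diagonal n i k ≈ indicator (i ℕ.≟ k)
  diagonal-large {n} {i} k i<n with i ℕ.<? n
  ... | yes _ = *-identityʳ _
  ... | no i≮n = ⊥-elim (i≮n i<n)

  orientation : ∀ z → ∃ λ ε → ε within 1# × ε * ε ≈ 1# × 0# ≤ ε * z
  orientation z with total 0# z
  ... | inj₁ 0≤z = 1# , (≤-refl , ≤-via (proj₁ 0<2) (solve 0 (# 1 := :- # 1 :+ # 2) refl)) , *-identityˡ 1# , ≤-respʳ (sym (*-identityˡ _)) 0≤z
  ... | inj₂ z≤0 = - 1# , (≤-via (proj₁ 0<2) (solve 0 (# 1 := :- # 1 :+ # 2) refl) , ≤-reflexive (-‿involutive 1#)) , solve 0 (:- # 1 :* :- # 1 := # 1) refl ,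
                   ≤-respʳ (solve 1 (λ c → :- c := :- # 1 :* c) refl z) (nonPos-neg z≤0)

  module Simulation (nx ny : ℕ) where

    X Y : Set
    X = Fin nx
    Y = Fin ny

    Matrix : Set
    Matrix = X → Y → ℝ

    DetTree : Set
    DetTree = Tree (X × Fin 1) (Y × Fin 1)

    val : DetTree → Matrix
    val t x y = sign (toℕ (run t (x , zero) (y , zero)))

    ⟨_,_⟩ : Matrix → Matrix → ℝ
    ⟨ w , g ⟩ = ∑ λ x → ∑ λ y → w x y * g x y

    ⟨⟩-cong : ∀ {w w′ g g′} → (∀ x y → w x y * g x y ≈ w′ x y * g′ x y) → ⟨ w , g ⟩ ≈ ⟨ w′ , g′ ⟩
    ⟨⟩-cong = ∑∑-cong

    -- Every real combination w of the entries of g is dominated by one deterministic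
    -- protocol, i.e. g lies in the convex hull of the sign matrices of such protocols.
    -- This formulation replaces random coins by a choice depending on w.
    Sim : ℕ → Matrix → Set
    Sim T g = ∀ w → ∃ λ t → depth t ℕ.≤ T × ⟨ w , g ⟩ ≤ ⟨ w , val t ⟩

    sim-cong : ∀ {T g g′} → (∀ x y → g x y ≈ g′ x y) → Sim T g → Sim T g′
    sim-cong g≈g′ sim w with sim w
    ... | t , d , le = t , d , ≤-respˡ (⟨⟩-cong λ x y → *-congˡ (g≈g′ x y)) le

    sim-mono : ∀ {T T′ g} → T ℕ.≤ T′ → Sim T g → Sim T′ g
    sim-mono T≤T′ sim w with sim w
    ... | t , d , le = t , ℕ.≤-trans d T≤T′ , le

    sim-1 : Sim 0 λ _ _ → 1#
    sim-1 w = output zero , z≤n , ≤-refl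

    sim-−1 : Sim 0 λ _ _ → - 1#
    sim-−1 w = output (suc zero) , z≤n , ≤-reflexive (⟨⟩-cong λ x y → *-congˡ (sym (*-identityʳ _)))

    ⟨⟩-average : ∀ {n} (v : Fin n → ℝ) (g : Fin n → Matrix) w → ⟨ w , (λ x y → ∑ λ i → v i * g i x y) ⟩ ≈ ∑ λ i → v i * ⟨ w , g i ⟩
    ⟨⟩-average v g w = begin
      (∑ λ x → ∑ λ y → w x y * ∑ λ i → v i * g i x y)
        ≈⟨ ∑∑-cong (λ x y → trans (*-∑ˡ (w x y) _) (∑-cong λ i → solve 3 (λ w v g → w :* (v :* g) := v :* (w :* g)) refl (w x y) (v i) (g i x y))) ⟩
      (∑ λ x → ∑ λ y → ∑ λ i → v i * (w x y * g i x y))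
        ≈⟨ ∑-cong (λ x → ∑-comm λ y i → v i * (w x y * g i x y)) ⟩
      (∑ λ x → ∑ λ i → ∑ λ y → v i * (w x y * g i x y))
        ≈⟨ ∑-comm (λ x i → ∑ λ y → v i * (w x y * g i x y)) ⟩
      (∑ λ i → ∑ λ x → ∑ λ y → v i * (w x y * g i x y))
        ≈⟨ ∑-cong (λ i → sym (∑∑-*ˡ (v i) _)) ⟩
      (∑ λ i → v i * ⟨ w , g i ⟩) ∎
      where open SetoidReasoning setoid

    sim-average : ∀ {T n} (v : Fin n → ℝ) (g : Fin n → Matrix) → (∀ i → 0# ≤ v i) → ∑ v ≈ 1# →
      (∀ i → Sim T (g i)) → Sim T λ x y → ∑ λ i → v i * g i x y
    sim-average v g 0≤v Σv≈1 sims w with average≤some v (λ i → ⟨ w , g i ⟩) 0≤v Σv≈1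
    ... | i , le with sims i w
    ... | t , d , le′ = t , d , ≤-trans (≤-reflexive (⟨⟩-average v g w)) (≤-trans le le′)

    sim-mix : ∀ {T g₀ g₁} c → 0# ≤ c → c ≤ 1# → Sim T g₀ → Sim T g₁ → Sim T λ x y → c * g₀ x y + (1# - c) * g₁ x y
    sim-mix {g₀ = g₀} {g₁} c 0≤c c≤1 sim₀ sim₁ =
      sim-cong (λ x y → ∑₂ _)
        (sim-average (λ { zero → c ; (suc _) → 1# - c }) (λ { zero → g₀ ; (suc _) → g₁ })
          (λ { zero → 0≤c ; (suc _) → 0≤diff c≤1 }) (trans (∑₂ _) (solve 1 (λ c → c :+ (# 1 :- c) := # 1) refl c))
          (λ { zero → sim₀ ; (suc zero) → sim₁ }))

    sim-0 : Sim 0 λ _ _ → 0#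
    sim-0 = sim-cong (λ _ _ → trans (+-congˡ (*-congʳ (trans (+-congʳ (sym ½+½)) (solve 1 (λ h → h :+ h :- h := h) refl ½)))) (solve 1 (λ h → h :* # 1 :+ h :* :- # 1 := # 0) refl ½))
      (sim-mix ½ 0≤½ ½≤1 sim-1 sim-−1)

    choice : ℝ → ℝ → Bit
    choice a b with total a b
    ... | inj₁ _ = suc zero
    ... | inj₂ _ = zero

    choice-max : ∀ a b → a ≤ choose (choice a b) a b × b ≤ choose (choice a b) a b
    choice-max a b with total a b
    ... | inj₁ a≤b = a≤b , ≤-refl
    ... | inj₂ b≤a = ≤-refl , b≤a

    -- The subtrees are chosen against the functional weighted by `α` and by `1 - α`. Each row x
    -- then takes the subtree with the larger row value, which is at least the mean of the two under
    -- `α x`. A private coin thus becomes a function of x.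
    sim-alice : ∀ {T g₀ g₁} (α : X → ℝ) → (∀ x → 0# ≤ α x) → (∀ x → α x ≤ 1#) → Sim T g₀ → Sim T g₁ →
      Sim (suc T) λ x y → α x * g₀ x y + (1# - α x) * g₁ x y
    sim-alice {T} {g₀} {g₁} α 0≤α α≤1 sim₀ sim₁ w
      with sim₀ (λ x y → α x * w x y) | sim₁ (λ x y → (1# - α x) * w x y)
    ... | t₀ , d₀ , le₀ | t₁ , d₁ , le₁ = t , s≤s (ℕ.⊔-lub d₀ d₁) , (begin
      (∑ λ x → ∑ λ y → w x y * (α x * g₀ x y + (1# - α x) * g₁ x y))
        ≈⟨ ∑∑-cong (λ x y → solve 4 (λ w a g h → w :* (a :* g :+ (# 1 :- a) :* h) := a :* w :* g :+ (# 1 :- a) :* w :* h) refl (w x y) (α x) (g₀ x y) (g₁ x y)) ⟩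
      (∑ λ x → ∑ λ y → α x * w x y * g₀ x y + (1# - α x) * w x y * g₁ x y)
        ≈⟨ ∑∑-+ _ _ ⟩
      ⟨ (λ x y → α x * w x y) , g₀ ⟩ + ⟨ (λ x y → (1# - α x) * w x y) , g₁ ⟩
        ≤⟨ +-mono-≤ le₀ le₁ ⟩
      ⟨ (λ x y → α x * w x y) , val t₀ ⟩ + ⟨ (λ x y → (1# - α x) * w x y) , val t₁ ⟩
        ≈⟨ +-cong (∑-cong λ x → trans (∑-cong λ y → *-assoc _ _ _) (sym (*-∑ˡ (α x) _)))
                  (∑-cong λ x → trans (∑-cong λ y → *-assoc _ _ _) (sym (*-∑ˡ (1# - α x) _))) ⟩
      (∑ λ x → α x * z t₀ x) + (∑ λ x → (1# - α x) * z t₁ x)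
        ≈⟨ sym (∑-affine α (z t₀) (z t₁)) ⟩
      (∑ λ x → α x * z t₀ x + (1# - α x) * z t₁ x)
        ≤⟨ ∑-mono (λ x → average₂≤max (0≤α x) (α≤1 x) (proj₁ (choice-max (z t₀ x) (z t₁ x))) (proj₂ (choice-max (z t₀ x) (z t₁ x)))) ⟩
      (∑ λ x → choose (s x) (z t₀ x) (z t₁ x))
        ≈⟨ ∑-cong (λ x → reflexive (lemma x)) ⟩
      (∑ λ x → z t x) ∎)
      where
      open ≤R
      z : DetTree → X → ℝ
      z t x = ∑ λ y → w x y * val t x y
      s : X → Bit
      s x = choice (z t₀ x) (z t₁ x)
      t : DetTree
      t = alice (λ (x , _) → s x) t₀ t₁
      lemma : ∀ x → choose (s x) (z t₀ x) (z t₁ x) ≡ z t x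
      lemma x with s x
      ... | zero = ≡.refl
      ... | suc _ = ≡.refl

    sim-bob : ∀ {T g₀ g₁} (β : Y → ℝ) → (∀ y → 0# ≤ β y) → (∀ y → β y ≤ 1#) → Sim T g₀ → Sim T g₁ →
      Sim (suc T) λ x y → β y * g₀ x y + (1# - β y) * g₁ x y
    sim-bob {T} {g₀} {g₁} β 0≤β β≤1 sim₀ sim₁ w
      with sim₀ (λ x y → β y * w x y) | sim₁ (λ x y → (1# - β y) * w x y)
    ... | t₀ , d₀ , le₀ | t₁ , d₁ , le₁ = t , s≤s (ℕ.⊔-lub d₀ d₁) , (begin
      (∑ λ x → ∑ λ y → w x y * (β y * g₀ x y + (1# - β y) * g₁ x y))
        ≈⟨ ∑∑-cong (λ x y → solve 4 (λ w a g h → w :* (a :* g :+ (# 1 :- a) :* h) := a :* w :* g :+ (# 1 :- a) :* w :* h) refl (w x y) (β y) (g₀ x y) (g₁ x y)) ⟩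
      (∑ λ x → ∑ λ y → β y * w x y * g₀ x y + (1# - β y) * w x y * g₁ x y)
        ≈⟨ ∑∑-+ _ _ ⟩
      ⟨ (λ x y → β y * w x y) , g₀ ⟩ + ⟨ (λ x y → (1# - β y) * w x y) , g₁ ⟩
        ≤⟨ +-mono-≤ le₀ le₁ ⟩
      ⟨ (λ x y → β y * w x y) , val t₀ ⟩ + ⟨ (λ x y → (1# - β y) * w x y) , val t₁ ⟩
        ≈⟨ +-cong (∑-comm λ x y → β y * w x y * val t₀ x y) (∑-comm λ x y → (1# - β y) * w x y * val t₁ x y) ⟩
      (∑ λ y → ∑ λ x → β y * w x y * val t₀ x y) + (∑ λ y → ∑ λ x → (1# - β y) * w x y * val t₁ x y)
        ≈⟨ +-cong (∑-cong λ y → trans (∑-cong λ x → *-assoc _ _ _) (sym (*-∑ˡ (β y) _)))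
                  (∑-cong λ y → trans (∑-cong λ x → *-assoc _ _ _) (sym (*-∑ˡ (1# - β y) _))) ⟩
      (∑ λ y → β y * z t₀ y) + (∑ λ y → (1# - β y) * z t₁ y)
        ≈⟨ sym (∑-affine β (z t₀) (z t₁)) ⟩
      (∑ λ y → β y * z t₀ y + (1# - β y) * z t₁ y)
        ≤⟨ ∑-mono (λ y → average₂≤max (0≤β y) (β≤1 y) (proj₁ (choice-max (z t₀ y) (z t₁ y))) (proj₂ (choice-max (z t₀ y) (z t₁ y)))) ⟩
      (∑ λ y → choose (s y) (z t₀ y) (z t₁ y))
        ≈⟨ ∑-cong (λ y → reflexive (lemma y)) ⟩
      (∑ λ y → z t y)
        ≈⟨ ∑-comm (λ y x → w x y * val t x y) ⟩
      ⟨ w , val t ⟩ ∎)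
      where
      open ≤R
      z : DetTree → Y → ℝ
      z t y = ∑ λ x → w x y * val t x y
      s : Y → Bit
      s y = choice (z t₀ y) (z t₁ y)
      t : DetTree
      t = bob (λ (y , _) → s y) t₀ t₁
      lemma : ∀ y → choose (s y) (z t₀ y) (z t₁ y) ≡ z t y
      lemma y with s y
      ... | zero = ≡.refl
      ... | suc _ = ≡.refl

    -- An index outside the lower half is sent to the junk value 0, so that the bound of the
    -- recursive call holds for every input; such inputs carry weight 0 there.
    below : ℕ → ℕ → ℕ
    below b i with i ℕ.<? b
    ... | yes _ = i
    ... | no _ = 0

    below< : ∀ b i → 0 ℕ.< b → below b i ℕ.< b
    below< b i 0<b with i ℕ.<? b
    ... | yes i<b = i<b
    ... | no _ = 0<b

    monus< : ∀ k i → i ℕ.< k ℕ.+ (k ℕ.+ 0) → 0 ℕ.< k → i ℕ.∸ k ℕ.< k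
    monus< k i i<2k 0<k with i ℕ.<? k
    ... | yes i<k = ℕ.≤-<-trans (ℕ.m∸n≤m i k) i<k
    ... | no i≮k = ℕ.+-cancelˡ-< k (i ℕ.∸ k) k (≡.subst₂ ℕ._<_ (≡.sym (ℕ.m+[n∸m]≡n (ℕ.≮⇒≥ i≮k))) (≡.cong (k ℕ.+_) (ℕ.+-identityʳ k)) i<2k)

    select-eq : ∀ k i (G : ℕ → ℝ) → indicator (i ℕ.<? k) * G (below k i) + (1# - indicator (i ℕ.<? k)) * G (k ℕ.+ (i ℕ.∸ k)) ≈ G i
    select-eq k i G with i ℕ.<? k
    ... | yes _ = solve 2 (λ g h → # 1 :* g :+ (# 1 :- # 1) :* h := g) refl (G i) (G (k ℕ.+ (i ℕ.∸ k)))
    ... | no i≮k = trans (solve 2 (λ g h → # 0 :* g :+ (# 1 :- # 0) :* h := h) refl (G 0) (G (k ℕ.+ (i ℕ.∸ k)))) (reflexive (≡.cong G (ℕ.m+[n∸m]≡n (ℕ.≮⇒≥ i≮k))))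

    -- Alice announces `τ x` in binary, highest bit first; every bit halves the range of indices.
    sim-select-alice : ∀ {T} ℓ (G : ℕ → Matrix) (τ : X → ℕ) → (∀ x → τ x ℕ.< 2 ℕ.^ ℓ) → (∀ i → Sim T (G i)) →
      Sim (ℓ ℕ.+ T) λ x y → G (τ x) x y
    sim-select-alice zero G τ τ<1 sims = sim-cong (λ x y → reflexive (≡.cong (λ i → G i x y) (≡.sym (ℕ.n<1⇒n≡0 (τ<1 x))))) (sims 0)
    sim-select-alice (suc ℓ) G τ τ<2k sims = sim-cong (λ x y → select-eq k (τ x) (λ i → G i x y))
      (sim-alice (λ x → indicator (τ x ℕ.<? k)) (λ x → indicator-nonNeg (τ x ℕ.<? k)) (λ x → indicator≤1 (τ x ℕ.<? k))
        (sim-select-alice ℓ G (λ x → below k (τ x)) (λ x → below< k (τ x) 0<k) sims)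
        (sim-select-alice ℓ (λ i → G (k ℕ.+ i)) (λ x → τ x ℕ.∸ k) (λ x → monus< k (τ x) (τ<2k x) 0<k) (λ i → sims (k ℕ.+ i))))
      where
      k : ℕ
      k = 2 ℕ.^ ℓ
      0<k : 0 ℕ.< k
      0<k = ℕ.m^n>0 2 ℓ

    sim-select-bob : ∀ {T} ℓ (G : ℕ → Matrix) (τ : Y → ℕ) → (∀ y → τ y ℕ.< 2 ℕ.^ ℓ) → (∀ i → Sim T (G i)) →
      Sim (ℓ ℕ.+ T) λ x y → G (τ y) x y
    sim-select-bob zero G τ τ<1 sims = sim-cong (λ x y → reflexive (≡.cong (λ i → G i x y) (≡.sym (ℕ.n<1⇒n≡0 (τ<1 y))))) (sims 0)
    sim-select-bob (suc ℓ) G τ τ<2k sims = sim-cong (λ x y → select-eq k (τ y) (λ i → G i x y))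
      (sim-bob (λ y → indicator (τ y ℕ.<? k)) (λ y → indicator-nonNeg (τ y ℕ.<? k)) (λ y → indicator≤1 (τ y ℕ.<? k))
        (sim-select-bob ℓ G (λ y → below k (τ y)) (λ y → below< k (τ y) 0<k) sims)
        (sim-select-bob ℓ (λ i → G (k ℕ.+ i)) (λ y → τ y ℕ.∸ k) (λ y → monus< k (τ y) (τ<2k y) 0<k) (λ i → sims (k ℕ.+ i))))
      where
      k : ℕ
      k = 2 ℕ.^ ℓ
      0<k : 0 ℕ.< k
      0<k = ℕ.m^n>0 2 ℓ

    -- Both depths are announced in full, after which both players know the common continuation.
    sim-min : ∀ {T} ℓ (H : ℕ → Matrix) (τ : X → ℕ) (σ : Y → ℕ) → (∀ x → τ x ℕ.< 2 ℕ.^ ℓ) → (∀ y → σ y ℕ.< 2 ℕ.^ ℓ) →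
      (∀ i → Sim T (H i)) → Sim (ℓ ℕ.+ (ℓ ℕ.+ T)) λ x y → H (τ x ℕ.⊓ σ y) x y
    sim-min ℓ H τ σ τ< σ< sims =
      sim-select-alice ℓ (λ s x y → H (s ℕ.⊓ σ y) x y) τ τ< λ s →
        sim-select-bob ℓ (λ t → H (s ℕ.⊓ t)) σ σ< λ t → sims (s ℕ.⊓ t)

    half-shift : ∀ {z} → z within 1# → 0# ≤ ½ * (1# + z) × ½ * (1# + z) ≤ 1#
    half-shift {z} (z≤1 , -z≤1) =
      *-nonNeg 0≤½ (≤-via (0≤diff -z≤1) (solve 1 (λ z → # 1 :+ z := # 0 :+ (# 1 :- :- z)) refl z)) ,
      ≤-respʳ (trans (*-comm _ _) 2*½) (*-monoˡ-≤ ½ 0≤½ (≤-via (0≤diff z≤1) (solve 1 (λ z → # 2 := # 1 :+ z :+ (# 1 :- z)) refl z)))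

    half-shift-eq : ∀ z g → ½ * (1# + z) * g + (1# - ½ * (1# + z)) * (- g) ≈ z * g
    half-shift-eq z g = trans (solve 3 (λ h z g → h :* (# 1 :+ z) :* g :+ (# 1 :- h :* (# 1 :+ z)) :* :- g := # 2 :* h :* g :+ # 2 :* h :* (z :* g) :- g) refl ½ z g)
      (trans (+-congʳ (+-cong (*-congʳ 2*½) (*-congʳ 2*½))) (solve 2 (λ z g → # 1 :* g :+ # 1 :* (z :* g) :- g := z :* g) refl z g))

    -- A number in [-1, 1] is the mean of a random sign of bias 1 + φ over 2; each player sends one
    -- such sign, and the signs are independent.
    sim-product : ∀ {φ : X → ℝ} {ψ : Y → ℝ} → (∀ x → φ x within 1#) → (∀ y → ψ y within 1#) → Sim 2 λ x y → φ x * ψ y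
    sim-product {φ} {ψ} φ≤1 ψ≤1 = sim-cong (λ x y → half-shift-eq (φ x) (ψ y))
      (sim-alice (λ x → ½ * (1# + φ x)) (λ x → proj₁ (half-shift (φ≤1 x))) (λ x → proj₂ (half-shift (φ≤1 x)))
        (sim-ψ ψ≤1)
        (sim-ψ λ y → within-neg (ψ≤1 y)))
      where
      sim-ψ : ∀ {ψ : Y → ℝ} → (∀ y → ψ y within 1#) → Sim 1 λ x y → ψ y
      sim-ψ {ψ} ψ≤1 = sim-cong (λ x y → trans (half-shift-eq (ψ y) 1#) (*-identityʳ _))
        (sim-bob (λ y → ½ * (1# + ψ y)) (λ y → proj₁ (half-shift (ψ≤1 y))) (λ y → proj₂ (half-shift (ψ≤1 y))) sim-1 sim-−1)

    -- The signs ε are chosen greedily, so that ε_{j x} ε_{k y} correlates with u at least as well as [j x = k y] does.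
    record Signs (u : Matrix) (j : X → ℕ) (k : Y → ℕ) (n : ℕ) : Set where
      field
        e : X → ℝ
        e′ : Y → ℝ
        e≤1 : ∀ x → e x within 1#
        e′≤1 : ∀ y → e′ y within 1#
        e-zero : ∀ x → n ℕ.≤ j x → e x ≈ 0#
        e′-zero : ∀ y → n ℕ.≤ k y → e′ y ≈ 0#
        dominates : ⟨ u , (λ x y → diagonal n (j x) (k y)) ⟩ ≤ ⟨ u , (λ x y → e x * e′ y) ⟩

    -- Giving block `n` the sign ε adds the diagonal term of this block, because ε² = 1, and ε times
    -- its cross terms with the earlier blocks. The latter are made nonnegative by `orientation`.
    signs-suc : ∀ {u j k n} → Signs u j k n → Signs u j k (suc n)
    signs-suc {u} {j} {k} {n} S = record
      { e = λ x → e x + ε * a x ; e′ = λ y → e′ y + ε * a′ y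
      ; e≤1 = λ x → extended ε≤1 n (j x) (e x) (e≤1 x) (e-zero x)
      ; e′≤1 = λ y → extended ε≤1 n (k y) (e′ y) (e′≤1 y) (e′-zero y)
      ; e-zero = λ x → extended-zero ε n (j x) (e x) (e-zero x)
      ; e′-zero = λ y → extended-zero ε n (k y) (e′ y) (e′-zero y)
      ; dominates = dom }
      where
      open Signs S
      a : X → ℝ
      a x = indicator (n ℕ.≟ j x)
      a′ : Y → ℝ
      a′ y = indicator (n ℕ.≟ k y)
      cross : ℝ
      cross = ⟨ u , (λ x y → e x * a′ y + a x * e′ y) ⟩
      ε : ℝ
      ε = proj₁ (orientation cross)
      ε≤1 : ε within 1#
      ε≤1 = proj₁ (proj₂ (orientation cross))
      ε² : ε * ε ≈ 1#
      ε² = proj₁ (proj₂ (proj₂ (orientation cross)))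
      0≤ε*cross : 0# ≤ ε * cross
      0≤ε*cross = proj₂ (proj₂ (proj₂ (orientation cross)))
      open ≤R
      dom : ⟨ u , (λ x y → diagonal (suc n) (j x) (k y)) ⟩ ≤ ⟨ u , (λ x y → (e x + ε * a x) * (e′ y + ε * a′ y)) ⟩
      dom = begin
        ⟨ u , (λ x y → diagonal (suc n) (j x) (k y)) ⟩
          ≈⟨ ∑∑-cong (λ x y → trans (*-congˡ (diagonal-suc n (j x) (k y))) (distribˡ _ _ _)) ⟩
        (∑ λ x → ∑ λ y → u x y * diagonal n (j x) (k y) + u x y * (a x * a′ y))
          ≈⟨ ∑∑-+ _ _ ⟩
        ⟨ u , (λ x y → diagonal n (j x) (k y)) ⟩ + ⟨ u , (λ x y → a x * a′ y) ⟩
          ≤⟨ +-monoˡ-≤ _ dominates ⟩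
        ⟨ u , (λ x y → e x * e′ y) ⟩ + ⟨ u , (λ x y → a x * a′ y) ⟩
          ≤⟨ ≤-via 0≤ε*cross refl ⟩
        ⟨ u , (λ x y → e x * e′ y) ⟩ + ⟨ u , (λ x y → a x * a′ y) ⟩ + ε * cross
          ≈⟨ +-cong (sym (∑∑-+ _ _)) (∑∑-*ˡ ε _) ⟩
        (∑ λ x → ∑ λ y → u x y * (e x * e′ y) + u x y * (a x * a′ y)) + (∑ λ x → ∑ λ y → ε * (u x y * (e x * a′ y + a x * e′ y)))
          ≈⟨ sym (∑∑-+ _ _) ⟩
        (∑ λ x → ∑ λ y → u x y * (e x * e′ y) + u x y * (a x * a′ y) + ε * (u x y * (e x * a′ y + a x * e′ y)))
          ≈⟨ ∑∑-cong (λ x y → expand (u x y) (e x) (e′ y) (a x) (a′ y)) ⟩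
        ⟨ u , (λ x y → (e x + ε * a x) * (e′ y + ε * a′ y)) ⟩ ∎
        where
        expand : ∀ u e f a b → u * (e * f) + u * (a * b) + ε * (u * (e * b + a * f)) ≈ u * ((e + ε * a) * (f + ε * b))
        expand u e f a b = trans (+-congʳ (+-congˡ (sym (trans (*-congʳ ε²) (*-identityˡ _)))))
          (solve 6 (λ u e f a b s → u :* (e :* f) :+ s :* s :* (u :* (a :* b)) :+ s :* (u :* (e :* b :+ a :* f)) := u :* ((e :+ s :* a) :* (f :+ s :* b))) refl u e f a b ε)

    signs : ∀ u j k n → Signs u j k n
    signs u j k zero = record
      { e = λ _ → 0# ; e′ = λ _ → 0# ; e≤1 = λ _ → within-0 0≤1 ; e′≤1 = λ _ → within-0 0≤1
      ; e-zero = λ _ _ → refl ; e′-zero = λ _ _ → refl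
      ; dominates = ≤-reflexive (⟨⟩-cong λ x y → *-congˡ (trans (zeroʳ _) (sym (zeroˡ 0#)))) }
    signs u j k (suc n) = signs-suc (signs u j k n)

    -- For independent uniform signs the mean of ε_{j x} ε_{k y} is [j x = k y]; with signs chosen
    -- against `w` an equality test therefore takes two bits, however large the range of `j` and
    -- `k`.
    sim-diagonal : ∀ {φ : X → ℝ} {ψ : Y → ℝ} (j : X → ℕ) (k : Y → ℕ) → (∀ x → φ x within 1#) → (∀ y → ψ y within 1#) →
      Sim 2 λ x y → indicator (j x ℕ.≟ k y) * (φ x * ψ y)
    sim-diagonal {φ} {ψ} j k φ≤1 ψ≤1 w =
      let t , d , le = sim-product (λ x → within-product (e≤1 x) (φ≤1 x)) (λ y → within-product (e′≤1 y) (ψ≤1 y)) w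
      in t , d , ≤-trans (≤-respˡ (⟨⟩-cong lhs) (≤-respʳ (⟨⟩-cong rhs) dominates)) le
      where
      b : ℕ
      -- Beyond every value of `j`, so that the restricted diagonal is the whole one.
      b = suc (proj₁ (bounded j))
      open Signs (signs (λ x y → w x y * (φ x * ψ y)) j k b)
      lhs : ∀ x y → w x y * (φ x * ψ y) * diagonal b (j x) (k y) ≈ w x y * (indicator (j x ℕ.≟ k y) * (φ x * ψ y))
      lhs x y = trans (*-congˡ (diagonal-large (k y) (s≤s (proj₂ (bounded j) x))))
        (solve 3 (λ w p i → w :* p :* i := w :* (i :* p)) refl (w x y) (φ x * ψ y) (indicator (j x ℕ.≟ k y)))
      rhs : ∀ x y → w x y * (φ x * ψ y) * (e x * e′ y) ≈ w x y * (e x * φ x * (e′ y * ψ y))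
      rhs x y = solve 5 (λ w p q e f → w :* (p :* q) :* (e :* f) := w :* (e :* p :* (f :* q))) refl (w x y) (φ x) (ψ y) (e x) (e′ y)

  -- Compression of trees with a public prior

  diff≈0 : ∀ {a b} c → a ≈ b → c * (a - b) ≈ 0#
  diff≈0 c a≈b = trans (*-congˡ (trans (+-congʳ a≈b) (-‿inverseʳ _))) (zeroʳ c)

  +-zero : ∀ {x d} → d ≈ 0# → x + d ≈ x
  +-zero d≈0 = trans (+-congˡ d≈0) (+-identityʳ _)

  -- A path goes on only while both ratios are at most 2, and a node multiplies each by at most 4,
  -- so 8 bounds the ratios at which it stops.
  ⅛ : ℝ
  ⅛ = ½ * (½ * ½)

  0≤⅛ : 0# ≤ ⅛
  0≤⅛ = *-nonNeg 0≤½ (*-nonNeg 0≤½ 0≤½)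

  8*⅛ : fromℕ 8 * ⅛ ≈ 1#
  8*⅛ = trans (solve 1 (λ h → # 8 :* (h :* (h :* h)) := # 2 :* h :* (# 2 :* h) :* (# 2 :* h)) refl ½)
    (trans (*-cong (*-cong 2*½ 2*½) 2*½) (solve 0 (# 1 :* # 1 :* # 1 := # 1) refl))

  -- Acceptance probability for a likelihood ratio z ≤ 8; the value 0 for larger z is junk.
  clip : ℝ → ℝ
  clip z with dec (⅛ * z ≤ 1#)
  ... | yes _ = ⅛ * z
  ... | no _ = 0#

  clip-nonNeg : ∀ {z} → 0# ≤ z → 0# ≤ clip z
  clip-nonNeg {z} 0≤z with dec (⅛ * z ≤ 1#)
  ... | yes _ = *-nonNeg 0≤⅛ 0≤z
  ... | no _ = ≤-refl

  clip≤1 : ∀ z → clip z ≤ 1#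
  clip≤1 z with dec (⅛ * z ≤ 1#)
  ... | yes p = p
  ... | no _ = 0≤1

  ⅛*≤1 : ∀ {z} → z ≤ fromℕ 8 → ⅛ * z ≤ 1#
  ⅛*≤1 z≤8 = ≤-respʳ (trans (*-comm _ _) 8*⅛) (*-monoˡ-≤ ⅛ 0≤⅛ z≤8)

  clip-small : ∀ {z} → z ≤ fromℕ 8 → clip z ≈ ⅛ * z
  clip-small {z} z≤8 with dec (⅛ * z ≤ 1#)
  ... | yes _ = refl
  ... | no ≰1 = ⊥-elim (≰1 (⅛*≤1 z≤8))

  stepped : ∀ {P : Set} → Dec P → ℕ → ℕ
  stepped (yes _) n = suc n
  stepped (no _) n = 0

  stepped≤ : ∀ {P : Set} (P? : Dec P) {n h} → n ℕ.≤ h → stepped P? n ℕ.≤ suc h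
  stepped≤ (yes _) n≤h = s≤s n≤h
  stepped≤ (no _) n≤h = z≤n

  shift : ∀ {A : Set} → A → (ℕ → A) → ℕ → A
  shift a H zero = a
  shift a H (suc i) = H i

  -- The path goes on exactly if both players go on, that is, if the minimum of their stopping
  -- depths is positive.
  shift-stepped : ∀ {P Q : Set} (P? : Dec P) (Q? : Dec Q) (s : ℝ) (H : ℕ → ℝ) m n →
    indicator P? * indicator Q? * H (m ℕ.⊓ n) + (1# - indicator P? * indicator Q?) * s ≈ shift s H (stepped P? m ℕ.⊓ stepped Q? n)
  shift-stepped (yes _) (yes _) s H m n = solve 2 (λ h s → # 1 :* # 1 :* h :+ (# 1 :- # 1 :* # 1) :* s := h) refl (H (m ℕ.⊓ n)) s
  shift-stepped (yes _) (no _) s H m n = solve 2 (λ h s → # 1 :* # 0 :* h :+ (# 1 :- # 1 :* # 0) :* s := s) refl (H (m ℕ.⊓ n)) s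
  shift-stepped (no _) (yes _) s H m n = solve 2 (λ h s → # 0 :* # 1 :* h :+ (# 1 :- # 0 :* # 1) :* s := s) refl (H (m ℕ.⊓ n)) s
  shift-stepped (no _) (no _) s H m n = solve 2 (λ h s → # 0 :* # 0 :* h :+ (# 1 :- # 0 :* # 0) :* s := s) refl (H (m ℕ.⊓ n)) s

  module PriorTrees (nx ny : ℕ) where

    open Simulation nx ny public

    -- One bit with public prior v; Alice and Bob know the likelihood ratios a and b
    -- between the actual and the prior distribution.
    record Kernel : Set where
      field
        v₀ v₁ : ℝ
        a₀ a₁ : X → ℝ
        b₀ b₁ : Y → ℝ
        0≤v₀ : 0# ≤ v₀
        0≤v₁ : 0# ≤ v₁
        0≤a₀ : ∀ x → 0# ≤ a₀ x
        0≤a₁ : ∀ x → 0# ≤ a₁ x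
        0≤b₀ : ∀ y → 0# ≤ b₀ y
        0≤b₁ : ∀ y → 0# ≤ b₁ y
        a₀≤4 : ∀ x → a₀ x ≤ fromℕ 4
        a₁≤4 : ∀ x → a₁ x ≤ fromℕ 4
        b₀≤4 : ∀ y → b₀ y ≤ fromℕ 4
        b₁≤4 : ∀ y → b₁ y ≤ fromℕ 4
        Σv : v₀ + v₁ ≈ 1#
        Σva : ∀ x → v₀ * a₀ x + v₁ * a₁ x ≈ 1#
        Σvb : ∀ y → v₀ * b₀ y + v₁ * b₁ y ≈ 1#
        Σvab : ∀ x y → v₀ * (a₀ x * b₀ y) + v₁ * (a₁ x * b₁ y) ≈ 1#

    data PTree : Set where
      leaf : Matrix → PTree
      node : Kernel → PTree → PTree → PTree

    height : PTree → ℕ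
    height (leaf _) = 0
    height (node _ t₀ t₁) = suc (height t₀ ℕ.⊔ height t₁)

    Leaves : (Matrix → Set) → PTree → Set
    Leaves P (leaf g) = P g
    Leaves P (node _ t₀ t₁) = Leaves P t₀ × Leaves P t₁

    expectation : PTree → Matrix
    expectation (leaf g) = g
    expectation (node κ t₀ t₁) x y = v₀ * (a₀ x * b₀ y) * expectation t₀ x y + v₁ * (a₁ x * b₁ y) * expectation t₁ x y
      where open Kernel κ

    -- `R` is the ratio between the actual and the prior probability of the path so far. A leaf of
    -- ratio R may pay at most √(B/R); no bound on the ratio itself is imposed.
    Bounded : ℝ → X → Y → PTree → ℝ → Set
    Bounded B x y (leaf g) R = R * (g x y * g x y) ≤ B
    Bounded B x y (node κ t₀ t₁) R = Bounded B x y t₀ (R * (a₀ x * b₀ y)) × Bounded B x y t₁ (R * (a₁ x * b₁ y))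
      where open Kernel κ

    bounded-cong : ∀ {B x y R R′} t → R ≈ R′ → Bounded B x y t R → Bounded B x y t R′
    bounded-cong (leaf g) R≈R′ p = ≤-respˡ (*-congʳ R≈R′) p
    bounded-cong (node κ t₀ t₁) R≈R′ (p , q) = bounded-cong t₀ (*-congʳ R≈R′) p , bounded-cong t₁ (*-congʳ R≈R′) q

    stopValue : Matrix → Matrix → (X → ℝ) → (Y → ℝ) → Matrix
    stopValue V V* ra rb x y = clip (ra x) * clip (rb y) * V x y + (1# - clip (ra x) * clip (rb y)) * V* x y

    small? : ∀ z → Dec (z ≤ fromℕ 2)
    small? z = dec (z ≤ fromℕ 2)

    -- A path is sampled from the prior until the likelihood ratio ra of Alice or rb of Bob
    -- exceeds 2; the node reached is accepted with probability proportional to ra rb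
    -- (continuing with V), otherwise the attempt is void (continuing with V*).
    stage : (PTree → Matrix) → Matrix → PTree → (X → ℝ) → (Y → ℝ) → Matrix
    stage V V* t@(leaf _) ra rb = stopValue (V t) V* ra rb
    stage V V* t@(node κ t₀ t₁) ra rb x y =
      go * (v₀ * stage V V* t₀ (λ x → ra x * a₀ x) (λ y → rb y * b₀ y) x y + v₁ * stage V V* t₁ (λ x → ra x * a₁ x) (λ y → rb y * b₁ y) x y)
        + (1# - go) * stopValue (V t) V* ra rb x y
      where
      open Kernel κ
      go : ℝ
      go = indicator (small? (ra x)) * indicator (small? (rb y))

    -- An inner node at which no attempt is left is worth 0; the error then is the whole
    -- expectation, which `expectation-within` controls.
    attempts : ℕ → PTree → Matrix
    attempts J (leaf g) = g
    attempts zero (node _ _ _) = λ _ _ → 0#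
    attempts (suc J) t@(node _ _ _) = stage (attempts J) (attempts J t) t (λ _ → 1#) (λ _ → 1#)

    sim-stopValue : ∀ {T V V* ra rb} → Sim T V → Sim T V* → (∀ x → 0# ≤ ra x) → (∀ y → 0# ≤ rb y) → Sim (2 ℕ.+ T) (stopValue V V* ra rb)
    sim-stopValue {T} {V} {V*} {ra} {rb} simV simV* 0≤ra 0≤rb =
      sim-cong (λ x y → solve 4 (λ a b v w → a :* (b :* v :+ (# 1 :- b) :* w) :+ (# 1 :- a) :* w := a :* b :* v :+ (# 1 :- a :* b) :* w) refl (clip (ra x)) (clip (rb y)) (V x y) (V* x y))
        (sim-alice (λ x → clip (ra x)) (λ x → clip-nonNeg (0≤ra x)) (λ x → clip≤1 _)
          (sim-bob (λ y → clip (rb y)) (λ y → clip-nonNeg (0≤rb y)) (λ y → clip≤1 _) simV simV*)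
          (sim-mono (ℕ.n≤1+n T) simV*))

    -- Fixing the public path: the stage is dominated by one in which Alice and Bob stop
    -- at depths τ x and σ y known to them.
    record FixedPath (T h : ℕ) (w g : Matrix) : Set where
      field
        τ : X → ℕ
        σ : Y → ℕ
        H : ℕ → Matrix
        sims : ∀ i → Sim T (H i)
        τ≤h : ∀ x → τ x ℕ.≤ h
        σ≤h : ∀ y → σ y ℕ.≤ h
        dominates : ⟨ w , g ⟩ ≤ ⟨ w , (λ x y → H (τ x ℕ.⊓ σ y) x y) ⟩

    fixedPath-mono : ∀ {T h h′ w g} → h ℕ.≤ h′ → FixedPath T h w g → FixedPath T h′ w g
    fixedPath-mono h≤h′ P = record
      { τ = τ ; σ = σ ; H = H ; sims = sims ; dominates = dominates
      ; τ≤h = λ x → ℕ.≤-trans (τ≤h x) h≤h′ ; σ≤h = λ y → ℕ.≤-trans (σ≤h y) h≤h′ }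
      where open FixedPath P

    average₂ : ∀ {w g₀ g₁ : Matrix} {v₀ v₁ m} → 0# ≤ v₀ → 0# ≤ v₁ → v₀ + v₁ ≈ 1# →
      ⟨ w , g₀ ⟩ ≤ m → ⟨ w , g₁ ⟩ ≤ m → ⟨ w , (λ x y → v₀ * g₀ x y + v₁ * g₁ x y) ⟩ ≤ m
    average₂ {w} {g₀} {g₁} {v₀} {v₁} {m} 0≤v₀ 0≤v₁ Σv p q = begin
      ⟨ w , (λ x y → v₀ * g₀ x y + v₁ * g₁ x y) ⟩
        ≈⟨ ∑∑-cong (λ x y → solve 5 (λ w v u g h → w :* (v :* g :+ u :* h) := v :* (w :* g) :+ u :* (w :* h)) refl (w x y) v₀ v₁ (g₀ x y) (g₁ x y)) ⟩
      (∑ λ x → ∑ λ y → v₀ * (w x y * g₀ x y) + v₁ * (w x y * g₁ x y))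
        ≈⟨ ∑∑-+ _ _ ⟩
      (∑ λ x → ∑ λ y → v₀ * (w x y * g₀ x y)) + (∑ λ x → ∑ λ y → v₁ * (w x y * g₁ x y))
        ≈⟨ sym (+-cong (∑∑-*ˡ v₀ _) (∑∑-*ˡ v₁ _)) ⟩
      v₀ * ⟨ w , g₀ ⟩ + v₁ * ⟨ w , g₁ ⟩
        ≤⟨ +-mono-≤ (*-monoˡ-≤ v₀ 0≤v₀ p) (*-monoˡ-≤ v₁ 0≤v₁ q) ⟩
      v₀ * m + v₁ * m
        ≈⟨ trans (sym (distribʳ m v₀ v₁)) (trans (*-congʳ Σv) (*-identityˡ m)) ⟩
      m ∎
      where open ≤R

    better-branch : ∀ {T h w} {g₀ g₁ : Matrix} {v₀ v₁} → 0# ≤ v₀ → 0# ≤ v₁ → v₀ + v₁ ≈ 1# →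
      FixedPath T h w g₀ → FixedPath T h w g₁ → FixedPath T h w (λ x y → v₀ * g₀ x y + v₁ * g₁ x y)
    better-branch {w = w} {g₀} {g₁} {v₀} {v₁} 0≤v₀ 0≤v₁ Σv P₀ P₁ with total ⟨ w , g₀ ⟩ ⟨ w , g₁ ⟩
    ... | inj₁ ≤₁ = record { FixedPath P₁ ; dominates = ≤-trans (average₂ 0≤v₀ 0≤v₁ Σv ≤₁ ≤-refl) (FixedPath.dominates P₁) }
    ... | inj₂ ≤₀ = record { FixedPath P₀ ; dominates = ≤-trans (average₂ 0≤v₀ 0≤v₁ Σv ≤-refl ≤₀) (FixedPath.dominates P₀) }

    fixPath : ∀ {T₀ T N} (V : PTree → Matrix) (V* : Matrix) → Sim T V* →
      (∀ s → Leaves (Sim T₀) s → height s ℕ.≤ N → Sim T (V s)) →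
      ∀ t ra rb → (∀ x → 0# ≤ ra x) → (∀ y → 0# ≤ rb y) → Leaves (Sim T₀) t → height t ℕ.≤ N →
      ∀ w → FixedPath (2 ℕ.+ T) (height t) w (stage V V* t ra rb)
    fixPath V V* simV* simV t@(leaf _) ra rb 0≤ra 0≤rb lvs h w = record
      { τ = λ _ → 0 ; σ = λ _ → 0 ; H = λ _ → stopValue (V t) V* ra rb
      ; sims = λ _ → sim-stopValue (simV t lvs h) simV* 0≤ra 0≤rb
      ; τ≤h = λ _ → z≤n ; σ≤h = λ _ → z≤n ; dominates = ≤-refl }
    fixPath {T = T} V V* simV* simV t@(node κ t₀ t₁) ra rb 0≤ra 0≤rb lvs@(lvs₀ , lvs₁) h w = record
      { τ = λ x → stepped (small? (ra x)) (τ x)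
      ; σ = λ y → stepped (small? (rb y)) (σ y)
      ; H = shift halt H
      ; sims = λ { zero → sim-stopValue (simV t lvs h) simV* 0≤ra 0≤rb ; (suc i) → sims i }
      ; τ≤h = λ x → stepped≤ (small? (ra x)) (τ≤h x)
      ; σ≤h = λ y → stepped≤ (small? (rb y)) (σ≤h y)
      ; dominates = begin
          (∑ λ x → ∑ λ y → w x y * (go x y * next x y + (1# - go x y) * halt x y))
            ≈⟨ ∑∑-cong (λ x y → solve 4 (λ w g n s → w :* (g :* n :+ (# 1 :- g) :* s) := g :* w :* n :+ w :* ((# 1 :- g) :* s)) refl (w x y) (go x y) (next x y) (halt x y)) ⟩
          (∑ λ x → ∑ λ y → go x y * w x y * next x y + w x y * ((1# - go x y) * halt x y))
            ≈⟨ ∑∑-+ _ _ ⟩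
          ⟨ w′ , next ⟩ + (∑ λ x → ∑ λ y → w x y * ((1# - go x y) * halt x y))
            ≤⟨ +-monoˡ-≤ _ dominates ⟩
          ⟨ w′ , (λ x y → H (τ x ℕ.⊓ σ y) x y) ⟩ + (∑ λ x → ∑ λ y → w x y * ((1# - go x y) * halt x y))
            ≈⟨ sym (∑∑-+ _ _) ⟩
          (∑ λ x → ∑ λ y → go x y * w x y * H (τ x ℕ.⊓ σ y) x y + w x y * ((1# - go x y) * halt x y))
            ≈⟨ ∑∑-cong (λ x y → trans (solve 4 (λ w g n s → g :* w :* n :+ w :* ((# 1 :- g) :* s) := w :* (g :* n :+ (# 1 :- g) :* s)) refl (w x y) (go x y) (H (τ x ℕ.⊓ σ y) x y) (halt x y))
                 (*-congˡ (trans (shift-stepped (small? (ra x)) (small? (rb y)) (halt x y) (λ i → H i x y) (τ x) (σ y))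
                   (shift-apply (stepped (small? (ra x)) (τ x) ℕ.⊓ stepped (small? (rb y)) (σ y)) x y)))) ⟩
          ⟨ w , (λ x y → shift halt H (stepped (small? (ra x)) (τ x) ℕ.⊓ stepped (small? (rb y)) (σ y)) x y) ⟩ ∎ }
      where
      open Kernel κ
      open ≤R
      go : Matrix
      go x y = indicator (small? (ra x)) * indicator (small? (rb y))
      halt : Matrix
      halt = stopValue (V t) V* ra rb
      next₀ next₁ next w′ : Matrix
      next₀ = stage V V* t₀ (λ x → ra x * a₀ x) (λ y → rb y * b₀ y)
      next₁ = stage V V* t₁ (λ x → ra x * a₁ x) (λ y → rb y * b₁ y)
      next x y = v₀ * next₀ x y + v₁ * next₁ x y
      -- Only inputs on which both players go on have a say in the choice of the branch.
      w′ x y = go x y * w x y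
      N₀ : height t₀ ℕ.≤ height t₀ ℕ.⊔ height t₁
      N₀ = ℕ.m≤m⊔n _ _
      N₁ : height t₁ ℕ.≤ height t₀ ℕ.⊔ height t₁
      N₁ = ℕ.m≤n⊔m (height t₀) _
      h′ : height t₀ ℕ.⊔ height t₁ ℕ.≤ _
      h′ = ℕ.≤-trans (ℕ.n≤1+n _) h
      rest : FixedPath (2 ℕ.+ T) (height t₀ ℕ.⊔ height t₁) w′ next
      rest = better-branch 0≤v₀ 0≤v₁ Σv
        (fixedPath-mono N₀ (fixPath V V* simV* simV t₀ _ _ (λ x → *-nonNeg (0≤ra x) (0≤a₀ x)) (λ y → *-nonNeg (0≤rb y) (0≤b₀ y)) lvs₀ (ℕ.≤-trans N₀ h′) w′))
        (fixedPath-mono N₁ (fixPath V V* simV* simV t₁ _ _ (λ x → *-nonNeg (0≤ra x) (0≤a₁ x)) (λ y → *-nonNeg (0≤rb y) (0≤b₁ y)) lvs₁ (ℕ.≤-trans N₁ h′) w′))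
      open FixedPath rest
      shift-apply : ∀ i x y → shift (halt x y) (λ i → H i x y) i ≈ shift halt H i x y
      shift-apply zero x y = refl
      shift-apply (suc i) x y = refl

    cost : ℕ → ℕ → ℕ → ℕ
    cost T₀ ℓ zero = T₀
    cost T₀ ℓ (suc J) = ℓ ℕ.+ (ℓ ℕ.+ (2 ℕ.+ cost T₀ ℓ J))

    -- Stopping depths are at most the height and hence fit into `ℓ` bits; a subtree reached by an
    -- accepted attempt inherits the bound `N`.
    sim-attempts : ∀ {T₀} ℓ N → N ℕ.< 2 ℕ.^ ℓ → ∀ J t → Leaves (Sim T₀) t → height t ℕ.≤ N → Sim (cost T₀ ℓ J) (attempts J t)
    sim-attempts ℓ N N< zero (leaf g) lvs h = lvs
    sim-attempts ℓ N N< (suc J) t@(leaf g) lvs h =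
      sim-mono (ℕ.≤-trans (ℕ.m≤n+m _ (ℓ ℕ.+ (ℓ ℕ.+ 2))) (ℕ.≤-reflexive (≡.trans (ℕ.+-assoc ℓ _ _) (≡.cong (ℓ ℕ.+_) (ℕ.+-assoc ℓ 2 _)))))
        (sim-attempts ℓ N N< J t lvs h)
    sim-attempts ℓ N N< zero (node _ _ _) lvs h = sim-mono z≤n sim-0
    sim-attempts ℓ N N< (suc J) t@(node κ t₀ t₁) lvs h w =
      let t , d , le = sim-min ℓ H τ σ (λ x → ℕ.≤-<-trans (ℕ.≤-trans (τ≤h x) h) N<) (λ y → ℕ.≤-<-trans (ℕ.≤-trans (σ≤h y) h) N<) sims w
      in t , d , ≤-trans dominates le
      where open FixedPath (fixPath (attempts J) (attempts J t) (sim-attempts ℓ N N< J t lvs h) (sim-attempts ℓ N N< J) t _ _ (λ _ → 0≤1) (λ _ → 0≤1) lvs h w)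

  -- Accuracy of the compression

  -- s plays the role of √r, so that a weight r costs only a factor s in the bound.
  rescale : ∀ {B R r s β c D} → 0# < B → 0# ≤ r → 0# ≤ s → r ≤ s * s → 0# ≤ c → 0# ≤ β → B ≤ R * (β * β) →
    (∀ {β′} → 0# ≤ β′ → B ≤ R * r * (β′ * β′) → D within c * β′) → (r * D) within c * (β * s)
  rescale {B} {R} {r} {s} {β} {c} {D} 0<B 0≤r 0≤s r≤s² 0≤c 0≤β B≤ hyp with dec (r ≈ 0#)
  ... | yes r≈0 = within-cong (sym (trans (*-congʳ r≈0) (zeroˡ D))) (within-0 (*-nonNeg 0≤c (*-nonNeg 0≤β 0≤s)))
  ... | no r≉0 = within-mono (≤-reflexive eq) (within-* r 0≤r (hyp (*-nonNeg 0≤β (/-nonNeg 0≤s 0≤r)) B≤′))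
    where
    rr : r * r ⁻¹ ≈ 1#
    rr = *-inverseʳ r≉0
    eq : r * (c * (β * (s / r))) ≈ c * (β * s)
    eq = trans (solve 5 (λ r c b s i → r :* (c :* (b :* (s :* i))) := r :* i :* (c :* (b :* s))) refl r c β s (r ⁻¹)) (trans (*-congʳ rr) (*-identityˡ _))
    B≤′ : B ≤ R * r * (β * (s / r) * (β * (s / r)))
    B≤′ = ≤-trans B≤ (≤-trans (≤-respˡ (*-identityʳ _) (*-monoˡ-≤ (R * (β * β)) (≤-trans (proj₁ 0<B) B≤) (≤/ (nonNeg≉⇒> 0≤r r≉0) (≤-respˡ (sym (*-identityˡ r)) r≤s²))))
      (≤-reflexive (sym (trans (solve 5 (λ R r b s i → R :* r :* (b :* (s :* i) :* (b :* (s :* i))) := r :* i :* (R :* (b :* b) :* (s :* s :* i))) refl R r β s (r ⁻¹))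
        (trans (*-congʳ rr) (*-identityˡ _))))))

  -- The AM-GM bound on √r. Being affine in r, it has mean exactly 1 under the prior, which √r would
  -- only have as an upper bound.
  mean : ℝ → ℝ
  mean r = ½ * (1# + r)

  mean-nonNeg : ∀ {r} → 0# ≤ r → 0# ≤ mean r
  mean-nonNeg 0≤r = *-nonNeg 0≤½ (+-nonNeg 0≤1 0≤r)

  ≤mean² : ∀ r → r ≤ mean r * mean r
  ≤mean² r = ≤-via (square-nonNeg (½ * (1# - r)))
    (trans (solve 2 (λ h r → h :* (# 1 :+ r) :* (h :* (# 1 :+ r)) := # 2 :* h :* (# 2 :* h) :* r :+ h :* (# 1 :- r) :* (h :* (# 1 :- r))) refl ½ r)
      (+-congʳ (trans (*-congʳ (*-cong 2*½ 2*½)) (solve 1 (λ r → # 1 :* # 1 :* r := r) refl r))))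

  -- For a ratio u ≥ 2 the AM-GM inequality √(uw) ≤ (1+u)(1+w)/4 improves by a constant.
  stopRoot : ℝ → ℝ → ℝ
  stopRoot u w = u / (1# + u) + ½ * ½ * ((1# + u) * w)

  module StopRoot {u w : ℝ} (0≤u : 0# ≤ u) (0≤w : 0# ≤ w) where

    0<1+u : 0# < 1# + u
    0<1+u = +-pos 0<1 0≤u

    stopRoot-nonNeg : 0# ≤ stopRoot u w
    stopRoot-nonNeg = +-nonNeg (/-nonNeg 0≤u (proj₁ 0<1+u)) (*-nonNeg (*-nonNeg 0≤½ 0≤½) (*-nonNeg (proj₁ 0<1+u) 0≤w))

    ≤stopRoot² : u * w ≤ stopRoot u w * stopRoot u w
    ≤stopRoot² = ≤-via (square-nonNeg (u / (1# + u) - ½ * ½ * ((1# + u) * w)))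
      (trans (solve 5 (λ u i v w h → (u :* i :+ h :* h :* (v :* w)) :* (u :* i :+ h :* h :* (v :* w)) := v :* i :* (# 2 :* h :* (# 2 :* h)) :* (u :* w) :+ (u :* i :- h :* h :* (v :* w)) :* (u :* i :- h :* h :* (v :* w))) refl u ((1# + u) ⁻¹) (1# + u) w ½)
        (+-congʳ (trans (*-congʳ (*-cong (*-inverseʳ (>⇒≉ 0<1+u)) (*-cong 2*½ 2*½))) (solve 1 (λ z → # 1 :* (# 1 :* # 1) :* z := z) refl (u * w)))))

    -- Multiplied by 1 + u, the two sides differ by (3u - 1)(u - 2).
    stopRoot≤ : fromℕ 2 ≤ u → fromℕ 12 * stopRoot u w ≤ fromℕ 3 * ((1# + u) * (1# + w)) - 1#
    stopRoot≤ 2≤u = *-cancelˡ-≤ 0<1+u (≤-via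
      (*-nonNeg (≤-via (+-nonNeg (*-nonNeg (fromℕ-nonNeg 3) (0≤diff 2≤u)) (fromℕ-nonNeg 5)) (solve 1 (λ u → # 3 :* u :- # 1 := # 0 :+ (# 3 :* (u :- # 2) :+ # 5)) refl u)) (0≤diff 2≤u))
      (trans (solve 2 (λ u w → (# 1 :+ u) :* (# 3 :* ((# 1 :+ u) :* (# 1 :+ w)) :- # 1) := # 12 :* u :+ # 3 :* ((# 1 :+ u) :* ((# 1 :+ u) :* w)) :+ (# 3 :* u :- # 1) :* (u :- # 2)) refl u w)
        (+-congʳ (sym (trans (solve 5 (λ u i v w h → v :* (# 12 :* (u :* i :+ h :* h :* (v :* w))) := v :* i :* (# 12 :* u) :+ # 2 :* h :* (# 2 :* h) :* (# 3 :* (v :* (v :* w)))) refl u ((1# + u) ⁻¹) (1# + u) w ½)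
          (+-cong (trans (*-congʳ (*-inverseʳ (>⇒≉ 0<1+u))) (*-identityˡ _)) (trans (*-congʳ (*-cong 2*½ 2*½)) (solve 1 (λ z → # 1 :* # 1 :* z := z) refl (fromℕ 3 * ((1# + u) * ((1# + u) * w)))))))))))

  -- Per attempt the error contracts by 1 - 1/768, as an attempt is accepted with probability
  -- 1/64 and an accepted one gains a factor 1 - 1/12 unless it ends in a leaf.
  rate : ℝ
  rate = ⅛ * ⅛ * fromℕ 12 ⁻¹

  12*rate : fromℕ 12 * rate ≈ ⅛ * ⅛
  12*rate = trans (solve 2 (λ a b → # 12 :* (a :* b) := # 12 :* b :* a) refl (⅛ * ⅛) (fromℕ 12 ⁻¹)) (trans (*-congʳ (*-inverseʳ (>⇒≉ (fromℕ-pos 11)))) (*-identityˡ _))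

  0≤rate : 0# ≤ rate
  0≤rate = *-nonNeg (*-nonNeg 0≤⅛ 0≤⅛) (⁻¹-nonNeg (fromℕ-nonNeg 12))

  768*rate : fromℕ 768 * rate ≈ 1#
  768*rate = trans (solve 1 (λ r → # 768 :* r := # 64 :* (# 12 :* r)) refl rate) (trans (*-congˡ 12*rate) (trans (solve 1 (λ a → # 64 :* (a :* a) := # 8 :* a :* (# 8 :* a)) refl ⅛) (trans (*-cong 8*⅛ 8*⅛) (*-identityˡ 1#))))

  rate≤1 : rate ≤ 1#
  rate≤1 = ≤-respʳ 768*rate (≤-via (*-nonNeg (fromℕ-nonNeg 767) 0≤rate) (solve 1 (λ r → # 768 :* r := r :+ # 767 :* r) refl rate))

  ρ : ℝ
  ρ = 1# - rate

  0≤ρ : 0# ≤ ρ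
  0≤ρ = 0≤diff rate≤1

  within-combine : ∀ {u v d e x y} → 0# ≤ u → 0# ≤ v → x within d → y within e → (u * x + v * y) within (u * d + v * e)
  within-combine 0≤u 0≤v p q = within-+ (within-* _ 0≤u p) (within-* _ 0≤v q)

  module Accuracy (nx ny : ℕ) (B : ℝ) (0<B : 0# < B) (x : Fin nx) (y : Fin ny) where

    open PriorTrees nx ny

    -- `β` plays the role of √(B/R). By `rescale` a child of ratio r contributes at most β ·
    -- `mean r`, and the prior mean of `mean r` is 1.
    expectation-within : ∀ t {R β} → Bounded B x y t R → 0# ≤ R → 0# ≤ β → B ≤ R * (β * β) → expectation t x y within β
    expectation-within (leaf g) {R} {β} bd 0≤R 0≤β B≤ = square≤⇒within 0≤β (*-cancelˡ-≤ (nonNeg≉⇒> 0≤R R≉0) (≤-trans bd B≤))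
      where
      R≉0 : ¬ R ≈ 0#
      R≉0 R≈0 = <⇒≱ 0<B (≤-respʳ (trans (*-congʳ R≈0) (zeroˡ _)) B≤)
    expectation-within (node κ t₀ t₁) {R} {β} (bd₀ , bd₁) 0≤R 0≤β B≤ =
      within-cong (solve 6 (λ v a g u b h → v :* (a :* g) :+ u :* (b :* h) := v :* a :* g :+ u :* b :* h) refl v₀ r₀ (expectation t₀ x y) v₁ r₁ (expectation t₁ x y))
        (within-mono (≤-reflexive total≈)
          (within-combine 0≤v₀ 0≤v₁
            (child t₀ 0≤r₀ bd₀) (child t₁ 0≤r₁ bd₁)))
      where
      open Kernel κ
      r₀ r₁ : ℝ
      r₀ = a₀ x * b₀ y
      r₁ = a₁ x * b₁ y
      0≤r₀ : 0# ≤ r₀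
      0≤r₀ = *-nonNeg (0≤a₀ x) (0≤b₀ y)
      0≤r₁ : 0# ≤ r₁
      0≤r₁ = *-nonNeg (0≤a₁ x) (0≤b₁ y)
      child : ∀ t {r} → 0# ≤ r → Bounded B x y t (R * r) → (r * expectation t x y) within 1# * (β * mean r)
      child t {r} 0≤r bd = rescale 0<B 0≤r (mean-nonNeg 0≤r) (≤mean² r) 0≤1 0≤β B≤
        λ 0≤β′ B≤′ → within-mono (≤-reflexive (sym (*-identityˡ _))) (expectation-within t bd (*-nonNeg 0≤R 0≤r) 0≤β′ B≤′)
      total≈ : v₀ * (1# * (β * mean r₀)) + v₁ * (1# * (β * mean r₁)) ≈ β
      total≈ = trans (solve 6 (λ v u b h r s → v :* (# 1 :* (b :* (h :* (# 1 :+ r)))) :+ u :* (# 1 :* (b :* (h :* (# 1 :+ s)))) := b :* (h :* (v :+ u :+ (v :* r :+ u :* s)))) refl v₀ v₁ β ½ r₀ r₁)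
        (trans (*-congˡ (*-congˡ (+-cong Σv (Σvab x y)))) (trans (*-congˡ (trans (distribˡ ½ 1# 1#) (trans (+-cong (*-identityʳ ½) (*-identityʳ ½)) ½+½))) (*-identityʳ β)))

    -- `c` is the error factor of the `J` remaining attempts, so that c β = 12 b is the error of
    -- starting over. `E*` and `V*` are the exact and the computed value at the root of the stage,
    -- to which a void attempt returns.
    module StageError (J : ℕ) (c : ℝ) (0≤c : 0# ≤ c)
      (hyp : ∀ t {R β} → Bounded B x y t R → 0# ≤ R → 0# ≤ β → B ≤ R * (β * β) → (expectation t x y - attempts J t x y) within c * β)
      (E* V* b R β : ℝ) (W* : Matrix) (W*≈ : W* x y ≈ V*) (0≤R : 0# ≤ R) (0≤β : 0# ≤ β) (B≤ : B ≤ R * (β * β)) (12b≈ : fromℕ 12 * b ≈ c * β)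
      (err* : (E* - V*) within (fromℕ 12 * b)) where

      h : ℝ
      h = ⅛ * ⅛

      0≤h : 0# ≤ h
      0≤h = *-nonNeg 0≤⅛ 0≤⅛

      0≤b : 0# ≤ b
      0≤b = *-cancelˡ-≤ (fromℕ-pos 11) (≤-respˡ (sym (zeroʳ _)) (≤-respʳ (sym 12b≈) (*-nonNeg 0≤c 0≤β)))

      -- The exact counterpart of a stage with ratios p and q: acceptance with probability h p q,
      -- otherwise a restart. By the sums in `Kernel`, expressions affine in p, q and p q average
      -- exactly over a node. This applies to `target` and `bound`, so only the nodes where a path
      -- stops call for an estimate.
      target : ℝ → ℝ → ℝ → ℝ
      target p q g = h * (p * q) * g + (1# - h * (p * q)) * E*
      bound : ℝ → ℝ → ℝ
      bound p q = h * (b * (fromℕ 3 * ((1# + p) * (1# + q)) - 1#)) + (1# - h * (p * q)) * (fromℕ 12 * b)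

      3≤ : ∀ {p q} → 0# ≤ p → 0# ≤ q → 0# ≤ fromℕ 3 * ((1# + p) * (1# + q)) - 1#
      3≤ {p} {q} 0≤p 0≤q = ≤-via (+-nonNeg (fromℕ-nonNeg 2) (*-nonNeg (fromℕ-nonNeg 3) (+-nonNeg (+-nonNeg 0≤p 0≤q) (*-nonNeg 0≤p 0≤q))))
        (solve 2 (λ p q → # 3 :* ((# 1 :+ p) :* (# 1 :+ q)) :- # 1 := # 0 :+ (# 2 :+ # 3 :* (p :+ q :+ p :* q))) refl p q)

      hpq≤1 : ∀ {p q} → 0# ≤ p → 0# ≤ q → p ≤ fromℕ 8 → q ≤ fromℕ 8 → h * (p * q) ≤ 1#
      hpq≤1 {p} {q} 0≤p 0≤q p≤8 q≤8 = ≤-respˡ (solve 3 (λ e p q → e :* p :* (e :* q) := e :* e :* (p :* q)) refl ⅛ p q)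
        (≤-respʳ (*-identityˡ 1#) (*-mono-≤ (*-nonNeg 0≤⅛ 0≤p) (⅛*≤1 p≤8) (*-nonNeg 0≤⅛ 0≤q) (⅛*≤1 q≤8)))

      accepted : ∀ {p q} → 0# ≤ p → 0# ≤ q → fromℕ 2 ≤ p ⊎ fromℕ 2 ≤ q → ∀ t → Bounded B x y t (R * (p * q)) →
        (p * q * (expectation t x y - attempts J t x y)) within b * (fromℕ 3 * ((1# + p) * (1# + q)) - 1#)
      accepted {p} {q} 0≤p 0≤q (inj₁ 2≤p) t bd = within-mono
        (≤-respˡ (trans (solve 2 (λ b s → b :* (# 12 :* s) := # 12 :* b :* s) refl b (stopRoot p q)) (trans (*-congʳ 12b≈) (*-assoc _ _ _))) (*-monoˡ-≤ b 0≤b (stopRoot≤ 2≤p)))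
        (rescale 0<B 0≤pq stopRoot-nonNeg ≤stopRoot² 0≤c 0≤β B≤ λ 0≤β′ B≤′ → hyp t bd (*-nonNeg 0≤R 0≤pq) 0≤β′ B≤′)
        where
        open StopRoot 0≤p 0≤q
        0≤pq : 0# ≤ p * q
        0≤pq = *-nonNeg 0≤p 0≤q
      accepted {p} {q} 0≤p 0≤q (inj₂ 2≤q) t bd = within-cong (*-congʳ (*-comm q p)) (within-mono (≤-reflexive (*-congˡ (+-congʳ (*-congˡ (*-comm _ _)))))
        (accepted {q} {p} 0≤q 0≤p (inj₁ 2≤q) t (bounded-cong t (*-congˡ (*-comm p q)) bd)))

      stop-error : ∀ t ra rb → 0# ≤ ra x → 0# ≤ rb y → ra x ≤ fromℕ 8 → rb y ≤ fromℕ 8 →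
        (ra x * rb y * (expectation t x y - attempts J t x y)) within b * (fromℕ 3 * ((1# + ra x) * (1# + rb y)) - 1#) →
        (target (ra x) (rb y) (expectation t x y) - stopValue (attempts J t) W* ra rb x y) within bound (ra x) (rb y)
      stop-error t ra rb 0≤p 0≤q p≤8 q≤8 acc = within-cong
        (sym (trans (+-congˡ (-‿cong (+-cong (*-congʳ clips) (*-cong (+-congˡ (-‿cong clips)) W*≈))))
          (solve 6 (λ h r e v f w → h :* r :* e :+ (# 1 :- h :* r) :* f :- (h :* r :* v :+ (# 1 :- h :* r) :* w) := h :* (r :* (e :- v)) :+ (# 1 :- h :* r) :* (f :- w)) refl h (ra x * rb y) (expectation t x y) (attempts J t x y) E* V*)))
        (within-combine 0≤h (0≤diff (hpq≤1 0≤p 0≤q p≤8 q≤8)) acc err*)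
        where
        clips : clip (ra x) * clip (rb y) ≈ h * (ra x * rb y)
        clips = trans (*-cong (clip-small p≤8) (clip-small q≤8)) (solve 3 (λ e p q → e :* p :* (e :* q) := e :* e :* (p :* q)) refl ⅛ (ra x) (rb y))

      scale≤8 : ∀ {p a} → 0# ≤ p → p ≤ fromℕ 2 → 0# ≤ a → a ≤ fromℕ 4 → p * a ≤ fromℕ 8
      scale≤8 0≤p p≤2 0≤a a≤4 = ≤-trans (*-mono-≤ 0≤p p≤2 0≤a a≤4) (≤-reflexive (solve 0 (# 2 :* # 4 := # 8) refl))

      -- Acceptance at a leaf is exact, so no ratio need exceed 2 there. An inner node stops only
      -- when some ratio exceeds 2, where `accepted` has the improved bound. Otherwise both sides
      -- are averages over the children.
      stage-error : ∀ t ra rb → 0# ≤ ra x → 0# ≤ rb y → ra x ≤ fromℕ 8 → rb y ≤ fromℕ 8 → Bounded B x y t (R * (ra x * rb y)) →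
        (target (ra x) (rb y) (expectation t x y) - stage (attempts J) W* t ra rb x y) within bound (ra x) (rb y)
      stage-error t@(leaf g) ra rb 0≤p 0≤q p≤8 q≤8 bd = stop-error t ra rb 0≤p 0≤q p≤8 q≤8
        (within-cong (sym (trans (*-congˡ (-‿inverseʳ _)) (zeroʳ _))) (within-0 (*-nonNeg 0≤b (3≤ 0≤p 0≤q))))
      stage-error t@(node κ t₀ t₁) ra rb 0≤p 0≤q p≤8 q≤8 bd@(bd₀ , bd₁) with small? (ra x) | small? (rb y)
      ... | no p≰2 | q? = within-cong (sym (+-congˡ (-‿cong (solve 3 (λ n s i → # 0 :* i :* n :+ (# 1 :- # 0 :* i) :* s := s) refl _ _ (indicator q?)))))
        (stop-error t ra rb 0≤p 0≤q p≤8 q≤8 (accepted 0≤p 0≤q (inj₁ (≰⇒≥ p≰2)) t bd))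
      ... | yes _ | no q≰2 = within-cong (sym (+-congˡ (-‿cong (solve 2 (λ n s → # 1 :* # 0 :* n :+ (# 1 :- # 1 :* # 0) :* s := s) refl _ _))))
        (stop-error t ra rb 0≤p 0≤q p≤8 q≤8 (accepted 0≤p 0≤q (inj₂ (≰⇒≥ q≰2)) t bd))
      ... | yes p≤2 | yes q≤2 = within-cong (sym target≈) (within-mono (≤-reflexive bound≈) (within-combine 0≤v₀ 0≤v₁
          (stage-error t₀ (λ x → ra x * a₀ x) (λ y → rb y * b₀ y) (*-nonNeg 0≤p (0≤a₀ x)) (*-nonNeg 0≤q (0≤b₀ y))
            (scale≤8 0≤p p≤2 (0≤a₀ x) (a₀≤4 x)) (scale≤8 0≤q q≤2 (0≤b₀ y) (b₀≤4 y)) (bounded-cong t₀ (rearrange _ _ _ _ _) bd₀))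
          (stage-error t₁ (λ x → ra x * a₁ x) (λ y → rb y * b₁ y) (*-nonNeg 0≤p (0≤a₁ x)) (*-nonNeg 0≤q (0≤b₁ y))
            (scale≤8 0≤p p≤2 (0≤a₁ x) (a₁≤4 x)) (scale≤8 0≤q q≤2 (0≤b₁ y) (b₁≤4 y)) (bounded-cong t₁ (rearrange _ _ _ _ _) bd₁))))
        where
        open Kernel κ
        p q α₀ α₁ γ₀ γ₁ : ℝ
        p = ra x
        q = rb y
        α₀ = a₀ x
        α₁ = a₁ x
        γ₀ = b₀ y
        γ₁ = b₁ y
        s₀ s₁ : ℝ
        s₀ = stage (attempts J) W* t₀ (λ x → ra x * a₀ x) (λ y → rb y * b₀ y) x y
        s₁ = stage (attempts J) W* t₁ (λ x → ra x * a₁ x) (λ y → rb y * b₁ y) x y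
        rearrange : ∀ R p q a c → R * (p * q) * (a * c) ≈ R * (p * a * (q * c))
        rearrange = solve 5 (λ R p q a c → R :* (p :* q) :* (a :* c) := R :* (p :* a :* (q :* c))) refl
        target≈ : target p q (v₀ * (α₀ * γ₀) * expectation t₀ x y + v₁ * (α₁ * γ₁) * expectation t₁ x y)
            - (1# * 1# * (v₀ * s₀ + v₁ * s₁) + (1# - 1# * 1#) * stopValue (attempts J t) W* ra rb x y)
          ≈ v₀ * (target (p * α₀) (q * γ₀) (expectation t₀ x y) - s₀) + v₁ * (target (p * α₁) (q * γ₁) (expectation t₁ x y) - s₁)
        target≈ = trans (sym (+-zero (diff≈0 E* Σv)))
          (trans (solve 15 (λ h p q e v u a c b d g k s z w → h :* (p :* q) :* (v :* (a :* c) :* g :+ u :* (b :* d) :* k) :+ (# 1 :- h :* (p :* q)) :* e :- (# 1 :* # 1 :* (v :* s :+ u :* z) :+ (# 1 :- # 1 :* # 1) :* w) :+ e :* (v :+ u :- # 1) := v :* (h :* (p :* a :* (q :* c)) :* g :+ (# 1 :- h :* (p :* a :* (q :* c))) :* e :- s) :+ u :* (h :* (p :* b :* (q :* d)) :* k :+ (# 1 :- h :* (p :* b :* (q :* d))) :* e :- z) :+ h :* (p :* q) :* e :* (v :* (a :* c) :+ u :* (b :* d) :- # 1)) refl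
              h p q E* v₀ v₁ α₀ γ₀ α₁ γ₁ (expectation t₀ x y) (expectation t₁ x y) s₀ s₁ (stopValue (attempts J t) W* ra rb x y)
            )
            (+-zero (diff≈0 (h * (p * q) * E*) (Σvab x y))))
        bound≈ : v₀ * bound (p * α₀) (q * γ₀) + v₁ * bound (p * α₁) (q * γ₁) ≈ bound p q
        bound≈ = trans
          (solve 10 (λ h p q b v u a c d f → v :* (h :* (b :* (# 3 :* ((# 1 :+ p :* a) :* (# 1 :+ q :* c)) :- # 1)) :+ (# 1 :- h :* (p :* a :* (q :* c))) :* (# 12 :* b)) :+ u :* (h :* (b :* (# 3 :* ((# 1 :+ p :* d) :* (# 1 :+ q :* f)) :- # 1)) :+ (# 1 :- h :* (p :* d :* (q :* f))) :* (# 12 :* b)) := h :* (b :* (# 3 :* ((# 1 :+ p) :* (# 1 :+ q)) :- # 1)) :+ (# 1 :- h :* (p :* q)) :* (# 12 :* b) :+ (# 2 :* h :* b :+ # 12 :* b) :* (v :+ u :- # 1) :+ # 3 :* h :* b :* p :* (v :* a :+ u :* d :- # 1) :+ # 3 :* h :* b :* q :* (v :* c :+ u :* f :- # 1) :+ (# 3 :* h :* b :* (p :* q) :- # 12 :* h :* b :* (p :* q)) :* (v :* (a :* c) :+ u :* (d :* f) :- # 1)) refl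
            h p q b v₀ v₁ α₀ γ₀ α₁ γ₁)
          (trans (+-zero (diff≈0 _ (Σvab x y))) (trans (+-zero (diff≈0 _ (Σvb y))) (trans (+-zero (diff≈0 _ (Σva x))) (+-zero (diff≈0 _ Σv)))))

    -- For p = q = 1 the bound of the stage is h · 11 b + (1 - h) · 12 b = (1 - h/12) · 12 b with h
    -- = 1/64, and h/12 is `rate`.
    attempts-error : ∀ J t {R β} → Bounded B x y t R → 0# ≤ R → 0# ≤ β → B ≤ R * (β * β) →
      (expectation t x y - attempts J t x y) within ρ ^ J * β
    attempts-error J t@(leaf g) bd 0≤R 0≤β B≤ = within-cong (sym (-‿inverseʳ _)) (within-0 (*-nonNeg (^-nonNeg J 0≤ρ) 0≤β))
    attempts-error zero t@(node _ _ _) bd 0≤R 0≤β B≤ = within-cong (solve 1 (λ e → e := e :- # 0) refl (expectation t x y))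
      (within-mono (≤-reflexive (sym (*-identityˡ _))) (expectation-within t bd 0≤R 0≤β B≤))
    attempts-error (suc J) t@(node _ _ _) {R} {β} bd 0≤R 0≤β B≤ =
      within-cong (+-congʳ (solve 2 (λ h e → h :* (# 1 :* # 1) :* e :+ (# 1 :- h :* (# 1 :* # 1)) :* e := e) refl (⅛ * ⅛) (expectation t x y)))
        (within-mono (≤-reflexive bound≈)
          (StageError.stage-error J (ρ ^ J) (^-nonNeg J 0≤ρ) (attempts-error J) (expectation t x y) (attempts J t x y) b R β (attempts J t) refl 0≤R 0≤β B≤ 12b≈
            (within-mono (≤-reflexive (sym 12b≈)) (attempts-error J t bd 0≤R 0≤β B≤))
            t (λ _ → 1#) (λ _ → 1#) 0≤1 0≤1 1≤8 1≤8 (bounded-cong t (solve 1 (λ r → r := r :* (# 1 :* # 1)) refl R) bd)))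
      where
      b : ℝ
      b = fromℕ 12 ⁻¹ * (ρ ^ J * β)
      12b≈ : fromℕ 12 * b ≈ ρ ^ J * β
      12b≈ = trans (sym (*-assoc _ _ _)) (trans (*-congʳ (*-inverseʳ (>⇒≉ (fromℕ-pos 11)))) (*-identityˡ _))
      1≤8 : 1# ≤ fromℕ 8
      1≤8 = ≤-via (fromℕ-nonNeg 7) (solve 0 (# 8 := # 1 :+ # 7) refl)
      bound≈ : ⅛ * ⅛ * (b * (fromℕ 3 * ((1# + 1#) * (1# + 1#)) - 1#)) + (1# - ⅛ * ⅛ * (1# * 1#)) * (fromℕ 12 * b) ≈ ρ ^ suc J * β
      bound≈ = trans (solve 2 (λ h b → h :* (b :* (# 3 :* ((# 1 :+ # 1) :* (# 1 :+ # 1)) :- # 1)) :+ (# 1 :- h :* (# 1 :* # 1)) :* (# 12 :* b) := # 12 :* b :- h :* b) refl (⅛ * ⅛) b)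
        (trans (+-congˡ (-‿cong (*-congʳ (sym 12*rate)))) (trans (solve 2 (λ b r → # 12 :* b :- # 12 :* r :* b := (# 1 :- r) :* (# 12 :* b)) refl b rate)
          (trans (*-congˡ 12b≈) (sym (*-assoc _ _ _)))))

  -- Message bits as chains of nodes with bounded likelihood ratios

  data Side : Set where
    aliceSide bobSide : Side

  module Splitting (nx ny : ℕ) where

    open PriorTrees nx ny public

    Private : Side → Set
    Private aliceSide = X
    Private bobSide = Y

    own : ∀ s → X → Y → Private s
    own aliceSide x y = x
    own bobSide x y = y

    record Ratios (Z : Set) : Set where
      field
        v₀ v₁ : ℝ
        r₀ r₁ : Z → ℝ
        0≤v₀ : 0# ≤ v₀
        0≤v₁ : 0# ≤ v₁
        0≤r₀ : ∀ z → 0# ≤ r₀ z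
        0≤r₁ : ∀ z → 0# ≤ r₁ z
        r₀≤4 : ∀ z → r₀ z ≤ fromℕ 4
        r₁≤4 : ∀ z → r₁ z ≤ fromℕ 4
        Σv : v₀ + v₁ ≈ 1#
        Σvr : ∀ z → v₀ * r₀ z + v₁ * r₁ z ≈ 1#

    1≤4 : 1# ≤ fromℕ 4
    1≤4 = ≤-via (fromℕ-nonNeg 3) (solve 0 (# 4 := # 1 :+ # 3) refl)

    kernel : ∀ s → Ratios (Private s) → Kernel
    kernel aliceSide ρ = record
      { Ratios ρ ; a₀ = r₀ ; a₁ = r₁ ; 0≤a₀ = 0≤r₀ ; 0≤a₁ = 0≤r₁ ; a₀≤4 = r₀≤4 ; a₁≤4 = r₁≤4 ; Σva = Σvr
      ; b₀ = λ _ → 1# ; b₁ = λ _ → 1# ; 0≤b₀ = λ _ → 0≤1 ; 0≤b₁ = λ _ → 0≤1 ; b₀≤4 = λ _ → 1≤4 ; b₁≤4 = λ _ → 1≤4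
      ; Σvb = λ _ → trans (+-cong (*-identityʳ _) (*-identityʳ _)) Σv
      ; Σvab = λ x _ → trans (+-cong (*-congˡ (*-identityʳ _)) (*-congˡ (*-identityʳ _))) (Σvr x) }
      where open Ratios ρ
    kernel bobSide ρ = record
      { Ratios ρ ; b₀ = r₀ ; b₁ = r₁ ; 0≤b₀ = 0≤r₀ ; 0≤b₁ = 0≤r₁ ; b₀≤4 = r₀≤4 ; b₁≤4 = r₁≤4 ; Σvb = Σvr
      ; a₀ = λ _ → 1# ; a₁ = λ _ → 1# ; 0≤a₀ = λ _ → 0≤1 ; 0≤a₁ = λ _ → 0≤1 ; a₀≤4 = λ _ → 1≤4 ; a₁≤4 = λ _ → 1≤4
      ; Σva = λ _ → trans (+-cong (*-identityʳ _) (*-identityʳ _)) Σv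
      ; Σvab = λ _ y → trans (+-cong (*-congˡ (*-identityˡ _)) (*-congˡ (*-identityˡ _))) (Σvr y) }
      where open Ratios ρ

    expectation-kernel : ∀ s ρ t₀ t₁ x y → let open Ratios ρ in
      expectation (node (kernel s ρ) t₀ t₁) x y ≈ v₀ * r₀ (own s x y) * expectation t₀ x y + v₁ * r₁ (own s x y) * expectation t₁ x y
    expectation-kernel aliceSide ρ t₀ t₁ x y = +-cong (*-congʳ (*-congˡ (*-identityʳ _))) (*-congʳ (*-congˡ (*-identityʳ _)))
    expectation-kernel bobSide ρ t₀ t₁ x y = +-cong (*-congʳ (*-congˡ (*-identityˡ _))) (*-congʳ (*-congˡ (*-identityˡ _)))

    bounded-kernel : ∀ {B x y R} s ρ t₀ t₁ → let open Ratios ρ in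
      Bounded B x y t₀ (R * r₀ (own s x y)) → Bounded B x y t₁ (R * r₁ (own s x y)) → Bounded B x y (node (kernel s ρ) t₀ t₁) R
    bounded-kernel aliceSide ρ t₀ t₁ p q = bounded-cong t₀ (*-congˡ (sym (*-identityʳ _))) p , bounded-cong t₁ (*-congˡ (sym (*-identityʳ _))) q
    bounded-kernel bobSide ρ t₀ t₁ p q = bounded-cong t₀ (*-congˡ (sym (*-identityˡ _))) p , bounded-cong t₁ (*-congˡ (sym (*-identityˡ _))) q

    -- `v` is the public prior and `u z` the law given the private input `z`. Unlike in `Ratios`,
    -- the quotients u/v are not controlled.
    record BitLaw (Z : Set) : Set where
      field
        v₀ v₁ : ℝ
        u₀ u₁ : Z → ℝ
        0≤v₀ : 0# ≤ v₀
        0≤v₁ : 0# ≤ v₁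
        0≤u₀ : ∀ z → 0# ≤ u₀ z
        0≤u₁ : ∀ z → 0# ≤ u₁ z
        Σv : v₀ + v₁ ≈ 1#
        Σu : ∀ z → u₀ z + u₁ z ≈ 1#

      u₀≤1 : ∀ z → u₀ z ≤ 1#
      u₀≤1 z = ≤-via (0≤u₁ z) (sym (Σu z))

      u₁≤1 : ∀ z → u₁ z ≤ 1#
      u₁≤1 z = ≤-via (0≤u₀ z) (trans (sym (Σu z)) (+-comm _ _))

    swap : ∀ {Z} → BitLaw Z → BitLaw Z
    swap o = record
      { v₀ = v₁ ; v₁ = v₀ ; u₀ = u₁ ; u₁ = u₀ ; 0≤v₀ = 0≤v₁ ; 0≤v₁ = 0≤v₀ ; 0≤u₀ = 0≤u₁ ; 0≤u₁ = 0≤u₀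
      ; Σv = trans (+-comm _ _) Σv ; Σu = λ z → trans (+-comm _ _) (Σu z) }
      where open BitLaw o

    quarter-pos : ∀ {v} → 1# ≤ fromℕ 4 * v → 0# < v
    quarter-pos {v} 1≤4v = ≰⇒> λ v≤0 → <⇒≱ 0<1 (≤-trans 1≤4v (≤-respʳ (zeroʳ _) (*-monoˡ-≤ (fromℕ 4) (fromℕ-nonNeg 4) v≤0)))

    direct : ∀ {Z} (o : BitLaw Z) → let open BitLaw o in 1# ≤ fromℕ 4 * v₀ → 1# ≤ fromℕ 4 * v₁ → Ratios Z
    direct o c₀ c₁ = record
      { v₀ = v₀ ; v₁ = v₁ ; r₀ = λ z → u₀ z / v₀ ; r₁ = λ z → u₁ z / v₁ ; 0≤v₀ = 0≤v₀ ; 0≤v₁ = 0≤v₁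
      ; 0≤r₀ = λ z → /-nonNeg (0≤u₀ z) 0≤v₀ ; 0≤r₁ = λ z → /-nonNeg (0≤u₁ z) 0≤v₁
      ; r₀≤4 = λ z → /≤ (quarter-pos c₀) (≤-trans (u₀≤1 z) c₀) ; r₁≤4 = λ z → /≤ (quarter-pos c₁) (≤-trans (u₁≤1 z) c₁)
      ; Σv = Σv
      ; Σvr = λ z → trans (+-cong (cancel c₀) (cancel c₁)) (Σu z) }
      where
      open BitLaw o
      cancel : ∀ {u v} → 1# ≤ fromℕ 4 * v → v * (u / v) ≈ u
      cancel c = trans (*-comm _ _) (/-cancel (>⇒≉ (quarter-pos c)))

    -- If bit 0 has prior v₀ < 1/4, one half of the prior mass, carrying bit 1 only, is split off;
    -- the remaining half has bit 0 with prior 2v₀.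
    module Rare {Z : Set} (o : BitLaw Z) (v₀≤¼ : fromℕ 4 * BitLaw.v₀ o ≤ 1#) where

      open BitLaw o

      3≤4v₁ : fromℕ 3 ≤ fromℕ 4 * v₁
      3≤4v₁ = ≤-via (0≤diff v₀≤¼) (trans (sym (+-zero (diff≈0 (fromℕ 4) (sym Σv)))) (solve 2 (λ v u → # 4 :* u :+ # 4 :* (# 1 :- (v :+ u)) := # 3 :+ (# 1 :- # 4 :* v)) refl v₀ v₁))

      0<2v₁ : 0# < fromℕ 2 * v₁
      0<2v₁ = *-pos 0<2 (quarter-pos (≤-trans (≤-via (fromℕ-nonNeg 2) (solve 0 (# 3 := # 1 :+ # 2) refl)) 3≤4v₁))

      1≤2v₁ : 1# ≤ fromℕ 2 * v₁
      1≤2v₁ = *-cancelˡ-≤ 0<2 (≤-trans (≤-via 0≤1 (solve 0 (# 3 := # 2 :* # 1 :+ # 1) refl)) (≤-respʳ (solve 1 (λ v → # 4 :* v := # 2 :* (# 2 :* v)) refl v₁) 3≤4v₁))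

      -- `uL` is the actual probability of the half that is split off, chosen to have ratio
      -- `u₁ / v₁` to its prior mass 1/2; `u₀′` is the probability of bit 0 given the other half.
      uL uR u₀′ : Z → ℝ
      uL z = u₁ z / (fromℕ 2 * v₁)
      uR z = 1# - uL z
      u₀′ z = u₀ z / uR z

      0≤uL : ∀ z → 0# ≤ uL z
      0≤uL z = /-nonNeg (0≤u₁ z) (proj₁ 0<2v₁)

      uL≤u₁ : ∀ z → uL z ≤ u₁ z
      uL≤u₁ z = /≤ 0<2v₁ (≤-respˡ (*-identityʳ _) (*-monoˡ-≤ (u₁ z) (0≤u₁ z) 1≤2v₁))

      3uL≤2 : ∀ z → fromℕ 3 * uL z ≤ fromℕ 2
      3uL≤2 z = ≤-respˡ (*-assoc _ _ _) (/≤ 0<2v₁ (≤-trans (≤-respʳ (*-identityʳ _) (*-monoˡ-≤ (fromℕ 3) (fromℕ-nonNeg 3) (u₁≤1 z)))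
        (≤-respʳ (solve 1 (λ v → # 4 :* v := # 2 :* (# 2 :* v)) refl v₁) 3≤4v₁)))

      0<uR : ∀ z → 0# < uR z
      0<uR z = ≰⇒> λ uR≤0 → <⇒≱ 0<1 (≤-via (+-nonNeg (0≤diff (3uL≤2 z)) (*-nonNeg (fromℕ-nonNeg 3) (0≤diff uR≤0)))
        (solve 1 (λ l → # 0 := # 1 :+ (# 2 :- # 3 :* l :+ # 3 :* (# 0 :- (# 1 :- l)))) refl (uL z)))

      uR≉0 : ∀ z → ¬ uR z ≈ 0#
      uR≉0 z = >⇒≉ (0<uR z)

      u₀≤uR : ∀ z → u₀ z ≤ uR z
      u₀≤uR z = ≤-via (0≤diff (uL≤u₁ z)) (trans (+-congʳ (sym (Σu z))) (solve 3 (λ u v l → u :+ v :- l := u :+ (v :- l)) refl (u₀ z) (u₁ z) (uL z)))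

      half : Ratios Z
      half = record
        { v₀ = ½ ; v₁ = ½ ; r₀ = λ z → fromℕ 2 * uR z ; r₁ = λ z → fromℕ 2 * uL z ; 0≤v₀ = 0≤½ ; 0≤v₁ = 0≤½
        ; 0≤r₀ = λ z → *-nonNeg (proj₁ 0<2) (proj₁ (0<uR z)) ; 0≤r₁ = λ z → *-nonNeg (proj₁ 0<2) (0≤uL z)
        ; r₀≤4 = λ z → ≤4 (≤-via (0≤uL z) (solve 1 (λ l → # 1 := # 1 :- l :+ l) refl (uL z)))
        ; r₁≤4 = λ z → ≤4 (≤-trans (uL≤u₁ z) (u₁≤1 z))
        ; Σv = ½+½
        ; Σvr = λ z → trans (solve 2 (λ h l → h :* (# 2 :* (# 1 :- l)) :+ h :* (# 2 :* l) := # 2 :* h) refl ½ (uL z)) 2*½ }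
        where
        ≤4 : ∀ {u} → u ≤ 1# → fromℕ 2 * u ≤ fromℕ 4
        ≤4 u≤1 = ≤-trans (*-monoˡ-≤ (fromℕ 2) (proj₁ 0<2) u≤1) (≤-via (proj₁ 0<2) (solve 0 (# 4 := # 2 :* # 1 :+ # 2) refl))

      rest : BitLaw Z
      rest = record
        { v₀ = fromℕ 2 * v₀ ; v₁ = 1# - fromℕ 2 * v₀ ; u₀ = u₀′ ; u₁ = λ z → 1# - u₀′ z
        ; 0≤v₀ = *-nonNeg (proj₁ 0<2) 0≤v₀ ; 0≤v₁ = 0≤diff (≤-trans (≤-via (*-nonNeg (proj₁ 0<2) 0≤v₀) (solve 1 (λ v → # 4 :* v := # 2 :* v :+ # 2 :* v) refl v₀)) v₀≤¼)
        ; 0≤u₀ = λ z → /-nonNeg (0≤u₀ z) (proj₁ (0<uR z))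
        ; 0≤u₁ = λ z → 0≤diff (/≤ (0<uR z) (≤-respʳ (sym (*-identityˡ _)) (u₀≤uR z)))
        ; Σv = solve 1 (λ v → v :+ (# 1 :- v) := # 1) refl _ ; Σu = λ z → solve 1 (λ v → v :+ (# 1 :- v) := # 1) refl (u₀′ z) }

      rest-v₀ : ∀ {k} → 1# ≤ 2^ (suc k) * (fromℕ 4 * v₀) → 1# ≤ 2^ k * (fromℕ 4 * (fromℕ 2 * v₀))
      rest-v₀ {k} = ≤-respʳ (solve 2 (λ p v → # 2 :* p :* (# 4 :* v) := p :* (# 4 :* (# 2 :* v))) refl (2^ k) v₀)

      rest-v₁ : ∀ {k} → 1# ≤ 2^ k * (fromℕ 4 * (1# - fromℕ 2 * v₀))
      rest-v₁ {k} = ≤-respˡ (*-identityˡ 1#) (*-mono-≤ 0≤1 (1≤2^ k) 0≤1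
        (≤-via (+-nonNeg (0≤diff v₀≤¼) (+-nonNeg (0≤diff v₀≤¼) 0≤1)) (solve 1 (λ v → # 4 :* (# 1 :- # 2 :* v) := # 1 :+ (# 1 :- # 4 :* v :+ (# 1 :- # 4 :* v :+ # 1))) refl v₀)))

      expectation≈ : ∀ z e₀ e₁ → ½ * (fromℕ 2 * uR z) * (u₀′ z * e₀ + (1# - u₀′ z) * e₁) + ½ * (fromℕ 2 * uL z) * e₁ ≈ u₀ z * e₀ + u₁ z * e₁
      expectation≈ z e₀ e₁ = trans
        (solve 5 (λ h l w e f → h :* (# 2 :* (# 1 :- l)) :* (w :* e :+ (# 1 :- w) :* f) :+ h :* (# 2 :* l) :* f := # 2 :* h :* (w :* (# 1 :- l) :* e :+ f :- w :* (# 1 :- l) :* f)) refl ½ (uL z) (u₀′ z) e₀ e₁)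
        (trans (*-cong 2*½ (+-cong (+-congʳ (*-congʳ (/-cancel (uR≉0 z)))) (-‿cong (*-congʳ (/-cancel (uR≉0 z))))))
          (trans (sym (+-zero (diff≈0 e₁ (Σu z)))) (solve 4 (λ u v e f → # 1 :* (u :* e :+ f :- u :* f) :+ f :* (u :+ v :- # 1) := u :* e :+ v :* f) refl (u₀ z) (u₁ z) e₀ e₁)))

      2uL≈ : ∀ z → fromℕ 2 * uL z ≈ u₁ z / v₁
      2uL≈ z = /-unique v₁≉0 (trans (solve 2 (λ l v → # 2 :* l :* v := l :* (# 2 :* v)) refl (uL z) v₁) (/-cancel (>⇒≉ 0<2v₁)))
        where
        v₁≉0 : ¬ v₁ ≈ 0#
        v₁≉0 v₁≈0 = >⇒≉ 0<2v₁ (trans (*-congˡ v₁≈0) (zeroʳ _))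

      ratio₀ : ¬ v₀ ≈ 0# → ∀ R z → R * (u₀ z / v₀) ≈ R * (fromℕ 2 * uR z) * (u₀′ z / (fromℕ 2 * v₀))
      ratio₀ v₀≉0 R z = trans (*-congˡ (sym (/-unique v₀≉0
          (trans (solve 4 (λ t w i v → t :* (w :* i) :* v := w :* (v :* t :* i)) refl (fromℕ 2 * uR z) (u₀′ z) ((fromℕ 2 * v₀) ⁻¹) v₀)
            (trans (*-congˡ (trans (solve 3 (λ r i v → v :* (# 2 :* r) :* i := r :* (# 2 :* v :* i)) refl (uR z) ((fromℕ 2 * v₀) ⁻¹) v₀) (trans (*-congˡ (*-inverseʳ (*-nonZero (>⇒≉ 0<2) v₀≉0))) (*-identityʳ _)))) (/-cancel (uR≉0 z)))))))
        (sym (*-assoc _ _ _))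

      ratio₁ : ∀ R z → R * (u₁ z / v₁) ≈ R * (fromℕ 2 * uR z) * ((1# - u₀′ z) / (1# - fromℕ 2 * v₀))
      ratio₁ R z = trans (*-congˡ (trans (sym (2uL≈ z)) (/-unique d≉0 lemma)))
        (trans (*-congˡ (solve 3 (λ r w i → # 2 :* r :* (# 1 :- w) :* i := # 2 :* r :* ((# 1 :- w) :* i)) refl (uR z) (u₀′ z) ((1# - fromℕ 2 * v₀) ⁻¹))) (sym (*-assoc _ _ _)))
        where
        d≉0 : ¬ 1# - fromℕ 2 * v₀ ≈ 0#
        d≉0 = >⇒≉ (quarter-pos (≤-respʳ (*-identityˡ _) (rest-v₁ {0})))
        lemma : fromℕ 2 * uL z * (1# - fromℕ 2 * v₀) ≈ fromℕ 2 * uR z * (1# - u₀′ z)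
        lemma = trans (sym (+-zero (diff≈0 (fromℕ 4 * uL z) Σv)))
          (trans (solve 3 (λ l v u → # 2 :* l :* (# 1 :- # 2 :* v) :+ # 4 :* l :* (v :+ u :- # 1) := # 2 :* (l :* (# 2 :* u) :- l)) refl (uL z) v₀ v₁)
            (trans (*-congˡ (+-congʳ (/-cancel (>⇒≉ 0<2v₁))))
              (trans (sym (+-zero (diff≈0 (- fromℕ 2) (Σu z)))) (trans (sym (+-zero (diff≈0 (- fromℕ 2) (/-cancel {u₀ z} (uR≉0 z)))))
                (solve 4 (λ u l v w → # 2 :* (u :- l) :+ :- # 2 :* (v :+ u :- # 1) :+ :- # 2 :* (w :* (# 1 :- l) :- v) := # 2 :* (# 1 :- l) :* (# 1 :- w)) refl (u₁ z) (uL z) (u₀ z) (u₀′ z))))))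

    quarter? : ∀ v → Dec (1# ≤ fromℕ 4 * v)
    quarter? v = dec (1# ≤ fromℕ 4 * v)

    mutual

      -- A rare step doubles the prior of the rare bit and leaves the other bit a prior of at least
      -- 1/2, so by hypothesis `k` doublings lead to priors of at least 1/4. The subtree of the
      -- frequent bit is duplicated at every step, which does not affect the height.
      split : ∀ k s (o : BitLaw (Private s)) → let open BitLaw o in
        1# ≤ 2^ k * (fromℕ 4 * v₀) → 1# ≤ 2^ k * (fromℕ 4 * v₁) → PTree → PTree → PTree
      split zero s o c₀ c₁ t₀ t₁ =
        node (kernel s (direct o (≤-respʳ (*-identityˡ _) c₀) (≤-respʳ (*-identityˡ _) c₁))) t₀ t₁
      split (suc k) s o c₀ c₁ t₀ t₁ with quarter? (BitLaw.v₀ o) | quarter? (BitLaw.v₁ o)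
      ... | yes q₀ | yes q₁ = node (kernel s (direct o q₀ q₁)) t₀ t₁
      ... | no r₀ | _ = splitRare k s o (≰⇒≥ r₀) c₀ t₀ t₁
      ... | yes _ | no r₁ = splitRare k s (swap o) (≰⇒≥ r₁) c₁ t₁ t₀

      splitRare : ∀ k s (o : BitLaw (Private s)) → let open BitLaw o in
        fromℕ 4 * v₀ ≤ 1# → 1# ≤ 2^ (suc k) * (fromℕ 4 * v₀) → PTree → PTree → PTree
      splitRare k s o r c t₀ t₁ = node (kernel s half) (split k s rest (rest-v₀ {k} c) (rest-v₁ {k}) t₀ t₁) t₁
        where open Rare o r

    private
      power-pos : ∀ {k v} → 0# ≤ v → 1# ≤ 2^ k * (fromℕ 4 * v) → ¬ v ≈ 0#
      power-pos {k} 0≤v c v≈0 = <⇒≱ 0<1 (≤-respʳ (trans (*-congˡ (trans (*-congˡ v≈0) (zeroʳ _))) (zeroʳ _)) c)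

    expectation-direct : ∀ s o q₀ q₁ t₀ t₁ x y → let open BitLaw o in
      expectation (node (kernel s (direct o q₀ q₁)) t₀ t₁) x y ≈ u₀ (own s x y) * expectation t₀ x y + u₁ (own s x y) * expectation t₁ x y
    expectation-direct s o q₀ q₁ t₀ t₁ x y = trans (expectation-kernel s (direct o q₀ q₁) t₀ t₁ x y)
      (+-cong (*-congʳ (trans (*-comm _ _) (/-cancel (>⇒≉ (quarter-pos q₀))))) (*-congʳ (trans (*-comm _ _) (/-cancel (>⇒≉ (quarter-pos q₁))))))

    expectation-split : ∀ k s o c₀ c₁ t₀ t₁ x y → let open BitLaw o in
      expectation (split k s o c₀ c₁ t₀ t₁) x y ≈ u₀ (own s x y) * expectation t₀ x y + u₁ (own s x y) * expectation t₁ x y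
    expectation-splitRare : ∀ k s o r c t₀ t₁ x y → let open BitLaw o in
      expectation (splitRare k s o r c t₀ t₁) x y ≈ u₀ (own s x y) * expectation t₀ x y + u₁ (own s x y) * expectation t₁ x y

    expectation-split zero s o c₀ c₁ t₀ t₁ x y = expectation-direct s o _ _ t₀ t₁ x y
    expectation-split (suc k) s o c₀ c₁ t₀ t₁ x y with quarter? (BitLaw.v₀ o) | quarter? (BitLaw.v₁ o)
    ... | yes q₀ | yes q₁ = expectation-direct s o q₀ q₁ t₀ t₁ x y
    ... | no r₀ | _ = expectation-splitRare k s o (≰⇒≥ r₀) c₀ t₀ t₁ x y
    ... | yes _ | no r₁ = trans (expectation-splitRare k s (swap o) (≰⇒≥ r₁) c₁ t₁ t₀ x y) (+-comm _ _)

    expectation-splitRare k s o r c t₀ t₁ x y = trans (expectation-kernel s half (split k s rest (rest-v₀ {k} c) (rest-v₁ {k}) t₀ t₁) t₁ x y)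
      (trans (+-congʳ (*-congˡ (expectation-split k s rest (rest-v₀ {k} c) (rest-v₁ {k}) t₀ t₁ x y))) (expectation≈ (own s x y) _ _))
      where open Rare o r

    -- Both routes to the frequent bit have its ratio `u₁ / v₁`, and the single route to the rare
    -- bit has `u₀ / v₀`. The chain thus shows the ratios of one undivided node.
    bounded-split : ∀ {B x y} k s o c₀ c₁ t₀ t₁ {R} → let open BitLaw o ; z = own s x y in
      Bounded B x y t₀ (R * (u₀ z / v₀)) → Bounded B x y t₁ (R * (u₁ z / v₁)) → Bounded B x y (split k s o c₀ c₁ t₀ t₁) R
    bounded-splitRare : ∀ {B x y} k s o r c t₀ t₁ {R} → let open BitLaw o ; z = own s x y in
      Bounded B x y t₀ (R * (u₀ z / v₀)) → Bounded B x y t₁ (R * (u₁ z / v₁)) → Bounded B x y (splitRare k s o r c t₀ t₁) R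

    bounded-split zero s o c₀ c₁ t₀ t₁ p q = bounded-kernel s (direct o _ _) t₀ t₁ p q
    bounded-split (suc k) s o c₀ c₁ t₀ t₁ p q with quarter? (BitLaw.v₀ o) | quarter? (BitLaw.v₁ o)
    ... | yes q₀ | yes q₁ = bounded-kernel s (direct o q₀ q₁) t₀ t₁ p q
    ... | no r₀ | _ = bounded-splitRare k s o (≰⇒≥ r₀) c₀ t₀ t₁ p q
    ... | yes _ | no r₁ = bounded-splitRare k s (swap o) (≰⇒≥ r₁) c₁ t₁ t₀ q p

    bounded-splitRare {x = x} {y} k s o r c t₀ t₁ {R} p q = bounded-kernel s half (split k s rest (rest-v₀ {k} c) (rest-v₁ {k}) t₀ t₁) t₁
      (bounded-split k s rest (rest-v₀ {k} c) (rest-v₁ {k}) t₀ t₁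
        (bounded-cong t₀ (ratio₀ (power-pos {suc k} 0≤v₀ c) R z) p) (bounded-cong t₁ (ratio₁ R z) q))
      (bounded-cong t₁ (*-congˡ (sym (2uL≈ z))) q)
      where
      open Rare o r
      open BitLaw o
      z : Private s
      z = own s x y

    height-split : ∀ k s o c₀ c₁ t₀ t₁ → height (split k s o c₀ c₁ t₀ t₁) ℕ.≤ suc k ℕ.+ (height t₀ ℕ.⊔ height t₁)
    height-splitRare : ∀ k s o r c t₀ t₁ → height (splitRare k s o r c t₀ t₁) ℕ.≤ suc (suc k) ℕ.+ (height t₀ ℕ.⊔ height t₁)

    height-split zero s o c₀ c₁ t₀ t₁ = ℕ.≤-refl
    height-split (suc k) s o c₀ c₁ t₀ t₁ with quarter? (BitLaw.v₀ o) | quarter? (BitLaw.v₁ o)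
    ... | yes q₀ | yes q₁ = s≤s (ℕ.m≤n+m _ (suc k))
    ... | no r₀ | _ = height-splitRare k s o (≰⇒≥ r₀) c₀ t₀ t₁
    ... | yes _ | no r₁ = ℕ.≤-trans (height-splitRare k s (swap o) (≰⇒≥ r₁) c₁ t₁ t₀) (ℕ.≤-reflexive (≡.cong (suc (suc k) ℕ.+_) (ℕ.⊔-comm (height t₁) (height t₀))))

    height-splitRare k s o r c t₀ t₁ = s≤s (ℕ.⊔-lub (height-split k s rest (rest-v₀ {k} c) (rest-v₁ {k}) t₀ t₁)
      (ℕ.≤-trans (ℕ.m≤n⊔m (height t₀) (height t₁)) (ℕ.m≤n+m _ (suc k))))
      where open Rare o r

    leaves-split : ∀ {P} k s o c₀ c₁ t₀ t₁ → Leaves P t₀ → Leaves P t₁ → Leaves P (split k s o c₀ c₁ t₀ t₁)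
    leaves-splitRare : ∀ {P} k s o r c t₀ t₁ → Leaves P t₀ → Leaves P t₁ → Leaves P (splitRare k s o r c t₀ t₁)

    leaves-split zero s o c₀ c₁ t₀ t₁ p q = p , q
    leaves-split (suc k) s o c₀ c₁ t₀ t₁ p q with quarter? (BitLaw.v₀ o) | quarter? (BitLaw.v₁ o)
    ... | yes q₀ | yes q₁ = p , q
    ... | no r₀ | _ = leaves-splitRare k s o (≰⇒≥ r₀) c₀ t₀ t₁ p q
    ... | yes _ | no r₁ = leaves-splitRare k s (swap o) (≰⇒≥ r₁) c₁ t₁ t₀ q p

    leaves-splitRare k s o r c t₀ t₁ p q = leaves-split k s rest (rest-v₀ {k} c) (rest-v₁ {k}) t₀ t₁ p q , q
      where open Rare o r

  -- Sending a message over a large alphabet by rejection sampling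

  module Rejection (nx ny : ℕ) where

    open Simulation nx ny

    -- Alice selects one of n public continuations.
    SimSelect : ℕ → ℕ → Matrix → Set
    SimSelect n T g = ∀ w → ∃ λ (j : X → ℕ) → (∀ x → j x ℕ.< n) × ∃ λ (G : ℕ → Matrix) →
      (∀ i → Sim T (G i)) × ⟨ w , g ⟩ ≤ ⟨ w , (λ x y → G (j x) x y) ⟩

    simSelect⇒sim : ∀ {n T g} ℓ → n ℕ.≤ 2 ℕ.^ ℓ → SimSelect n T g → Sim (ℓ ℕ.+ T) g
    simSelect⇒sim ℓ n≤ sel w =
      let j , j<n , G , sims , le = sel w
          t , d , le′ = sim-select-alice ℓ G j (λ x → ℕ.≤-trans (j<n x) n≤) sims w
      in t , d , ≤-trans le le′

    simSelect-cong : ∀ {n T g g′} → (∀ x y → g x y ≈ g′ x y) → SimSelect n T g → SimSelect n T g′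
    simSelect-cong g≈g′ sel w =
      let j , j<n , G , sims , le = sel w
      in j , j<n , G , sims , ≤-respˡ (⟨⟩-cong λ x y → *-congˡ (g≈g′ x y)) le

    -- Index 0 stands for the value 0, index 1 for accepting the present sample, 2 + i for option i
    -- of the later trials; an index of largest row value is taken.
    pick : ℕ → ℝ → ℝ → ℕ
    pick i p q with total p q
    pick i p q | inj₁ p≤q with total 0# q
    ... | inj₁ _ = 2 ℕ.+ i
    ... | inj₂ _ = 0
    pick i p q | inj₂ q≤p with total 0# p
    ... | inj₁ _ = 1
    ... | inj₂ _ = 0

    pick< : ∀ {n} i p q → i ℕ.< n → pick i p q ℕ.< 2 ℕ.+ n
    pick< i p q i<n with total p q
    pick< i p q i<n | inj₁ p≤q with total 0# q
    ... | inj₁ _ = s≤s (s≤s i<n)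
    ... | inj₂ _ = s≤s z≤n
    pick< i p q i<n | inj₂ q≤p with total 0# p
    ... | inj₁ _ = s≤s (s≤s z≤n)
    ... | inj₂ _ = s≤s z≤n

    options : ∀ {A : Set} → A → A → (ℕ → A) → ℕ → A
    options z a G 0 = z
    options z a G 1 = a
    options z a G (suc (suc i)) = G i

    pick-max : ∀ i (p : ℝ) (q : ℕ → ℝ) → let best = options 0# p q (pick i p (q i)) in 0# ≤ best × p ≤ best × q i ≤ best
    pick-max i p q with total p (q i)
    pick-max i p q | inj₁ p≤q with total 0# (q i)
    ... | inj₁ 0≤q = 0≤q , p≤q , ≤-refl
    ... | inj₂ q≤0 = ≤-refl , ≤-trans p≤q q≤0 , q≤0
    pick-max i p q | inj₂ q≤p with total 0# p
    ... | inj₁ 0≤p = 0≤p , ≤-refl , q≤p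
    ... | inj₂ p≤0 = ≤-refl , p≤0 , ≤-trans q≤p p≤0

    subaverage≤ : ∀ {a α p q m} → 0# ≤ a → 0# ≤ α → a + α ≤ 1# → 0# ≤ m → p ≤ m → q ≤ m → a * p + α * q ≤ m
    subaverage≤ {a} {α} {m = m} 0≤a 0≤α a+α≤1 0≤m p≤m q≤m = ≤-trans (+-mono-≤ (*-monoˡ-≤ a 0≤a p≤m) (*-monoˡ-≤ α 0≤α q≤m))
      (≤-respˡ (distribʳ m a α) (≤-respʳ (*-identityˡ m) (*-monoʳ-≤ m 0≤m a+α≤1)))

    -- No bit is sent yet: row by row, the best of 0, the present sample and the choice among later
    -- trials is recorded. A trial adds two options, so a single announcement of logarithmic length
    -- covers all trials.
    select-alice : ∀ {n T} {V g : Matrix} (a α : X → ℝ) → (∀ x → 0# ≤ a x) → (∀ x → 0# ≤ α x) → (∀ x → a x + α x ≤ 1#) →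
      Sim T V → SimSelect n T g → SimSelect (2 ℕ.+ n) T λ x y → a x * V x y + α x * g x y
    select-alice {n} {T} {V} {g} a α 0≤a 0≤α a+α≤1 simV selg w =
      let j , j<n , G , sims , le = selg (λ x y → α x * w x y)
          G′ = options (λ _ _ → 0#) V G
          j′ = λ x → pick (j x) (row V x) (row (G (j x)) x)
      in j′ , (λ x → pick< (j x) _ _ (j<n x)) , G′ ,
         (λ { 0 → sim-mono z≤n sim-0 ; 1 → simV ; (suc (suc i)) → sims i }) ,
         (begin
           (∑ λ x → ∑ λ y → w x y * (a x * V x y + α x * g x y))
             ≈⟨ ∑∑-cong (λ x y → solve 5 (λ w a v b g → w :* (a :* v :+ b :* g) := a :* (w :* v) :+ b :* w :* g) refl (w x y) (a x) (V x y) (α x) (g x y)) ⟩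
           (∑ λ x → ∑ λ y → a x * (w x y * V x y) + α x * w x y * g x y)
             ≈⟨ ∑∑-+ _ _ ⟩
           (∑ λ x → ∑ λ y → a x * (w x y * V x y)) + ⟨ (λ x y → α x * w x y) , g ⟩
             ≤⟨ +-mono-≤ ≤-refl le ⟩
           (∑ λ x → ∑ λ y → a x * (w x y * V x y)) + (∑ λ x → ∑ λ y → α x * w x y * G (j x) x y)
             ≈⟨ +-cong (∑-cong λ x → sym (*-∑ˡ (a x) _)) (∑-cong λ x → trans (∑-cong λ y → *-assoc _ _ _) (sym (*-∑ˡ (α x) _))) ⟩
           (∑ λ x → a x * row V x) + (∑ λ x → α x * row (G (j x)) x)
             ≈⟨ sym (∑-+ _ _) ⟩
           (∑ λ x → a x * row V x + α x * row (G (j x)) x)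
             ≤⟨ ∑-mono (λ x → let p , q , r = pick-max (j x) (row V x) (λ i → row (G i) x) in subaverage≤ (0≤a x) (0≤α x) (a+α≤1 x) p q r) ⟩
           (∑ λ x → options 0# (row V x) (λ i → row (G i) x) (j′ x))
             ≈⟨ ∑-cong (λ x → row-options G x (j′ x)) ⟩
           (∑ λ x → row (G′ (j′ x)) x) ∎)
      where
      open ≤R
      row : Matrix → X → ℝ
      row M x = ∑ λ y → w x y * M x y
      row-options : ∀ G x i → options 0# (row V x) (λ i → row (G i) x) i ≈ row (options (λ _ _ → 0#) V G i) x
      row-options G x 0 = sym (∑-zero λ y → zeroʳ _)
      row-options G x 1 = refl
      row-options G x (suc (suc i)) = refl

    select-average : ∀ {n T k} (v : Fin k → ℝ) (g : Fin k → Matrix) → (∀ i → 0# ≤ v i) → ∑ v ≈ 1# →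
      (∀ i → SimSelect n T (g i)) → SimSelect n T λ x y → ∑ λ i → v i * g i x y
    select-average v g 0≤v Σv≈1 sels w =
      let i , le = average≤some v (λ i → ⟨ w , g i ⟩) 0≤v Σv≈1
          j , j<n , G , sims , le′ = sels i w
      in j , j<n , G , sims , ≤-trans (≤-reflexive (⟨⟩-average v g w)) (≤-trans le le′)

    module _ {T k : ℕ} (v : Fin k → ℝ) (0≤v : ∀ i → 0# ≤ v i) (Σv≈1 : ∑ v ≈ 1#)
      (r : Fin k → X → ℝ) (0≤r : ∀ i x → 0# ≤ r i x) (Σvr≤1 : ∀ x → (∑ λ i → v i * r i x) ≤ 1#)
      (V : Fin k → Matrix) (simV : ∀ i → Sim T (V i))
      {L γ : ℝ} (r≤L : ∀ i x → r i x ≤ L) (0≤γ : 0# ≤ γ) (γL≤1 : γ * (L + 1#) ≤ 1#) where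

      target : Matrix
      target x y = ∑ λ i → v i * r i x * V i x y

      Σvr : X → ℝ
      Σvr x = ∑ λ i → v i * r i x

      -- The probability γ(1 - Σvr) of a garbage symbol makes every trial end with probability exactly γ.
      garbage : X → ℝ
      garbage x = γ * (1# - Σvr x)

      0≤garbage : ∀ x → 0# ≤ garbage x
      0≤garbage x = *-nonNeg 0≤γ (0≤diff (Σvr≤1 x))

      continue : Fin k → X → ℝ
      continue i x = 1# - γ * r i x - garbage x

      0≤Σvr : ∀ x → 0# ≤ Σvr x
      0≤Σvr x = ∑-nonNeg λ i → *-nonNeg (0≤v i) (0≤r i x)

      0≤continue : ∀ i x → 0# ≤ continue i x
      0≤continue i x = ≤-via (+-nonNeg (0≤diff γL≤1) (+-nonNeg (*-nonNeg 0≤γ (0≤diff (r≤L i x))) (*-nonNeg 0≤γ (0≤Σvr x))))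
        (solve 4 (λ g r s l → # 1 :- g :* r :- g :* (# 1 :- s) := # 0 :+ (# 1 :- g :* (l :+ # 1) :+ (g :* (l :- r) :+ g :* s))) refl γ (r i x) (Σvr x) L)

      -- A trial ends with probability γ whatever x is, so the target comes out multiplied by a
      -- constant, the probability that one of `K` trials ends.
      trials : ∀ K → SimSelect (suc (K ℕ.* 2)) T λ x y → (1# - (1# - γ) ^ K) * target x y
      trials zero w = (λ _ → 0) , (λ _ → s≤s z≤n) , (λ _ _ _ → 0#) , (λ _ → sim-mono z≤n sim-0) ,
        ≤-reflexive (⟨⟩-cong λ x y → *-congˡ (solve 1 (λ z → (# 1 :- # 1) :* z := # 0) refl (target x y)))
      trials (suc K) = simSelect-cong value
        (select-average v (λ i x y → γ * r i x * V i x y + continue i x * ((1# - (1# - γ) ^ K) * target x y)) 0≤v Σv≈1 λ i →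
          select-alice (λ x → γ * r i x) (continue i) (λ x → *-nonNeg 0≤γ (0≤r i x)) (0≤continue i)
            (λ x → ≤-via (0≤garbage x) (solve 2 (λ a g → # 1 := a :+ (# 1 :- a :- g) :+ g) refl (γ * r i x) (garbage x))) (simV i) (trials K))
        where
        value : ∀ x y → (∑ λ i → v i * (γ * r i x * V i x y + continue i x * ((1# - (1# - γ) ^ K) * target x y))) ≈ (1# - (1# - γ) ^ suc K) * target x y
        value x y = begin
          (∑ λ i → v i * (γ * r i x * V i x y + continue i x * H))
            ≈⟨ ∑-cong (λ i → solve 6 (λ v g r w b h → v :* (g :* r :* w :+ (# 1 :- g :* r :- b) :* h) := g :* (v :* r :* w) :+ (v :* ((# 1 :- b) :* h) :- v :* r :* (g :* h))) refl (v i) γ (r i x) (V i x y) (garbage x) H) ⟩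
          (∑ λ i → γ * (v i * r i x * V i x y) + (v i * ((1# - garbage x) * H) - v i * r i x * (γ * H)))
            ≈⟨ trans (∑-+ _ _) (+-cong (sym (*-∑ˡ γ _)) (trans (∑-+ _ _) (+-cong (sym (*-∑ʳ _ v)) (trans (sym (∑-neg _)) (-‿cong (sym (*-∑ʳ _ (λ i → v i * r i x)))))))) ⟩
          γ * target x y + (∑ v * ((1# - garbage x) * H) - Σvr x * (γ * H))
            ≈⟨ +-congˡ (+-congʳ (*-congʳ Σv≈1)) ⟩
          γ * target x y + (1# * ((1# - garbage x) * H) - Σvr x * (γ * H))
            ≈⟨ solve 4 (λ g t s p → g :* t :+ (# 1 :* ((# 1 :- g :* (# 1 :- s)) :* ((# 1 :- p) :* t)) :- s :* (g :* ((# 1 :- p) :* t))) := (# 1 :- (# 1 :- g) :* p) :* t) refl γ (target x y) (Σvr x) ((1# - γ) ^ K) ⟩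
          (1# - (1# - γ) ^ suc K) * target x y ∎
          where
          open SetoidReasoning setoid
          H : ℝ
          H = (1# - (1# - γ) ^ K) * target x y

      sim-rejection : ∀ K ℓ → suc (K ℕ.* 2) ℕ.≤ 2 ℕ.^ ℓ → Sim (ℓ ℕ.+ T) λ x y → (1# - (1# - γ) ^ K) * target x y
      sim-rejection K ℓ le = simSelect⇒sim ℓ le (trials K)

  -- Logarithms

  2^-cancel-≤ : ∀ {m n} → 2^ m ≤ 2^ n → m ℕ.≤ n
  2^-cancel-≤ {m} {n} le with m ℕ.≤? n
  ... | yes m≤n = m≤n
  ... | no m≰n = ⊥-elim (<⇒≱ (2^-pos n) (≤-via (0≤diff (≤-trans (2^-mono (ℕ.≰⇒> m≰n)) le)) (solve 1 (λ p → # 0 := p :+ (p :- # 2 :* p)) refl (2^ n))))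

  ≤2^ : ∀ x → ∃ λ k → x ≤ 2^ k
  ≤2^ x = let k , x≤k = archimedean x in k , ≤-trans x≤k (fromℕ≤2^ k)

  ½^≤ : ∀ {x} → 0# < x → ∃ λ k → ½ ^ k ≤ x
  ½^≤ {x} 0<x = let k , le = ≤2^ (x ⁻¹) in k , *-cancelˡ-≤ (2^-pos k)
    (≤-respˡ (sym (2^*½^ k)) (≤-respˡ (x⁻¹*x≈1 (>⇒≉ 0<x)) (*-monoʳ-≤ x (proj₁ 0<x) le)))

  LogBelow : ℝ → ℝ → Set
  LogBelow x t = ∃ λ a → ∃ λ b → ∃ λ n → (fromℕ (suc n) * t ≈ fromℕ a - fromℕ b) × (fromℕ 2 ^ a ≤ fromℕ 2 ^ b * x ^ suc n)

  -- With the denominator cleared, both bounds on x raised to the power n + 1 compare two powers of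
  -- two, hence their exponents.
  logBelow-upper : ∀ {x j k} → 0# ≤ x → 2^ j * x ≤ 2^ k → UpperBound (LogBelow x) (fromℕ k - fromℕ j)
  logBelow-upper {x} {j} {k} 0≤x le {t} (a , b , n , eq , pow) = *-cancelˡ-≤ (fromℕ-pos n)
    (≤-respˡ (sym eq) (≤-via (0≤diff (fromℕ-mono nat))
      (trans (solve 5 (λ n k j a b → n :* (k :- j) := a :- b :+ (b :+ k :* n :- (a :+ j :* n))) refl N (fromℕ k) (fromℕ j) (fromℕ a) (fromℕ b))
        (+-congˡ (sym (+-cong (hom b k) (-‿cong (hom a j))))))))
    where
    N : ℝ
    N = fromℕ (suc n)
    hom : ∀ b k → fromℕ (b ℕ.+ k ℕ.* suc n) ≈ fromℕ b + fromℕ k * N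
    hom b k = trans (fromℕ-homo-+ b (k ℕ.* suc n)) (+-congˡ (fromℕ-homo-* k (suc n)))
    split : ∀ b k → 2^ (b ℕ.+ k ℕ.* suc n) ≈ 2^ b * 2^ k ^ suc n
    split b k = trans (^-homo-* (fromℕ 2) b _) (*-congˡ (sym (^-assocʳ (fromℕ 2) k (suc n))))
    nat : a ℕ.+ j ℕ.* suc n ℕ.≤ b ℕ.+ k ℕ.* suc n
    nat = 2^-cancel-≤ (begin
      2^ (a ℕ.+ j ℕ.* suc n)               ≈⟨ split a j ⟩
      2^ a * 2^ j ^ suc n                  ≤⟨ *-monoʳ-≤ _ (^-nonNeg (suc n) (proj₁ (2^-pos j))) pow ⟩
      2^ b * x ^ suc n * 2^ j ^ suc n      ≈⟨ trans (*-assoc _ _ _) (*-congˡ (trans (*-comm _ _) (sym (^-distrib-* (2^ j) x (suc n))))) ⟩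
      2^ b * (2^ j * x) ^ suc n            ≤⟨ *-monoˡ-≤ _ (proj₁ (2^-pos b)) (^-mono-≤ (suc n) (*-nonNeg (proj₁ (2^-pos j)) 0≤x) le) ⟩
      2^ b * 2^ k ^ suc n                  ≈⟨ sym (split b k) ⟩
      2^ (b ℕ.+ k ℕ.* suc n)               ∎)
      where open ≤R

  logBelow-member : ∀ {x a b} → 2^ a ≤ 2^ b * x → LogBelow x (fromℕ a - fromℕ b)
  logBelow-member {a = a} {b} le = a , b , 0 , solve 1 (λ z → (# 1 :+ # 0) :* z := z) refl (fromℕ a - fromℕ b) , ≤-respʳ (*-congˡ (sym (*-identityʳ _))) le

  logBelow-inhabited : ∀ {x} → 0# < x → ∃ (LogBelow x)
  logBelow-inhabited {x} 0<x = let k , le = ½^≤ 0<x in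
    _ , logBelow-member {a = 0} {k} (≤-respˡ (2^*½^ k) (*-monoˡ-≤ _ (proj₁ (2^-pos k)) le))

  logBelow-bounded : ∀ {x} → 0# < x → ∃ (UpperBound (LogBelow x))
  logBelow-bounded {x} 0<x = let k , le = ≤2^ x in
    _ , logBelow-upper {j = 0} {k} (proj₁ 0<x) (≤-respˡ (sym (*-identityˡ x)) le)

  log-≥ : ∀ {x t} → 0# < x → LogBelow x t → t ≤ log₂ x
  log-≥ 0<x = sup-upper (logBelow-inhabited 0<x) (logBelow-bounded 0<x)

  log-≤ : ∀ {x u} → 0# < x → UpperBound (LogBelow x) u → log₂ x ≤ u
  log-≤ 0<x = sup-least (logBelow-inhabited 0<x) (logBelow-bounded 0<x)

  log-upper : ∀ {x} j k → 0# < x → 2^ j * x ≤ 2^ k → log₂ x ≤ fromℕ k - fromℕ j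
  log-upper j k 0<x le = log-≤ 0<x (logBelow-upper {j = j} {k} (proj₁ 0<x) le)

  log-lower : ∀ {x} a b → 0# < x → 2^ a ≤ 2^ b * x → fromℕ a - fromℕ b ≤ log₂ x
  log-lower a b 0<x le = log-≥ 0<x (logBelow-member {a = a} {b} le)

  log-mono : ∀ {x y} → 0# < x → x ≤ y → log₂ x ≤ log₂ y
  log-mono 0<x x≤y = log-≤ 0<x λ (a , b , n , eq , pow) → log-≥ (<-≤-trans 0<x x≤y)
    (a , b , n , eq , ≤-trans pow (*-monoˡ-≤ _ (proj₁ (2^-pos b)) (^-mono-≤ (suc n) (proj₁ 0<x) x≤y)))

  -- Rational lower bounds add over a common denominator. This direction suffices: the cost is the
  -- logarithm of a product, and bounding it bounds the sum of the logarithms.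
  log-super : ∀ {x y} → 0# < x → 0# < y → log₂ x + log₂ y ≤ log₂ (x * y)
  log-super {x} {y} 0<x 0<y = ≤-trans (+-monoˡ-≤ (log₂ y) (log-≤ 0<x λ {t} St →
      ≤-trans (≤-reflexive (solve 2 (λ t l → t := l :- (l :- t)) refl t (log₂ (x * y)))) (+-monoʳ-≤ _ (neg-mono-≤ (log-≤ 0<y λ {t′} St′ →
        ≤-via (0≤diff (log-≥ (*-pos 0<x 0<y) (sum-member St St′))) (solve 3 (λ t s l → l :- t := s :+ (l :- (t :+ s))) refl t t′ (log₂ (x * y))))))))
    (≤-reflexive (solve 2 (λ l m → l :- m :+ m := l) refl (log₂ (x * y)) (log₂ y)))
    where
    sum-member : ∀ {t t′} → LogBelow x t → LogBelow y t′ → LogBelow (x * y) (t + t′)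
    sum-member {t} {t′} (a , b , n , eq , pow) (c , d , m , eq′ , pow′) =
      a ℕ.* suc m ℕ.+ c ℕ.* suc n , b ℕ.* suc m ℕ.+ d ℕ.* suc n , m ℕ.+ n ℕ.* suc m , eq″ , pow″
      where
      N M : ℝ
      N = fromℕ (suc n)
      M = fromℕ (suc m)
      hom : ∀ a c → fromℕ (a ℕ.* suc m ℕ.+ c ℕ.* suc n) ≈ fromℕ a * M + fromℕ c * N
      hom a c = trans (fromℕ-homo-+ (a ℕ.* suc m) _) (+-cong (fromℕ-homo-* a (suc m)) (fromℕ-homo-* c (suc n)))
      eq″ : fromℕ (suc n ℕ.* suc m) * (t + t′) ≈ fromℕ (a ℕ.* suc m ℕ.+ c ℕ.* suc n) - fromℕ (b ℕ.* suc m ℕ.+ d ℕ.* suc n)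
      eq″ = trans (*-congʳ (fromℕ-homo-* (suc n) (suc m)))
        (trans (solve 4 (λ n m t s → n :* m :* (t :+ s) := n :* t :* m :+ m :* s :* n) refl N M t t′)
          (trans (+-cong (*-congʳ eq) (*-congʳ eq′))
            (trans (solve 6 (λ a b c d n m → (a :- b) :* m :+ (c :- d) :* n := a :* m :+ c :* n :- (b :* m :+ d :* n)) refl (fromℕ a) (fromℕ b) (fromℕ c) (fromℕ d) N M)
              (sym (+-cong (hom a c) (-‿cong (hom b d)))))))
      power : ∀ a c → 2^ (a ℕ.* suc m ℕ.+ c ℕ.* suc n) ≈ 2^ a ^ suc m * 2^ c ^ suc n
      power a c = trans (^-homo-* (fromℕ 2) (a ℕ.* suc m) _) (*-cong (sym (^-assocʳ (fromℕ 2) a (suc m))) (sym (^-assocʳ (fromℕ 2) c (suc n))))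
      pow″ : 2^ (a ℕ.* suc m ℕ.+ c ℕ.* suc n) ≤ 2^ (b ℕ.* suc m ℕ.+ d ℕ.* suc n) * (x * y) ^ (suc n ℕ.* suc m)
      pow″ = begin
        2^ (a ℕ.* suc m ℕ.+ c ℕ.* suc n)
          ≈⟨ power a c ⟩
        2^ a ^ suc m * 2^ c ^ suc n
          ≤⟨ *-mono-≤ (^-nonNeg (suc m) (proj₁ (2^-pos a))) (^-mono-≤ (suc m) (proj₁ (2^-pos a)) pow)
                      (^-nonNeg (suc n) (proj₁ (2^-pos c))) (^-mono-≤ (suc n) (proj₁ (2^-pos c)) pow′) ⟩
        (2^ b * x ^ suc n) ^ suc m * (2^ d * y ^ suc m) ^ suc n
          ≈⟨ *-cong (^-distrib-* (2^ b) _ (suc m)) (^-distrib-* (2^ d) _ (suc n)) ⟩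
        2^ b ^ suc m * (x ^ suc n) ^ suc m * (2^ d ^ suc n * (y ^ suc m) ^ suc n)
          ≈⟨ solve 4 (λ b x d y → b :* x :* (d :* y) := b :* d :* (x :* y)) refl (2^ b ^ suc m) ((x ^ suc n) ^ suc m) (2^ d ^ suc n) ((y ^ suc m) ^ suc n) ⟩
        2^ b ^ suc m * 2^ d ^ suc n * ((x ^ suc n) ^ suc m * (y ^ suc m) ^ suc n)
          ≈⟨ *-cong (sym (power b d)) (trans (*-cong (^-assocʳ x (suc n) (suc m))
               (trans (^-assocʳ y (suc m) (suc n)) (reflexive (≡.cong (y ^_) (ℕ.*-comm (suc m) (suc n)))))) (sym (^-distrib-* x y (suc n ℕ.* suc m)))) ⟩
        2^ (b ℕ.* suc m ℕ.+ d ℕ.* suc n) * (x * y) ^ (suc n ℕ.* suc m) ∎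
        where open ≤R

  ExpBelow : ℝ → ℝ → Set
  ExpBelow t x = 0# < x × log₂ x ≤ t

  expBelow-inhabited : ∀ t → ∃ λ n → ExpBelow t (½ ^ n)
  expBelow-inhabited t = let n , -t≤n = archimedean (- t) in
    n , ½^-pos n , ≤-trans (log-upper n 0 (½^-pos n) (≤-reflexive (2^*½^ n)))
      (≤-via (0≤diff -t≤n) (solve 2 (λ t n → t := # 0 :- n :+ (n :- :- t)) refl t (fromℕ n)))

  expBelow-bounded : ∀ t → ∃ (UpperBound (ExpBelow t))
  expBelow-bounded t = let k , le = archimedean (t + 1#) in
    2^ k , λ {x} (0<x , logx≤t) → case-≤ k le 0<x logx≤t (dec (x ≤ 2^ k))
    where
    case-≤ : ∀ k {x} → t + 1# ≤ fromℕ k → 0# < x → log₂ x ≤ t → Dec (x ≤ 2^ k) → x ≤ 2^ k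
    case-≤ k le 0<x logx≤t (yes x≤) = x≤
    case-≤ k {x} le 0<x logx≤t (no x≰) = ⊥-elim (<⇒≱ 0<1 (≤-via (+-nonNeg (0≤diff le) (0≤diff
        (≤-trans (log-lower k 0 0<x (≤-respʳ (sym (*-identityˡ x)) (≰⇒≥ x≰))) logx≤t)))
      (solve 2 (λ t k → # 0 := # 1 :+ (k :- (t :+ # 1) :+ (t :- (k :- # 0)))) refl t (fromℕ k))))

  exp-pos : ∀ t → 0# < exp₂ t
  exp-pos t = let n , b = expBelow-inhabited t in
    <-≤-trans (½^-pos n) (sup-upper (_ , b) (expBelow-bounded t) b)

  ≤exp : ∀ {t x} → ExpBelow t x → x ≤ exp₂ t
  ≤exp {t} b = sup-upper (_ , b) (expBelow-bounded t) b

  -- If the logarithm fell short of t by d > 0, dividing `exp₂ t` by 1 - g for a small g would give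
  -- a larger member of the set whose supremum `exp₂ t` is.
  log-exp : ∀ t → t ≤ log₂ (exp₂ t)
  log-exp t with dec (t ≤ log₂ (exp₂ t))
  ... | yes le = le
  ... | no ≰ = ⊥-elim (<⇒≱ (*-pos 0<x 0<g) xg≤0)
    where
    e d : ℝ
    e = exp₂ t
    d = t - log₂ e
    0<e : 0# < e
    0<e = exp-pos t
    0<d : 0# < d
    0<d = nonNeg≉⇒> (0≤diff (≰⇒≥ ≰)) λ d≈0 → ≰ (≤-reflexive (trans (solve 2 (λ t l → t := t :- l :+ l) refl t (log₂ e)) (trans (+-congʳ d≈0) (+-identityˡ _))))
    m : ℕ
    m = proj₁ (archimedean (d ⁻¹))
    n : ℝ
    n = fromℕ (suc m)
    0<n : 0# < n
    0<n = fromℕ-pos m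
    n⁻¹≤d : n ⁻¹ ≤ d
    n⁻¹≤d = *-cancelˡ-≤ 0<n (≤-respˡ (sym (*-inverseʳ (>⇒≉ 0<n))) (≤-respˡ (x⁻¹*x≈1 (>⇒≉ 0<d))
      (*-monoʳ-≤ d (proj₁ 0<d) (≤-trans (proj₂ (archimedean (d ⁻¹))) (≤-via 0≤1 (+-comm _ _))))))
    g : ℝ
    -- Bernoulli gives (1 - g)^n ≥ 1 - n g = 1/2, so that log₂ (1 - g) ≥ -1/n ≥ -d.
    g = ½ * n ⁻¹
    0<g : 0# < g
    0<g = *-pos 0<½ (⁻¹-pos 0<n)
    n*g : n * g ≈ ½
    n*g = trans (solve 3 (λ n h i → n :* (h :* i) := n :* i :* h) refl n ½ (n ⁻¹)) (trans (*-congʳ (*-inverseʳ (>⇒≉ 0<n))) (*-identityˡ ½))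
    1≤n : 1# ≤ n
    1≤n = ≤-via (fromℕ-nonNeg m) refl
    g≤½ : g ≤ ½
    g≤½ = ≤-respʳ n*g (≤-respˡ (*-identityˡ g) (*-monoʳ-≤ g (proj₁ 0<g) 1≤n))
    0<1-g : 0# < 1# - g
    0<1-g = <-≤-trans 0<½ (≤-via (0≤diff g≤½) (trans (+-congʳ (sym ½+½)) (solve 2 (λ h g → h :+ h :- g := h :+ (h :- g)) refl ½ g)))
    log-1-g : - (n ⁻¹) ≤ log₂ (1# - g)
    log-1-g = log-≥ 0<1-g (0 , 1 , m , trans (sym (-‿distribʳ-* _ _)) (trans (-‿cong (*-inverseʳ (>⇒≉ 0<n))) (solve 0 (:- # 1 := # 0 :- (# 1 :+ # 0)) refl)) ,
      ≤-trans (≤-reflexive (trans (sym 2*½) (trans (solve 2 (λ h i → # 2 :* h := # 2 :* # 1 :* h) refl ½ g) (*-congˡ (trans (solve 1 (λ h → h := h :+ h :- h) refl ½) (+-cong ½+½ (-‿cong (sym n*g))))))))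
        (*-monoˡ-≤ _ (proj₁ (2^-pos 1)) (bernoulli⁻ (suc m) (proj₁ 0<g) (≤-trans g≤½ ½≤1))))
    x : ℝ
    x = e / (1# - g)
    0<x : 0# < x
    0<x = *-pos 0<e (⁻¹-pos 0<1-g)
    x*1-g : x * (1# - g) ≈ e
    x*1-g = /-cancel (>⇒≉ 0<1-g)
    logx≤t : log₂ x ≤ t
    logx≤t = ≤-via (+-nonNeg (+-nonNeg (0≤diff (≤-trans (log-super 0<x 0<1-g) (log-mono (*-pos 0<x 0<1-g) (≤-reflexive x*1-g)))) (0≤diff log-1-g)) (0≤diff n⁻¹≤d))
      (solve 5 (λ t x e g i → t := x :+ (e :- (x :+ g) :+ (g :- :- i) :+ (t :- e :- i))) refl t (log₂ x) (log₂ e) (log₂ (1# - g)) (n ⁻¹))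
    x≤e : x ≤ e
    x≤e = ≤exp (0<x , logx≤t)
    xg≤0 : x * g ≤ 0#
    xg≤0 = ≤-via (0≤diff x≤e) (trans (solve 3 (λ x e g → # 0 := x :* g :+ (e :- x :+ (x :* (# 1 :- g) :- e))) refl x e g) (+-congˡ (+-zero (trans (+-congʳ x*1-g) (-‿inverseʳ e)))))

  log-^ʳ : ∀ {x} t → t * log₂ x ≤ log₂ (x ^ʳ t)
  log-^ʳ t = log-exp _

  -- The spare factor 2 leaves a gap of 1 between the logarithms, so the contradiction needs only
  -- weak monotonicity.
  log≤⇒≤ : ∀ {x y} k → 0# < x → 0# < y → log₂ x ≤ fromℕ k + log₂ y → x ≤ 2^ (suc k) * y
  log≤⇒≤ {x} {y} k 0<x 0<y le with dec (x ≤ 2^ (suc k) * y)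
  ... | yes p = p
  ... | no ≰ = ⊥-elim (<⇒≱ 0<1 (≤-via (+-nonNeg (+-nonNeg (0≤diff le) (0≤diff (log-mono (*-pos (2^-pos (suc k)) 0<y) (≰⇒≥ ≰))))
      (+-nonNeg (0≤diff (log-super (2^-pos (suc k)) 0<y)) (0≤diff (log-lower (suc k) 0 (2^-pos (suc k)) (≤-reflexive (sym (*-identityˡ _)))))))
    (solve 5 (λ x k y p q → # 0 := # 1 :+ (k :+ y :- x :+ (x :- p) :+ (p :- (q :+ y) :+ (q :- (# 1 :+ k :- # 0))))) refl (log₂ x) (fromℕ k) (log₂ y) (log₂ (2^ (suc k) * y)) (log₂ (2^ (suc k))))))

  log-nonPos : ∀ {x} → 0# < x → x ≤ 1# → log₂ x ≤ 0#
  log-nonPos 0<x x≤1 = ≤-trans (log-upper 0 0 0<x (≤-respˡ (sym (*-identityˡ _)) x≤1)) (≤-reflexive (solve 0 (# 0 :- # 0 := # 0) refl))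

  -- `c` stands for q(xy|m)/p(xy), `r` for q(xym)/p(xym), `s` for the absolute bias given m; 180 is
  -- 12/δ.
  module CostBounds {I κ E c r s : ℝ} (1≤I : 1# ≤ I) (0<c : 0# < c) (0<r : 0# < r) (0<s : 0# < s) (s≤1 : s ≤ 1#)
    (E≈ : E ≈ fromℕ 180 * I) (cost : log₂ c + I * log₂ r + - E * log₂ s ≤ κ * I) where

    0<I : 0# < I
    0<I = <-≤-trans 0<1 1≤I

    cost′ : log₂ c + I * log₂ r - fromℕ 180 * I * log₂ s ≤ κ * I
    cost′ = ≤-respˡ (+-congˡ (trans (*-congʳ (-‿cong E≈)) (sym (-‿distribˡ-* _ _)))) cost

    0≤-log-s : 0# ≤ - log₂ s
    0≤-log-s = nonPos-neg (log-nonPos 0<s s≤1)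

    -- By hypothesis log c ≥ log s - 4, so I log r ≤ κ I + 4 + (180 I - 1) log s. As log s ≤ 0 and I
    -- ≥ 1, this is at most (κ + 4) I + I log s.
    ratio≤ : ∀ K → κ + fromℕ 4 ≤ fromℕ K → s ≤ 2^ 4 * c → r ≤ 2^ (suc K) * s
    ratio≤ K κ≤ s≤16c = log≤⇒≤ K 0<r 0<s (*-cancelˡ-≤ 0<I
      (≤-via (+-nonNeg (+-nonNeg (0≤diff cost′) (0≤diff log-c≥)) (+-nonNeg (*-nonNeg (proj₁ 0<I) (0≤diff κ≤)) (+-nonNeg (*-nonNeg (fromℕ-nonNeg 4) (0≤diff 1≤I))
          (*-nonNeg (≤-via (+-nonNeg (*-nonNeg (fromℕ-nonNeg 179) (0≤diff 1≤I)) (fromℕ-nonNeg 178)) (solve 1 (λ i → # 179 :* i :- # 1 := # 0 :+ (# 179 :* (i :- # 1) :+ # 178)) refl I)) 0≤-log-s))))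
        (solve 6 (λ k i c r s n → i :* (n :+ s) := i :* r :+ (k :* i :- (c :+ i :* r :- # 180 :* i :* s) :+ (c :- (s :- # 4)) :+ (i :* (n :- (k :+ # 4)) :+ (# 4 :* (i :- # 1) :+ (# 179 :* i :- # 1) :* :- s)))) refl
          κ I (log₂ c) (log₂ r) (log₂ s) (fromℕ K))))
      where
      log-c≥ : log₂ s - fromℕ 4 ≤ log₂ c
      log-c≥ = ≤-trans (+-monoʳ-≤ (log₂ s) (≤-trans (≤-reflexive (solve 1 (λ n → :- n := # 0 :- n) refl (fromℕ 4))) (log-lower 0 4 (½^-pos 4) (≤-reflexive (sym (2^*½^ 4))))))
        (≤-trans (log-super 0<s (½^-pos 4)) (log-mono (*-pos 0<s (½^-pos 4))
          (*-cancelˡ-≤ (2^-pos 4) (≤-respˡ (sym (trans (solve 3 (λ p s h → p :* (s :* h) := p :* h :* s) refl (2^ 4) s (½ ^ 4)) (trans (*-congʳ (2^*½^ 4)) (*-identityˡ s)))) s≤16c))))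

    -- With log r ≥ -k and log s ≤ 0 the cost bound leaves log c ≤ (κ + k) I.
    conditional≤ : ∀ k m → (κ + fromℕ k) * I ≤ fromℕ m → ½ ^ k ≤ r → c ≤ 2^ (suc m)
    conditional≤ k m m≥ ½^k≤r = ≤-respʳ (*-identityʳ _) (log≤⇒≤ m 0<c 0<1
      (≤-trans (≤-via (+-nonNeg (+-nonNeg (0≤diff cost′) (0≤diff m≥)) (+-nonNeg (*-nonNeg (proj₁ 0<I) (0≤diff log-r≥)) (*-nonNeg (*-nonNeg (fromℕ-nonNeg 180) (proj₁ 0<I)) 0≤-log-s)))
          (solve 7 (λ k i c r s n m → m := c :+ (k :* i :- (c :+ i :* r :- # 180 :* i :* s) :+ (m :- (k :+ n) :* i) :+ (i :* (r :- (# 0 :- n)) :+ # 180 :* i :* :- s))) refl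
            κ I (log₂ c) (log₂ r) (log₂ s) (fromℕ k) (fromℕ m)))
        (≤-via (0≤diff log-1≥) (solve 2 (λ m l → m :+ l := m :+ (l :- # 0)) refl (fromℕ m) (log₂ 1#)))))
      where
      log-r≥ : 0# - fromℕ k ≤ log₂ r
      log-r≥ = log-lower 0 k 0<r (≤-respˡ (2^*½^ k) (*-monoˡ-≤ _ (proj₁ (2^-pos k)) ½^k≤r))
      log-1≥ : 0# ≤ log₂ 1#
      log-1≥ = ≤-trans (≤-reflexive (solve 0 (# 0 := # 0 :- # 0) refl)) (log-lower 0 0 0<1 (≤-reflexive (sym (*-identityˡ _))))

  -- Marginals of protocol distributions

  ∑ᵀ : ∀ {n} (ks : Vec ℕ n) → (Transcript ks → ℝ) → ℝ
  ∑ᵀ [] g = g []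
  ∑ᵀ (k ∷ ks) g = ∑ λ i → ∑ᵀ ks λ m → g (i ∷ m)

  sumTranscript≈∑ᵀ : ∀ {n} (ks : Vec ℕ n) g → sumTranscript ks g ≈ ∑ᵀ ks g
  sumTranscript≈∑ᵀ [] g = refl
  sumTranscript≈∑ᵀ (k ∷ ks) g = trans (sum≈∑ _) (∑-cong λ i → sumTranscript≈∑ᵀ ks λ m → g (i ∷ m))

  ∑ᵀ-cong : ∀ {n} (ks : Vec ℕ n) {f g} → (∀ m → f m ≈ g m) → ∑ᵀ ks f ≈ ∑ᵀ ks g
  ∑ᵀ-cong [] f≈g = f≈g []
  ∑ᵀ-cong (k ∷ ks) f≈g = ∑-cong λ i → ∑ᵀ-cong ks λ m → f≈g (i ∷ m)

  ∑ᵀ-mono : ∀ {n} (ks : Vec ℕ n) {f g} → (∀ m → f m ≤ g m) → ∑ᵀ ks f ≤ ∑ᵀ ks g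
  ∑ᵀ-mono [] f≤g = f≤g []
  ∑ᵀ-mono (k ∷ ks) f≤g = ∑-mono λ i → ∑ᵀ-mono ks λ m → f≤g (i ∷ m)

  ∑ᵀ-zero : ∀ {n} (ks : Vec ℕ n) {f} → (∀ m → f m ≈ 0#) → ∑ᵀ ks f ≈ 0#
  ∑ᵀ-zero [] f≈0 = f≈0 []
  ∑ᵀ-zero (k ∷ ks) f≈0 = ∑-zero λ i → ∑ᵀ-zero ks λ m → f≈0 (i ∷ m)

  ∑ᵀ-nonNeg : ∀ {n} (ks : Vec ℕ n) {f} → (∀ m → 0# ≤ f m) → 0# ≤ ∑ᵀ ks f
  ∑ᵀ-nonNeg [] 0≤f = 0≤f []
  ∑ᵀ-nonNeg (k ∷ ks) 0≤f = ∑-nonNeg λ i → ∑ᵀ-nonNeg ks λ m → 0≤f (i ∷ m)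

  ∑ᵀ-zero⇒ : ∀ {n} (ks : Vec ℕ n) {f} → (∀ m → 0# ≤ f m) → ∑ᵀ ks f ≈ 0# → ∀ m → f m ≈ 0#
  ∑ᵀ-zero⇒ [] 0≤f Σ≈0 [] = Σ≈0
  ∑ᵀ-zero⇒ (k ∷ ks) 0≤f Σ≈0 (i ∷ m) = ∑ᵀ-zero⇒ ks (λ m → 0≤f (i ∷ m)) (∑-zero⇒ (λ i → ∑ᵀ-nonNeg ks λ m → 0≤f (i ∷ m)) Σ≈0 i) m

  ∑ᵀ-+ : ∀ {n} (ks : Vec ℕ n) f g → ∑ᵀ ks (λ m → f m + g m) ≈ ∑ᵀ ks f + ∑ᵀ ks g
  ∑ᵀ-+ [] f g = refl
  ∑ᵀ-+ (k ∷ ks) f g = trans (∑-cong λ i → ∑ᵀ-+ ks (λ m → f (i ∷ m)) (λ m → g (i ∷ m))) (∑-+ _ _)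

  *-∑ᵀ : ∀ {n} (ks : Vec ℕ n) c f → c * ∑ᵀ ks f ≈ ∑ᵀ ks λ m → c * f m
  *-∑ᵀ [] c f = refl
  *-∑ᵀ (k ∷ ks) c f = trans (*-∑ˡ c _) (∑-cong λ i → *-∑ᵀ ks c λ m → f (i ∷ m))

  ∑-∑ᵀ : ∀ {n l} (ks : Vec ℕ n) (f : Fin l → Transcript ks → ℝ) → (∑ λ i → ∑ᵀ ks (f i)) ≈ ∑ᵀ ks λ m → ∑ λ i → f i m
  ∑-∑ᵀ [] f = refl
  ∑-∑ᵀ (k ∷ ks) f = trans (∑-comm λ i j → ∑ᵀ ks λ m → f i (j ∷ m)) (∑-cong λ j → ∑-∑ᵀ ks λ i m → f i (j ∷ m))

  -- Indicators and prefixes of transcripts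

  indicator-cong : ∀ {P Q : Set} (P? : Dec P) (Q? : Dec Q) → (P → Q) → (Q → P) → indicator P? ≈ indicator Q?
  indicator-cong (yes _) (yes _) _ _ = refl
  indicator-cong (no _) (no _) _ _ = refl
  indicator-cong (yes p) (no ¬q) f _ = ⊥-elim (¬q (f p))
  indicator-cong (no ¬p) (yes q) _ g = ⊥-elim (¬p (g q))

  indicator-true : ∀ {P : Set} (P? : Dec P) → P → indicator P? ≈ 1#
  indicator-true (yes _) _ = refl
  indicator-true (no ¬p) p = ⊥-elim (¬p p)

  indicator-× : ∀ {P Q : Set} (P? : Dec P) (Q? : Dec Q) → indicator (P? ×-dec Q?) ≈ indicator P? * indicator Q?
  indicator-× (yes _) (yes _) = sym (*-identityˡ 1#)
  indicator-× (yes _) (no _) = sym (*-identityˡ 0#)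
  indicator-× (no _) _ = sym (zeroˡ _)

  if-indicator : ∀ {P : Set} (P? : Dec P) a → (if does P? then a else 0#) ≈ indicator P? * a
  if-indicator (yes _) a = sym (*-identityˡ a)
  if-indicator (no _) a = sym (zeroˡ a)

  opaque
    unfolding ∑

    ∑-indicator : ∀ {n} (i : Fin n) (f : Fin n → ℝ) → (∑ λ j → indicator (i Fin.≟ j) * f j) ≈ f i
    ∑-indicator zero f = trans (+-cong (*-identityˡ _) (∑-zero {f = λ j → indicator (zero Fin.≟ suc j) * f (suc j)} λ j → zeroˡ _)) (+-identityʳ _)
    ∑-indicator (suc i) f = trans (+-cong (zeroˡ _) (trans (∑-cong {f = λ j → indicator (suc i Fin.≟ suc j) * f (suc j)} {λ j → indicator (i Fin.≟ j) * f (suc j)}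
      λ j → *-congʳ (indicator-cong (suc i Fin.≟ suc j) (i Fin.≟ j) Fin.suc-injective (≡.cong suc))) (∑-indicator i (f ∘ suc)))) (+-identityˡ _)

  cylinder : ∀ {n} {ks : Vec ℕ n} → ℕ → Transcript ks → (Transcript ks → ℝ) → ℝ
  cylinder {ks = ks} i m g = ∑ᵀ ks λ m′ → indicator (agreeBelow? i m m′) * g m′

  cylinder-0 : ∀ {n} {ks : Vec ℕ n} (m : Transcript ks) g → cylinder 0 m g ≈ ∑ᵀ ks g
  cylinder-0 {ks = ks} m g = ∑ᵀ-cong ks λ m′ → trans (*-congʳ (indicator-true (agreeBelow? 0 m m′) λ _ ())) (*-identityˡ _)

  agree-suc : ∀ {n k} {ks : Vec ℕ n} i (a a′ : Fin k) (m m′ : Transcript ks) →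
    indicator (agreeBelow? {ks = k ∷ ks} (suc i) (a ∷ m) (a′ ∷ m′)) ≈ indicator (a Fin.≟ a′) * indicator (agreeBelow? i m m′)
  agree-suc i a a′ m m′ = trans (indicator-cong (agreeBelow? (suc i) (a ∷ m) (a′ ∷ m′)) ((a Fin.≟ a′) ×-dec agreeBelow? i m m′)
      (λ agree → agree zero (s≤s z≤n) , λ j j<i → agree (suc j) (s≤s j<i))
      (λ { (a≡a′ , agree) zero _ → a≡a′ ; (a≡a′ , agree) (suc j) (s≤s j<i) → agree j j<i }))
    (indicator-× (a Fin.≟ a′) (agreeBelow? i m m′))

  cylinder-suc : ∀ {n k} {ks : Vec ℕ n} i (a : Fin k) (m : Transcript ks) g →
    cylinder {ks = k ∷ ks} (suc i) (a ∷ m) g ≈ cylinder i m (λ m′ → g (a ∷ m′))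
  cylinder-suc {ks = ks} i a m g = trans
    (∑-cong λ a′ → trans (∑ᵀ-cong ks λ m′ → trans (*-congʳ (agree-suc i a a′ m m′)) (*-assoc _ _ _)) (sym (*-∑ᵀ ks (indicator (a Fin.≟ a′)) λ m′ → indicator (agreeBelow? i m m′) * g (a′ ∷ m′))))
    (∑-indicator a λ a′ → ∑ᵀ ks λ m′ → indicator (agreeBelow? i m m′) * g (a′ ∷ m′))

  cylinder-if : ∀ {A : Set} (A? : Dec A) {n} {ks : Vec ℕ n} i (m : Transcript ks) (g : Transcript ks → ℝ) →
    (∑ᵀ ks λ m′ → if does (A? ×-dec agreeBelow? i m m′) then g m′ else 0#) ≈ indicator A? * cylinder i m g
  cylinder-if A? {ks = ks} i m g = trans
    (∑ᵀ-cong ks λ m′ → trans (if-indicator (A? ×-dec agreeBelow? i m m′) (g m′))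
      (trans (*-congʳ (indicator-× A? (agreeBelow? i m m′))) (*-assoc _ _ _)))
    (sym (*-∑ᵀ ks (indicator A?) λ m′ → indicator (agreeBelow? i m m′) * g m′))

  other : Side → Side
  other aliceSide = bobSide
  other bobSide = aliceSide

  alternate : Side → ℕ → Side
  alternate s zero = s
  alternate s (suc i) = alternate (other s) i

  speaker : Parity → Side
  speaker 1ℙ = aliceSide
  speaker 0ℙ = bobSide

  speaker-alternate : ∀ i → speaker (ℕ.parity (suc i)) ≡ alternate aliceSide i
  speaker-alternate 0 = ≡.refl
  speaker-alternate 1 = ≡.refl
  speaker-alternate (suc (suc i)) = speaker-alternate i

  module Marginals (nx ny : ℕ) where

    open Splitting nx ny public

    whole : Matrix → ℝ
    whole w = ∑ λ x → ∑ λ y → w x y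

    given : (s : Side) → Matrix → Private s → ℝ
    given aliceSide w x = ∑ λ y → w x y
    given bobSide w y = ∑ λ x → w x y

    given-cong : ∀ s {w w′} → (∀ x y → w x y ≈ w′ x y) → ∀ z → given s w z ≈ given s w′ z
    given-cong aliceSide w≈ x = ∑-cong λ y → w≈ x y
    given-cong bobSide w≈ y = ∑-cong λ x → w≈ x y

    given-nonNeg : ∀ s {w} → (∀ x y → 0# ≤ w x y) → ∀ z → 0# ≤ given s w z
    given-nonNeg aliceSide 0≤w x = ∑-nonNeg λ y → 0≤w x y
    given-nonNeg bobSide 0≤w y = ∑-nonNeg λ x → 0≤w x y

    given-∑ : ∀ s {k} (w : Fin k → Matrix) z → given s (λ x y → ∑ λ i → w i x y) z ≈ ∑ λ i → given s (w i) z
    given-∑ aliceSide w x = ∑-comm λ y i → w i x y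
    given-∑ bobSide w y = ∑-comm λ x i → w i x y

    given-zero : ∀ s {w} → (∀ x y → 0# ≤ w x y) → whole w ≈ 0# → ∀ z → given s w z ≈ 0#
    given-zero s {w} 0≤w whole≈0 z = given-zero′ s z
      where
      zero-entry : ∀ x y → w x y ≈ 0#
      zero-entry x y = ∑-zero⇒ (λ y → 0≤w x y) (∑-zero⇒ (λ x → ∑-nonNeg λ y → 0≤w x y) whole≈0 x) y
      given-zero′ : ∀ s z → given s w z ≈ 0#
      given-zero′ aliceSide x = ∑-zero λ y → zero-entry x y
      given-zero′ bobSide y = ∑-zero λ x → zero-entry x y

    whole-nonNeg : ∀ {w} → (∀ x y → 0# ≤ w x y) → 0# ≤ whole w
    whole-nonNeg 0≤w = ∑-nonNeg λ x → ∑-nonNeg λ y → 0≤w x y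

    whole-∑ : ∀ {k} (w : Fin k → Matrix) → whole (λ x y → ∑ λ i → w i x y) ≈ ∑ λ i → whole (w i)
    whole-∑ w = trans (∑-cong λ x → ∑-comm λ y i → w i x y) (∑-comm λ x i → ∑ λ y → w i x y)

    Weights : ∀ {n} → Vec ℕ n → Set
    Weights ks = X → Y → Transcript ks → ℝ

    fix : ∀ {n k} {ks : Vec ℕ n} → Fin k → Weights (k ∷ ks) → Weights ks
    fix i P x y m = P x y (i ∷ m)

    mass : ∀ {n} {ks : Vec ℕ n} → Weights ks → Matrix
    mass {ks = ks} P x y = ∑ᵀ ks (P x y)

    -- s is the player sending the first message.
    factors : ∀ {n} (ks : Vec ℕ n) → Side → Weights ks → X → Y → Transcript ks → ℝ
    factors [] s P x y [] = 1#
    factors (k ∷ ks) s P x y (i ∷ m) =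
      given s (mass (fix i P)) (own s x y) / given s (mass P) (own s x y) * factors ks (other s) (fix i P) x y m

    ownFactors : ∀ {n} (ks : Vec ℕ n) (r : Side) → Side → Weights ks → Private r → Transcript ks → ℝ
    ownFactors [] r s P z [] = 1#
    ownFactors (k ∷ ks) aliceSide aliceSide P z (i ∷ m) =
      given aliceSide (mass (fix i P)) z / given aliceSide (mass P) z * ownFactors ks aliceSide bobSide (fix i P) z m
    ownFactors (k ∷ ks) bobSide bobSide P z (i ∷ m) =
      given bobSide (mass (fix i P)) z / given bobSide (mass P) z * ownFactors ks bobSide aliceSide (fix i P) z m
    ownFactors (k ∷ ks) aliceSide bobSide P z (i ∷ m) = ownFactors ks aliceSide aliceSide (fix i P) z m
    ownFactors (k ∷ ks) bobSide aliceSide P z (i ∷ m) = ownFactors ks bobSide bobSide (fix i P) z m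

    -- The rectangle property of protocols: a message depends on the input of its sender only.
    factors-split : ∀ {n} (ks : Vec ℕ n) s P x y m → factors ks s P x y m ≈ ownFactors ks aliceSide s P x m * ownFactors ks bobSide s P y m
    factors-split [] s P x y [] = sym (*-identityˡ 1#)
    factors-split (k ∷ ks) aliceSide P x y (i ∷ m) = trans (*-congˡ (factors-split ks bobSide (fix i P) x y m)) (sym (*-assoc _ _ _))
    factors-split (k ∷ ks) bobSide P x y (i ∷ m) = trans (*-congˡ (factors-split ks aliceSide (fix i P) x y m)) (solve 3 (λ f a b → f :* (a :* b) := a :* (f :* b)) refl _ _ _)

    conditional : ∀ {n} {ks : Vec ℕ n} → Side → ℕ → Weights ks → X → Y → Transcript ks → ℝ
    conditional s i P x y m = given s (λ x y → cylinder (suc i) m (P x y)) (own s x y) / given s (λ x y → cylinder i m (P x y)) (own s x y)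

    conditional-suc : ∀ {n k} {ks : Vec ℕ n} s i (P : Weights (k ∷ ks)) x y a m →
      conditional s (suc i) P x y (a ∷ m) ≈ conditional s i (fix a P) x y m
    conditional-suc s i P x y a m = /-cong (given-cong s (λ x y → cylinder-suc (suc i) a m (P x y)) _) (given-cong s (λ x y → cylinder-suc i a m (P x y)) _)

    conditional-0 : ∀ {n k} {ks : Vec ℕ n} s (P : Weights (k ∷ ks)) x y a m →
      conditional s 0 P x y (a ∷ m) ≈ given s (mass (fix a P)) (own s x y) / given s (mass P) (own s x y)
    conditional-0 s P x y a m = /-cong (given-cong s (λ x y → trans (cylinder-suc 0 a m (P x y)) (cylinder-0 m _)) _) (given-cong s (λ x y → cylinder-0 (a ∷ m) (P x y)) _)

    product-cong : ∀ n {f g : Fin n → ℝ} → (∀ i → f i ≈ g i) → product f ≈ product g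
    product-cong zero f≈g = refl
    product-cong (suc n) f≈g = *-cong (f≈g zero) (product-cong n (f≈g ∘ suc))

    product-conditional : ∀ {n} (ks : Vec ℕ n) s P x y m → product {n} (λ j → conditional (alternate s (toℕ j)) (toℕ j) P x y m) ≈ factors ks s P x y m
    product-conditional [] s P x y [] = refl
    product-conditional {suc n} (k ∷ ks) s P x y (a ∷ m) = *-cong (conditional-0 s P x y a m)
      (trans (product-cong n λ j → conditional-suc (alternate (other s) (toℕ j)) (toℕ j) P x y a m) (product-conditional ks (other s) (fix a P) x y m))

  module ProtocolFactors (nx ny : ℕ) {C : ℕ} (k₀ : ℕ) (ks : Vec ℕ C) (p : Joint.Ω nx ny (k₀ ∷ ks) → ℝ) where

    open Marginals nx ny public
    module J = Joint nx ny (k₀ ∷ ks)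

    P : Weights (k₀ ∷ ks)
    P x y m = p (x , y , m)

    μ : Matrix
    μ = mass P

    sumΩ≈ : ∀ g → J.sumΩ g ≈ ∑ λ x → ∑ λ y → ∑ᵀ (k₀ ∷ ks) λ m → g (x , y , m)
    sumΩ≈ g = trans (sum≈∑ _) (∑-cong λ x → trans (sum≈∑ _) (∑-cong λ y → sumTranscript≈∑ᵀ (k₀ ∷ ks) λ m → g (x , y , m)))

    Prxy≈μ : ∀ x y → J.Prxy p x y ≈ μ x y
    Prxy≈μ x y = trans (sumΩ≈ λ (x′ , y′ , m) → if does ((x Fin.≟ x′) ×-dec (y Fin.≟ y′)) then p (x′ , y′ , m) else 0#) (trans
      (∑∑-cong λ x′ y′ → trans (∑ᵀ-cong (k₀ ∷ ks) λ m → trans (if-indicator ((x Fin.≟ x′) ×-dec (y Fin.≟ y′)) (P x′ y′ m)) (*-congʳ (indicator-× (x Fin.≟ x′) (y Fin.≟ y′))))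
        (trans (sym (*-∑ᵀ (k₀ ∷ ks) (indicator (x Fin.≟ x′) * indicator (y Fin.≟ y′)) (P x′ y′))) (*-assoc _ _ _)))
      (trans (∑-cong λ x′ → trans (sym (*-∑ˡ (indicator (x Fin.≟ x′)) λ y′ → indicator (y Fin.≟ y′) * μ x′ y′)) (*-congˡ (∑-indicator y λ y′ → μ x′ y′))) (∑-indicator x λ x′ → μ x′ y)))

    Prm<1≈ : ∀ i m → J.Prm< p 1 (i ∷ m) ≈ whole (mass (fix i P))
    Prm<1≈ i m = trans (sumΩ≈ λ (x , y , m′) → if does (agreeBelow? 1 (i ∷ m) m′) then p (x , y , m′) else 0#) (∑∑-cong λ x y →
      trans (∑ᵀ-cong (k₀ ∷ ks) λ m′ → if-indicator (agreeBelow? 1 (i ∷ m) m′) (P x y m′))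
        (trans (cylinder-suc 0 i m (P x y)) (cylinder-0 m _)))

    Prxm<≈ : ∀ i x m → J.Prxm< p i x m ≈ given aliceSide (λ x y → cylinder i m (P x y)) x
    Prxm<≈ i x m = trans (sumΩ≈ λ (x′ , y , m′) → if does ((x Fin.≟ x′) ×-dec agreeBelow? i m m′) then p (x′ , y , m′) else 0#) (trans
      (∑-cong λ x′ → trans (∑-cong λ y → cylinder-if (x Fin.≟ x′) i m (P x′ y)) (sym (*-∑ˡ (indicator (x Fin.≟ x′)) λ y → cylinder i m (P x′ y))))
      (∑-indicator x λ x′ → ∑ λ y → cylinder i m (P x′ y)))

    Prym<≈ : ∀ i y m → J.Prym< p i y m ≈ given bobSide (λ x y → cylinder i m (P x y)) y
    Prym<≈ i y m = trans (sumΩ≈ λ (x , y′ , m′) → if does ((y Fin.≟ y′) ×-dec agreeBelow? i m m′) then p (x , y′ , m′) else 0#)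
      (∑-cong λ x → trans (∑-cong λ y′ → cylinder-if (y Fin.≟ y′) i m (P x y′)) (∑-indicator y λ y′ → cylinder i m (P x y′)))

    messageFactor≈ : ∀ x y m i → J.messageFactor p (x , y , m) i ≈ conditional (speaker (ℕ.parity i)) i P x y m
    messageFactor≈ x y m i with ℕ.parity i
    ... | 1ℙ = /-cong (Prxm<≈ (suc i) x m) (Prxm<≈ i x m)
    ... | 0ℙ = /-cong (Prym<≈ (suc i) y m) (Prym<≈ i y m)

    factorization : J.IsProtocolDistribution p → ∀ x y i m →
      P x y (i ∷ m) ≈ μ x y * whole (mass (fix i P)) * factors ks aliceSide (fix i P) x y m
    factorization isP x y i m = trans (J.IsProtocolDistribution.factors isP x y (i ∷ m))
      (*-cong (*-cong (Prxy≈μ x y) (Prm<1≈ i m))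
        (trans (product-cong C λ j → trans (messageFactor≈ x y (i ∷ m) (suc (toℕ j)))
            (trans (reflexive (≡.cong (λ s → conditional s (suc (toℕ j)) P x y (i ∷ m)) (speaker-alternate (toℕ j))))
              (conditional-suc (alternate aliceSide (toℕ j)) (toℕ j) P x y i m)))
          (product-conditional ks aliceSide (fix i P) x y m)))

  -- The prior tree of a protocol

  -- The value ½ for t = 0 is junk.
  share : ℝ → ℝ → ℝ
  share t a with dec (t ≈ 0#)
  ... | yes _ = ½
  ... | no _ = a / t

  share-nonNeg : ∀ {t a} → 0# ≤ t → 0# ≤ a → 0# ≤ share t a
  share-nonNeg {t} 0≤t 0≤a with dec (t ≈ 0#)
  ... | yes _ = 0≤½
  ... | no _ = /-nonNeg 0≤a 0≤t

  share-sum : ∀ {t a₀ a₁} → a₀ + a₁ ≈ t → share t a₀ + share t a₁ ≈ 1#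
  share-sum {t} a₀+a₁≈t with dec (t ≈ 0#)
  ... | yes _ = ½+½
  ... | no t≉0 = trans (sym (distribʳ _ _ _)) (trans (*-congʳ a₀+a₁≈t) (*-inverseʳ t≉0))

  share-* : ∀ {t a} → (t ≈ 0# → a ≈ 0#) → share t a * t ≈ a
  share-* {t} zero⇒ with dec (t ≈ 0#)
  ... | yes t≈0 = trans (*-congˡ t≈0) (trans (zeroʳ _) (sym (zero⇒ t≈0)))
  ... | no t≉0 = /-cancel t≉0

  module ProtocolTree (nx ny : ℕ) (k : ℕ) where

    open Marginals nx ny public

    NonNeg : ∀ {n} {ks : Vec ℕ n} → Weights ks → Set
    NonNeg P = ∀ x y m → 0# ≤ P x y m

    mass-nonNeg : ∀ {n} {ks : Vec ℕ n} {P : Weights ks} → NonNeg P → ∀ x y → 0# ≤ mass P x y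
    mass-nonNeg {ks = ks} 0≤P x y = ∑ᵀ-nonNeg ks (0≤P x y)

    whole-fix : ∀ {n l} {ks : Vec ℕ n} (P : Weights (l ∷ ks)) → whole (mass P) ≈ ∑ λ i → whole (mass (fix i P))
    whole-fix P = whole-∑ λ i → mass (fix i P)

    given-fix : ∀ {n l} {ks : Vec ℕ n} s (P : Weights (l ∷ ks)) z → given s (mass P) z ≈ ∑ λ i → given s (mass (fix i P)) z
    given-fix s P z = given-∑ s (λ i → mass (fix i P)) z

    whole-part : ∀ {n l} {ks : Vec ℕ n} (P : Weights (l ∷ ks)) → NonNeg P → ∀ i → whole (mass P) ≈ 0# → whole (mass (fix i P)) ≈ 0#
    whole-part P 0≤P i whole≈0 = ∑-zero⇒ (λ i → whole-nonNeg (mass-nonNeg λ x y m → 0≤P x y (i ∷ m))) (trans (sym (whole-fix P)) whole≈0) i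

    prior : ∀ {n} (ks : Vec ℕ n) → Weights ks → Transcript ks → ℝ
    prior [] P [] = 1#
    prior (l ∷ ks) P (i ∷ m) = share (whole (mass P)) (whole (mass (fix i P))) * prior ks (fix i P) m

    prior-nonNeg : ∀ {n} (ks : Vec ℕ n) P → NonNeg P → ∀ m → 0# ≤ prior ks P m
    prior-nonNeg [] P 0≤P [] = 0≤1
    prior-nonNeg (l ∷ ks) P 0≤P (i ∷ m) = *-nonNeg (share-nonNeg (whole-nonNeg (mass-nonNeg 0≤P)) (whole-nonNeg (mass-nonNeg λ x y m → 0≤P x y (i ∷ m))))
      (prior-nonNeg ks (fix i P) (λ x y m → 0≤P x y (i ∷ m)) m)

    prior-mass : ∀ {n} (ks : Vec ℕ n) P → NonNeg P → ∀ m → prior ks P m * whole (mass P) ≈ whole λ x y → P x y m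
    prior-mass [] P 0≤P [] = *-identityˡ _
    prior-mass (l ∷ ks) P 0≤P (i ∷ m) = trans (solve 3 (λ s p w → s :* p :* w := p :* (s :* w)) refl _ _ _)
      (trans (*-congˡ (share-* (whole-part P 0≤P i))) (prior-mass ks (fix i P) (λ x y m → 0≤P x y (i ∷ m)) m))

    factors-nonNeg : ∀ {n} (ks : Vec ℕ n) s P → NonNeg P → ∀ x y m → 0# ≤ factors ks s P x y m
    factors-nonNeg [] s P 0≤P x y [] = 0≤1
    factors-nonNeg (l ∷ ks) s P 0≤P x y (i ∷ m) = *-nonNeg
      (/-nonNeg (given-nonNeg s (mass-nonNeg λ x y m → 0≤P x y (i ∷ m)) _) (given-nonNeg s (mass-nonNeg 0≤P) _))
      (factors-nonNeg ks (other s) (fix i P) (λ x y m → 0≤P x y (i ∷ m)) x y m)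

    -- Small enough that smoothing n ≤ 2^k bits keeps a fraction (1 - η)^n ≥ 1 - n η ≥ 1/2 of the
    -- prior of a path.
    η : ℝ
    η = ½ ^ suc k

    0≤η : 0# ≤ η
    0≤η = proj₁ (½^-pos (suc k))

    η≤1 : η ≤ 1#
    η≤1 = ½^≤1 (suc k)

    -- Mixing with a fair coin keeps every prior probability above ½^(k+2).
    smooth : ℝ → ℝ
    smooth v = (1# - η) * v + η * ½

    smooth-≥η : ∀ {v} → 0# ≤ v → η * ½ ≤ smooth v
    smooth-≥η 0≤v = ≤-via (*-nonNeg (0≤diff η≤1) 0≤v) (+-comm _ _)

    smooth-≥ : ∀ v → (1# - η) * v ≤ smooth v
    smooth-≥ v = ≤-via (*-nonNeg 0≤η 0≤½) refl

    smooth-nonNeg : ∀ {v} → 0# ≤ v → 0# ≤ smooth v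
    smooth-nonNeg 0≤v = ≤-trans (*-nonNeg 0≤η 0≤½) (smooth-≥η 0≤v)

    smooth-pos : ∀ {v} → 0# ≤ v → 0# < smooth v
    smooth-pos 0≤v = <-≤-trans (*-pos (½^-pos (suc k)) 0<½) (smooth-≥η 0≤v)

    smooth-large : ∀ {v} → 0# ≤ v → 1# ≤ 2^ k * (fromℕ 4 * smooth v)
    smooth-large {v} 0≤v = ≤-respˡ
      (trans (solve 3 (λ p h q → p :* (# 4 :* (h :* q :* h)) := p :* q :* (# 2 :* h :* (# 2 :* h))) refl (2^ k) ½ (½ ^ k)) (trans (*-cong (2^*½^ k) (*-cong 2*½ 2*½)) (solve 0 (# 1 :* (# 1 :* # 1) := # 1) refl)))
      (*-monoˡ-≤ _ (proj₁ (2^-pos k)) (*-monoˡ-≤ _ (fromℕ-nonNeg 4) (smooth-≥η 0≤v)))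

    smooth-sum : ∀ {v₀ v₁} → v₀ + v₁ ≈ 1# → smooth v₀ + smooth v₁ ≈ 1#
    smooth-sum {v₀} {v₁} Σv = trans (sym (+-zero (diff≈0 (- (1# - η)) Σv)))
      (trans (solve 4 (λ e v u h → (# 1 :- e) :* v :+ e :* h :+ ((# 1 :- e) :* u :+ e :* h) :+ :- (# 1 :- e) :* (v :+ u :- # 1) := # 1 :- e :+ e :* (# 2 :* h)) refl η v₀ v₁ ½)
        (trans (+-congˡ (*-congˡ 2*½)) (solve 1 (λ e → # 1 :- e :+ e :* # 1 := # 1) refl η)))

    module _ {n} {ks : Vec ℕ n} (s : Side) (P : Weights (2 ∷ ks)) (0≤P : NonNeg P) where

      fix-nonNeg : ∀ i → NonNeg (fix i P)
      fix-nonNeg i x y m = 0≤P x y (i ∷ m)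

      bitPrior : Bit → ℝ
      bitPrior i = share (whole (mass P)) (whole (mass (fix i P)))

      bitLikelihood : Bit → Private s → ℝ
      bitLikelihood i z = share (given s (mass P) z) (given s (mass (fix i P)) z)

      0≤bitPrior : ∀ i → 0# ≤ bitPrior i
      0≤bitPrior i = share-nonNeg (whole-nonNeg (mass-nonNeg 0≤P)) (whole-nonNeg (mass-nonNeg (fix-nonNeg i)))

      0≤bitLikelihood : ∀ i z → 0# ≤ bitLikelihood i z
      0≤bitLikelihood i z = share-nonNeg (given-nonNeg s (mass-nonNeg 0≤P) z) (given-nonNeg s (mass-nonNeg (fix-nonNeg i)) z)

      bitLaw : BitLaw (Private s)
      bitLaw = record
        { v₀ = smooth (bitPrior zero) ; v₁ = smooth (bitPrior (suc zero)) ; u₀ = bitLikelihood zero ; u₁ = bitLikelihood (suc zero)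
        ; 0≤v₀ = smooth-nonNeg (0≤bitPrior zero) ; 0≤v₁ = smooth-nonNeg (0≤bitPrior (suc zero))
        ; 0≤u₀ = 0≤bitLikelihood zero ; 0≤u₁ = 0≤bitLikelihood (suc zero)
        ; Σv = smooth-sum (share-sum (sym (trans (whole-fix P) (∑₂ _))))
        ; Σu = λ z → share-sum (sym (trans (given-fix s P z) (∑₂ _))) }

    Bits : ∀ {n} → Vec ℕ n → Set
    Bits = VecAll (_≡ 2)

    build : ∀ {n} (ks : Vec ℕ n) → Bits ks → Side → (P : Weights ks) → NonNeg P → (Transcript ks → Matrix) → PTree
    build [] _ s P 0≤P g = leaf (g [])
    build (_ ∷ ks) (≡.refl VecAll.∷ bs) s P 0≤P g = split k s (bitLaw s P 0≤P) (smooth-large (0≤bitPrior s P 0≤P zero)) (smooth-large (0≤bitPrior s P 0≤P (suc zero)))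
      (build ks bs (other s) (fix zero P) (fix-nonNeg s P 0≤P zero) λ m → g (zero ∷ m))
      (build ks bs (other s) (fix (suc zero) P) (fix-nonNeg s P 0≤P (suc zero)) λ m → g (suc zero ∷ m))

    -- Where a private marginal vanishes, `share` takes the value 1/2 but `factors` the value 0. The
    -- two may be exchanged only against payoffs that vanish there.
    Supported : ∀ {n} {ks : Vec ℕ n} → Side → Weights ks → X → Y → (Transcript ks → Matrix) → Set
    Supported {ks = ks} s P x y g = ∀ m → factors ks s P x y m ≈ 0# → g m x y ≈ 0#

    module _ {n} {ks : Vec ℕ n} (s : Side) (P : Weights (2 ∷ ks)) (0≤P : NonNeg P) (x : X) (y : Y) (i : Bit)
      (g : Transcript (2 ∷ ks) → Matrix) (supp : Supported s P x y g) where

      supported-fix : Supported (other s) (fix i P) x y (λ m → g (i ∷ m))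
      supported-fix m f≈0 = supp (i ∷ m) (trans (*-congˡ f≈0) (zeroʳ _))

      likelihood-factor : ∀ m → bitLikelihood s P 0≤P i (own s x y) * factors ks (other s) (fix i P) x y m * g (i ∷ m) x y ≈ factors (2 ∷ ks) s P x y (i ∷ m) * g (i ∷ m) x y
      likelihood-factor m with dec (given s (mass P) (own s x y) ≈ 0#)
      ... | no _ = refl
      ... | yes given≈0 = trans (*-congˡ g≈0) (trans (zeroʳ _) (sym (trans (*-congˡ g≈0) (zeroʳ _))))
        where
        g≈0 : g (i ∷ m) x y ≈ 0#
        g≈0 = supp (i ∷ m) (trans (*-congʳ (trans (*-congˡ (⁻¹-zero given≈0)) (zeroʳ _))) (zeroˡ _))

    expectation-build : ∀ {n} (ks : Vec ℕ n) bs s P 0≤P g x y → Supported s P x y g →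
      expectation (build ks bs s P 0≤P g) x y ≈ ∑ᵀ ks λ m → factors ks s P x y m * g m x y
    expectation-build [] bs s P 0≤P g x y supp = sym (*-identityˡ _)
    expectation-build (_ ∷ ks) (≡.refl VecAll.∷ bs) s P 0≤P g x y supp =
      trans (expectation-split k s (bitLaw s P 0≤P) _ _ _ _ x y) (trans (+-cong (branch zero) (branch (suc zero))) (sym (∑₂ _)))
      where
      branch : ∀ i → bitLikelihood s P 0≤P i (own s x y) * expectation (build ks bs (other s) (fix i P) (fix-nonNeg s P 0≤P i) λ m → g (i ∷ m)) x y
        ≈ ∑ᵀ ks λ m → factors (2 ∷ ks) s P x y (i ∷ m) * g (i ∷ m) x y
      branch i = trans (*-congˡ (expectation-build ks bs (other s) (fix i P) _ (λ m → g (i ∷ m)) x y (supported-fix s P 0≤P x y i g supp)))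
        (trans (*-∑ᵀ ks _ _) (∑ᵀ-cong ks λ m → trans (sym (*-assoc _ _ _)) (likelihood-factor s P 0≤P x y i g supp m)))

    -- The ratio at leaf m is `factors` over the smoothed prior, which is at least (1 - η)^n times
    -- the true one.
    bounded-build : ∀ {n} (ks : Vec ℕ n) bs s P 0≤P g x y {R B} → 0# ≤ B → Supported s P x y g →
      (∀ m → R * factors ks s P x y m * (g m x y * g m x y) ≤ B * ((1# - η) ^ n * prior ks P m)) →
      Bounded B x y (build ks bs s P 0≤P g) R
    bounded-build [] bs s P 0≤P g x y {R} {B} 0≤B supp hyp = ≤-respˡ (*-congʳ (*-identityʳ R)) (≤-respʳ (solve 1 (λ b → b :* (# 1 :* # 1) := b) refl B) (hyp []))
    bounded-build {suc n} (_ ∷ ks) (≡.refl VecAll.∷ bs) s P 0≤P g x y {R} {B} 0≤B supp hyp =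
      bounded-split k s (bitLaw s P 0≤P) _ _ _ _ (branch zero) (branch (suc zero))
      where
      branch : ∀ i → Bounded B x y (build ks bs (other s) (fix i P) (fix-nonNeg s P 0≤P i) λ m → g (i ∷ m))
        (R * (bitLikelihood s P 0≤P i (own s x y) / smooth (bitPrior s P 0≤P i)))
      branch i = bounded-build ks bs (other s) (fix i P) _ (λ m → g (i ∷ m)) x y 0≤B (supported-fix s P 0≤P x y i g supp) λ m →
        ≤-respˡ (solve 5 (λ r l f h v → r :* (l :* f :* h) :* h :* v := r :* (l :* v) :* f :* (h :* h)) refl R u (factors ks (other s) (fix i P) x y m) (g (i ∷ m) x y) (v ⁻¹))
          (/≤ 0<v (begin
            R * (u * factors ks (other s) (fix i P) x y m * g (i ∷ m) x y) * g (i ∷ m) x y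
              ≈⟨ *-congʳ (*-congˡ (likelihood-factor s P 0≤P x y i g supp m)) ⟩
            R * (factors (2 ∷ ks) s P x y (i ∷ m) * g (i ∷ m) x y) * g (i ∷ m) x y
              ≈⟨ solve 3 (λ r f h → r :* (f :* h) :* h := r :* f :* (h :* h)) refl R (factors (2 ∷ ks) s P x y (i ∷ m)) (g (i ∷ m) x y) ⟩
            R * factors (2 ∷ ks) s P x y (i ∷ m) * (g (i ∷ m) x y * g (i ∷ m) x y)
              ≤⟨ hyp (i ∷ m) ⟩
            B * ((1# - η) * (1# - η) ^ n * (w * prior ks (fix i P) m))
              ≈⟨ solve 5 (λ b e d w p → b :* (e :* d :* (w :* p)) := b :* (d :* p) :* (e :* w)) refl B (1# - η) ((1# - η) ^ n) w (prior ks (fix i P) m) ⟩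
            B * ((1# - η) ^ n * prior ks (fix i P) m) * ((1# - η) * w)
              ≤⟨ *-monoˡ-≤ _ (*-nonNeg 0≤B (*-nonNeg (^-nonNeg n (0≤diff η≤1)) (prior-nonNeg ks (fix i P) (fix-nonNeg s P 0≤P i) m))) (smooth-≥ w) ⟩
            B * ((1# - η) ^ n * prior ks (fix i P) m) * v ∎))
        where
        open ≤R
        u v w : ℝ
        u = bitLikelihood s P 0≤P i (own s x y)
        w = bitPrior s P 0≤P i
        v = smooth w
        0<v : 0# < v
        0<v = smooth-pos (0≤bitPrior s P 0≤P i)

    height-build : ∀ {n} (ks : Vec ℕ n) bs s P 0≤P g → height (build ks bs s P 0≤P g) ℕ.≤ n ℕ.* suc k
    height-build [] bs s P 0≤P g = z≤n
    height-build (_ ∷ ks) (≡.refl VecAll.∷ bs) s P 0≤P g = ℕ.≤-trans (height-split k s (bitLaw s P 0≤P) _ _ _ _)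
      (ℕ.+-monoʳ-≤ (suc k) (ℕ.⊔-lub (height-build ks bs (other s) (fix zero P) _ _) (height-build ks bs (other s) (fix (suc zero) P) _ _)))

    leaves-build : ∀ {Q : Matrix → Set} {n} (ks : Vec ℕ n) bs s P 0≤P g → (∀ m → Q (g m)) → Leaves Q (build ks bs s P 0≤P g)
    leaves-build [] bs s P 0≤P g Qg = Qg []
    leaves-build (_ ∷ ks) (≡.refl VecAll.∷ bs) s P 0≤P g Qg = leaves-split k s (bitLaw s P 0≤P) _ _ _ _
      (leaves-build ks bs (other s) (fix zero P) _ _ λ m → Qg (zero ∷ m))
      (leaves-build ks bs (other s) (fix (suc zero) P) _ _ λ m → Qg (suc zero ∷ m))

  -- One public random string: the first message and the remaining bits

  sign-within : ∀ n → sign n within 1#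
  sign-within zero = ≤-refl , ≤-via (proj₁ 0<2) (solve 0 (# 1 := :- # 1 :+ # 2) refl)
  sign-within (suc n) = within-product (≤-via (proj₁ 0<2) (solve 0 (# 1 := :- # 1 :+ # 2) refl) , ≤-reflexive (-‿involutive 1#)) (sign-within n)

  module SimBound (nx ny : ℕ) where

    open Simulation nx ny

    ⟨⟩-point : ∀ ε x y g → ⟨ (λ x′ y′ → ε * (indicator (x Fin.≟ x′) * indicator (y Fin.≟ y′))) , g ⟩ ≈ ε * g x y
    ⟨⟩-point ε x y g = trans
      (∑-cong λ x′ → trans (∑-cong λ y′ → solve 4 (λ e a b g → e :* (a :* b) :* g := e :* (a :* (b :* g))) refl ε (indicator (x Fin.≟ x′)) (indicator (y Fin.≟ y′)) (g x′ y′))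
        (trans (sym (*-∑ˡ ε _)) (*-congˡ (trans (sym (*-∑ˡ (indicator (x Fin.≟ x′)) _)) (*-congˡ (∑-indicator y (g x′)))))))
      (trans (sym (*-∑ˡ ε _)) (*-congˡ (∑-indicator x λ x′ → g x′ y)))

    -- The functionals that read off plus or minus the entry at (x, y) compare it with a sign.
    sim-within : ∀ {T g} → Sim T g → ∀ x y → g x y within 1#
    sim-within {g = g} sim x y = ≤-trans (≤-respˡ (*-identityˡ _) (upper 1#)) (proj₁ (unit 1# (≤-refl , proj₂ (sign-within 0)))) ,
      ≤-trans (≤-respˡ (solve 1 (λ g → :- # 1 :* g := :- g) refl (g x y)) (upper (- 1#))) (proj₁ (unit (- 1#) (within-neg (sign-within 0))))
      where
      point : ℝ → Matrix
      point ε x′ y′ = ε * (indicator (x Fin.≟ x′) * indicator (y Fin.≟ y′))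
      upper : ∀ ε → ε * g x y ≤ ε * val (proj₁ (sim (point ε))) x y
      upper ε = ≤-respˡ (⟨⟩-point ε x y g) (≤-respʳ (⟨⟩-point ε x y (val (proj₁ (sim (point ε))))) (proj₂ (proj₂ (sim (point ε)))))
      unit : ∀ ε → ε within 1# → (ε * val (proj₁ (sim (point ε))) x y) within 1#
      unit ε ε≤1 = within-product ε≤1 (sign-within (toℕ (run (proj₁ (sim (point ε))) (x , zero) (y , zero))))

  module FirstRound (nx ny k : ℕ) where

    open ProtocolTree nx ny k
    open Rejection nx ny using (sim-rejection)
    open SimBound nx ny

    module _ {n l} {ks : Vec ℕ n} (bs : Bits ks) (P : Weights (l ∷ ks)) (0≤P : NonNeg P) (whole≉0 : ¬ whole (mass P) ≈ 0#)
      (g : Transcript (l ∷ ks) → Matrix) {T : ℕ} (sims : ∀ m → Sim T (g m)) (J e : ℕ) where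

      0≤fix : ∀ i → NonNeg (fix i P)
      0≤fix i x y m = 0≤P x y (i ∷ m)

      0<whole : 0# < whole (mass P)
      0<whole = nonNeg≉⇒> (whole-nonNeg (mass-nonNeg 0≤P)) whole≉0

      v : Fin l → ℝ
      v i = whole (mass (fix i P)) / whole (mass P)

      u r r̃ : Fin l → X → ℝ
      u i x = given aliceSide (mass (fix i P)) x / given aliceSide (mass P) x
      r i x = u i x / v i

      -- First messages of ratio above `L` are dropped. `L` is written as a square because √L enters
      -- the error.
      L : ℝ
      L = 2^ e * 2^ e

      good? : ∀ i x → Dec (r i x ≤ L)
      good? i x = dec (r i x ≤ L)

      r̃ i x = indicator (good? i x) * r i x

      tree : Fin l → PTree
      tree i = build ks bs bobSide (fix i P) (0≤fix i) λ m → g (i ∷ m)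

      E V : Fin l → Matrix
      E i = expectation (tree i)
      V i = attempts J (tree i)

      0≤v : ∀ i → 0# ≤ v i
      0≤v i = /-nonNeg (whole-nonNeg (mass-nonNeg (0≤fix i))) (proj₁ 0<whole)

      0≤u : ∀ i x → 0# ≤ u i x
      0≤u i x = /-nonNeg (given-nonNeg aliceSide (mass-nonNeg (0≤fix i)) x) (given-nonNeg aliceSide (mass-nonNeg 0≤P) x)

      0≤r : ∀ i x → 0# ≤ r i x
      0≤r i x = /-nonNeg (0≤u i x) (0≤v i)

      0≤r̃ : ∀ i x → 0# ≤ r̃ i x
      0≤r̃ i x = *-nonNeg (indicator-nonNeg (good? i x)) (0≤r i x)

      r̃≤L : ∀ i x → r̃ i x ≤ L
      r̃≤L i x with good? i x
      ... | yes r≤L = ≤-respˡ (sym (*-identityˡ _)) r≤L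
      ... | no _ = ≤-respˡ (sym (zeroˡ _)) (*-nonNeg (proj₁ (2^-pos e)) (proj₁ (2^-pos e)))

      Σv : ∑ v ≈ 1#
      Σv = trans (sym (*-∑ʳ _ _)) (trans (*-congʳ (sym (whole-fix P))) (*-inverseʳ whole≉0))

      vr≈u : ∀ i x → v i * r i x ≈ u i x
      vr≈u i x with dec (whole (mass (fix i P)) ≈ 0#)
      ... | yes w≈0 = trans (*-congʳ (trans (*-congʳ w≈0) (zeroˡ _))) (trans (zeroˡ _) (sym (trans (*-congʳ (given-zero aliceSide (mass-nonNeg (0≤fix i)) w≈0 x)) (zeroˡ _))))
      ... | no w≉0 = trans (*-comm _ _) (/-cancel (*-nonZero w≉0 (⁻¹-nonZero whole≉0)))

      Σu≤1 : ∀ x → (∑ λ i → u i x) ≤ 1#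
      Σu≤1 x with dec (given aliceSide (mass P) x ≈ 0#)
      ... | yes g≈0 = ≤-trans (≤-reflexive (∑-zero λ i → trans (*-congˡ (⁻¹-zero g≈0)) (zeroʳ _))) 0≤1
      ... | no g≉0 = ≤-reflexive (trans (sym (*-∑ʳ _ _)) (trans (*-congʳ (sym (given-fix aliceSide P x))) (*-inverseʳ g≉0)))

      Σvr≤1 : ∀ x → (∑ λ i → v i * r i x) ≤ 1#
      Σvr≤1 x = ≤-respˡ (∑-cong λ i → sym (vr≈u i x)) (Σu≤1 x)

      r̃≤r : ∀ i x → r̃ i x ≤ r i x
      r̃≤r i x = ≤-respʳ (*-identityˡ _) (*-monoʳ-≤ _ (0≤r i x) (indicator≤1 (good? i x)))

      Σvr̃≤1 : ∀ x → (∑ λ i → v i * r̃ i x) ≤ 1#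
      Σvr̃≤1 x = ≤-trans (∑-mono λ i → *-monoˡ-≤ (v i) (0≤v i) (r̃≤r i x)) (Σvr≤1 x)

      S : Matrix
      S x y = ∑ λ i → v i * r̃ i x * V i x y

      truth : Matrix
      truth x y = ∑ λ i → u i x * E i x y

      truth≈ : ∀ x y → Supported aliceSide P x y g → truth x y ≈ ∑ᵀ (l ∷ ks) λ m → factors (l ∷ ks) aliceSide P x y m * g m x y
      truth≈ x y supp = ∑-cong λ i → trans
        (*-congˡ (expectation-build ks bs bobSide (fix i P) (0≤fix i) (λ m → g (i ∷ m)) x y λ m f≈0 → supp (i ∷ m) (trans (*-congˡ f≈0) (zeroʳ _))))
        (trans (*-∑ᵀ ks _ _) (∑ᵀ-cong ks λ m → sym (*-assoc _ _ _)))

      module _ {ℓ} (N< : n ℕ.* suc k ℕ.< 2 ℕ.^ ℓ) where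

        simV : ∀ i → Sim (cost T ℓ J) (V i)
        simV i = sim-attempts ℓ (n ℕ.* suc k) N< J (tree i) (leaves-build ks bs bobSide (fix i P) (0≤fix i) _ λ m → sims (i ∷ m)) (height-build ks bs bobSide (fix i P) (0≤fix i) _)

        sim-first : ∀ {γ} → 0# ≤ γ → γ * (L + 1#) ≤ 1# → ∀ K ℓ′ → suc (K ℕ.* 2) ℕ.≤ 2 ℕ.^ ℓ′ →
          Sim (ℓ′ ℕ.+ cost T ℓ J) λ x y → (1# - (1# - γ) ^ K) * S x y
        sim-first 0≤γ γL≤1 = sim-rejection v 0≤v Σv r̃ 0≤r̃ Σvr̃≤1 V simV r̃≤L 0≤γ γL≤1

        module _ {B β : ℝ} (0<B : 0# < B) (0≤β : 0# ≤ β) (B≤ : B ≤ 1# * (β * β)) (x : X) (y : Y) (supp : Supported aliceSide P x y g)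
          (hyp : ∀ m → factors (l ∷ ks) aliceSide P x y m * (g m x y * g m x y) * whole (mass P) ≤ B * ((1# - η) ^ n * whole λ x y → P x y m)) where

          open Accuracy nx ny B 0<B x y

          bounded-tree : ∀ i → Bounded B x y (tree i) (r i x)
          bounded-tree i = bounded-build ks bs bobSide (fix i P) (0≤fix i) (λ m → g (i ∷ m)) x y (proj₁ 0<B)
            (λ m f≈0 → supp (i ∷ m) (trans (*-congˡ f≈0) (zeroʳ _))) bound
            where
            bound : ∀ m → r i x * factors ks bobSide (fix i P) x y m * (g (i ∷ m) x y * g (i ∷ m) x y) ≤ B * ((1# - η) ^ n * prior ks (fix i P) m)
            bound m with dec (whole (mass (fix i P)) ≈ 0#)
            ... | yes w≈0 = ≤-respˡ (sym (trans (*-congʳ (trans (*-congʳ r≈0) (zeroˡ _))) (zeroˡ _)))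
              (*-nonNeg (proj₁ 0<B) (*-nonNeg (^-nonNeg n (0≤diff η≤1)) (prior-nonNeg ks (fix i P) (0≤fix i) m)))
              where
              r≈0 : r i x ≈ 0#
              r≈0 = trans (*-congˡ (⁻¹-zero (trans (*-congʳ w≈0) (zeroˡ _)))) (zeroʳ _)
            ... | no w≉0 = *-cancelʳ-≤ (nonNeg≉⇒> (whole-nonNeg (mass-nonNeg (0≤fix i))) w≉0)
              (≤-respˡ (trans (solve 4 (λ u f h w → u :* f :* h :* w := u :* w :* f :* h) refl (u i x) (factors ks bobSide (fix i P) x y m) (g (i ∷ m) x y * g (i ∷ m) x y) (whole (mass P)))
                  (trans (*-congʳ (*-congʳ rw)) (solve 4 (λ u f h w → u :* w :* f :* h := u :* f :* h :* w) refl (r i x) (factors ks bobSide (fix i P) x y m) (g (i ∷ m) x y * g (i ∷ m) x y) (whole (mass (fix i P))))))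
                (≤-respʳ (trans (*-congˡ (*-congˡ (sym (prior-mass ks (fix i P) (0≤fix i) m)))) (solve 4 (λ b d p w → b :* (d :* (p :* w)) := b :* (d :* p) :* w) refl B ((1# - η) ^ n) (prior ks (fix i P) m) (whole (mass (fix i P)))))
                  (hyp (i ∷ m))))
              where
              rw : u i x * whole (mass P) ≈ r i x * whole (mass (fix i P))
              rw = trans (*-congʳ (sym (vr≈u i x))) (trans (solve 3 (λ v r w → v :* r :* w := r :* (v :* w)) refl (v i) (r i x) (whole (mass P))) (*-congˡ (/-cancel whole≉0)))

          -- The first summand is the error of the attempts, with `mean` for the root of r. The
          -- second covers a dropped message, whose whole contribution √r β is at most (r/√L) β
          -- since r exceeds L.
          slack : Fin l → ℝ
          slack i = ρ ^ J * (β * mean (r i x)) + β * (r i x / 2^ e)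

          term-error : ∀ i → (r i x * (E i x y - indicator (good? i x) * V i x y)) within slack i
          term-error i with good? i x
          ... | yes _ = within-cong (*-congˡ (+-congˡ (-‿cong (sym (*-identityˡ _)))))
            (within-mono (≤-via (*-nonNeg 0≤β (/-nonNeg (0≤r i x) (proj₁ (2^-pos e)))) refl)
              (rescale 0<B (0≤r i x) (mean-nonNeg (0≤r i x)) (≤mean² _) (^-nonNeg J 0≤ρ) 0≤β B≤
                λ 0≤β′ B≤′ → attempts-error J (tree i) (bounded-tree i) (0≤r i x) 0≤β′ (≤-respʳ (*-congʳ (*-identityˡ _)) B≤′)))
          ... | no r≰L = within-cong (*-congˡ (solve 2 (λ e w → e := e :- # 0 :* w) refl (E i x y) (V i x y)))
            (within-mono (≤-respˡ (sym (*-identityˡ _)) (≤-via (*-nonNeg (^-nonNeg J 0≤ρ) (*-nonNeg 0≤β (mean-nonNeg (0≤r i x)))) (+-comm _ _)))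
              (rescale 0<B (0≤r i x) (/-nonNeg (0≤r i x) (proj₁ (2^-pos e))) root 0≤1 0≤β B≤
                λ 0≤β′ B≤′ → within-mono (≤-reflexive (sym (*-identityˡ _))) (expectation-within (tree i) (bounded-tree i) (0≤r i x) 0≤β′ (≤-respʳ (*-congʳ (*-identityˡ _)) B≤′))))
            where
            root : r i x ≤ r i x / 2^ e * (r i x / 2^ e)
            root = ≤-respʳ (solve 2 (λ r i → r :* (r :* (i :* i)) := r :* i :* (r :* i)) refl (r i x) (2^ e ⁻¹))
              (≤-respˡ (*-identityʳ _) (*-monoˡ-≤ (r i x) (0≤r i x)
                (≤-respˡ (trans (solve 2 (λ p i → p :* p :* (i :* i) := p :* i :* (p :* i)) refl (2^ e) (2^ e ⁻¹)) (trans (*-cong ee ee) (*-identityˡ 1#)))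
                  (*-monoʳ-≤ _ (square-nonNeg (2^ e ⁻¹)) (≰⇒≥ r≰L)))))
              where
              ee : 2^ e * 2^ e ⁻¹ ≈ 1#
              ee = *-inverseʳ (>⇒≉ (2^-pos e))

          Σslack≤ : (∑ λ i → v i * slack i) ≤ ρ ^ J * β + β / 2^ e
          Σslack≤ = ≤-trans (≤-reflexive (trans
              (∑-cong λ i → solve 6 (λ v c b h r t → v :* (c :* (b :* (h :* (# 1 :+ r))) :+ b :* (r :* t)) := c :* b :* h :* v :+ (c :* b :* h :+ b :* t) :* (v :* r)) refl (v i) (ρ ^ J) β ½ (r i x) (2^ e ⁻¹))
              (trans (∑-+ _ _) (+-cong (sym (*-∑ˡ _ v)) (sym (*-∑ˡ _ λ i → v i * r i x))))))
            (≤-trans (+-mono-≤ (*-monoˡ-≤ _ 0≤cbh (≤-reflexive Σv)) (*-monoˡ-≤ _ (+-nonNeg 0≤cbh (/-nonNeg 0≤β (proj₁ (2^-pos e)))) (Σvr≤1 x)))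
              (≤-reflexive (trans (solve 4 (λ c b h t → c :* b :* h :* # 1 :+ (c :* b :* h :+ b :* t) :* # 1 := c :* b :* (# 2 :* h) :+ b :* t) refl (ρ ^ J) β ½ (2^ e ⁻¹))
                (+-congʳ (trans (*-congˡ 2*½) (*-identityʳ _))))))
            where
            0≤cbh : 0# ≤ ρ ^ J * β * ½
            0≤cbh = *-nonNeg (*-nonNeg (^-nonNeg J 0≤ρ) 0≤β) 0≤½

          S-within : S x y within 1#
          S-within = within-mono (≤-trans (≤-reflexive (∑-cong λ i → *-identityʳ _)) (Σvr̃≤1 x))
            (within-∑ λ i → within-* (v i * r̃ i x) (*-nonNeg (0≤v i) (0≤r̃ i x)) (sim-within (simV i) x y))

          -- The three terms belong to the limited number of attempts, to the dropped messages and
          -- to rejection sampling without result.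
          first-error : ∀ {γ} → γ ≤ 1# → ∀ K → (truth x y - (1# - (1# - γ) ^ K) * S x y) within ρ ^ J * β + β / 2^ e + (1# - γ) ^ K
          first-error {γ} γ≤1 K = within-cong pieces (within-+ (within-mono Σslack≤ (within-∑ λ i → within-* (v i) (0≤v i) (term-error i)))
              (within-mono (≤-reflexive (*-identityʳ _)) (within-* _ (^-nonNeg K (0≤diff γ≤1)) S-within)))
            where
            pieces : (∑ λ i → v i * (r i x * (E i x y - indicator (good? i x) * V i x y))) + (1# - γ) ^ K * S x y ≈ truth x y - (1# - (1# - γ) ^ K) * S x y
            pieces = trans (+-congʳ (trans
                (∑-cong λ i → trans (solve 5 (λ v r e c w → v :* (r :* (e :- c :* w)) := v :* r :* e :+ :- (v :* (c :* r) :* w)) refl (v i) (r i x) (E i x y) (indicator (good? i x)) (V i x y))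
                  (+-congʳ (*-congʳ (vr≈u i x))))
                (trans (∑-+ _ _) (+-congˡ (sym (∑-neg λ i → v i * r̃ i x * V i x y))))))
              (solve 3 (λ t s q → t :+ :- s :+ q :* s := t :- (# 1 :- q) :* s) refl (truth x y) (S x y) ((1# - γ) ^ K))

  -- Products a(x)b(y) in a bounded range

  dyadic : ∀ N z → 1# ≤ z → z ≤ 2^ N → ∃ λ j → 2^ j ≤ z × z ≤ 2^ (suc j)
  dyadic zero z 1≤z z≤1 = 0 , 1≤z , ≤-trans z≤1 (2^-mono {0} {1} z≤n)
  dyadic (suc N) z 1≤z z≤ with dec (2^ N ≤ z)
  ... | yes 2^N≤z = N , 2^N≤z , z≤
  ... | no 2^N≰z = dyadic N z 1≤z (≰⇒≥ 2^N≰z)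

  -- One scaling puts the finitely many nonzero values above 1, so that their dyadic levels are
  -- natural numbers.
  commonScale : ∀ {n} (a : Fin n → ℝ) → (∀ i → 0# ≤ a i) → ∃ λ S → ∀ i → a i ≈ 0# ⊎ 1# ≤ 2^ S * a i
  commonScale a 0≤a = proj₁ (bounded s) , λ i → large i (dec (a i ≈ 0#)) ≡.refl
    where
    exponent : ∀ {z} → 0# ≤ z → Dec (z ≈ 0#) → ℕ
    exponent 0≤z (yes _) = 0
    exponent 0≤z (no z≉0) = proj₁ (½^≤ (nonNeg≉⇒> 0≤z z≉0))
    s : _ → ℕ
    s i = exponent (0≤a i) (dec (a i ≈ 0#))
    large : ∀ i d → d ≡ dec (a i ≈ 0#) → a i ≈ 0# ⊎ 1# ≤ 2^ (proj₁ (bounded s)) * a i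
    large i (yes a≈0) _ = inj₁ a≈0
    large i (no a≉0) eq = inj₂ (≤-trans
      (≤-respˡ (2^*½^ N) (*-monoˡ-≤ _ (proj₁ (2^-pos N)) (proj₂ (½^≤ (nonNeg≉⇒> (0≤a i) a≉0)))))
      (*-monoʳ-≤ _ (0≤a i) (2^-mono (≡.subst (ℕ._≤ proj₁ (bounded s)) (≡.cong (exponent (0≤a i)) (≡.sym eq)) (proj₂ (bounded s) i)))))
      where
      N : ℕ
      N = exponent (0≤a i) (no a≉0)

  commonScale-mono : ∀ {S S′ z} → S ℕ.≤ S′ → 0# ≤ z → z ≈ 0# ⊎ 1# ≤ 2^ S * z → z ≈ 0# ⊎ 1# ≤ 2^ S′ * z
  commonScale-mono S≤S′ 0≤z (inj₁ z≈0) = inj₁ z≈0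
  commonScale-mono S≤S′ 0≤z (inj₂ 1≤) = inj₂ (≤-trans 1≤ (*-monoʳ-≤ _ 0≤z (2^-mono S≤S′)))

  scaled : ∀ S {z} → z ≈ 0# ⊎ 1# ≤ 2^ S * z → 2^ S * z ≈ 0# ⊎ 1# ≤ 2^ S * z
  scaled S (inj₁ z≈0) = inj₁ (trans (*-congˡ z≈0) (zeroʳ _))
  scaled S (inj₂ 1≤) = inj₂ 1≤

  record Dyadic (z : ℝ) : Set where
    field
      level : ℕ
      fraction : ℝ
      0≤fraction : 0# ≤ fraction
      fraction≤1 : fraction ≤ 1#
      z≈ : z ≈ 2^ (suc level) * fraction
      lower : z ≈ 0# ⊎ 2^ level ≤ z

    upper : z ≤ 2^ (suc level)
    upper = ≤-respˡ (sym z≈) (≤-respʳ (*-identityʳ _) (*-monoˡ-≤ _ (proj₁ (2^-pos (suc level))) fraction≤1))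

  level-of : ∀ {z} → z ≈ 0# ⊎ 1# ≤ z → Dyadic z
  level-of {z} (inj₁ z≈0) = record { level = 0 ; fraction = 0# ; 0≤fraction = ≤-refl ; fraction≤1 = 0≤1 ; z≈ = trans z≈0 (sym (zeroʳ _)) ; lower = inj₁ z≈0 }
  level-of {z} (inj₂ 1≤z) =
    let N , z≤ = ≤2^ z
        j , lo , hi = dyadic N z 1≤z z≤
        0<p = 2^-pos (suc j)
    in record
      { level = j ; fraction = z / 2^ (suc j) ; 0≤fraction = /-nonNeg (≤-trans 0≤1 1≤z) (proj₁ 0<p)
      ; fraction≤1 = /≤ 0<p (≤-respʳ (sym (*-identityˡ _)) hi) ; z≈ = sym (trans (*-comm _ _) (/-cancel (>⇒≉ 0<p))) ; lower = inj₂ lo }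

  -- The indicator of n₀ ≤ n < n₀ + i, in the form in which adding up slices produces it.
  window : ℕ → ℕ → ℕ → ℝ
  window n₀ zero n = 0#
  window n₀ (suc i) n = indicator (n ℕ.≟ n₀ ℕ.+ i) + window n₀ i n

  window-outside : ∀ n₀ i n → n ℕ.< n₀ ⊎ n₀ ℕ.+ i ℕ.≤ n → window n₀ i n ≈ 0#
  window-outside n₀ zero n _ = refl
  window-outside n₀ (suc i) n out with n ℕ.≟ n₀ ℕ.+ i
  window-outside n₀ (suc i) n (inj₁ n<n₀) | yes ≡.refl = ⊥-elim (ℕ.m+n≮m n₀ i n<n₀)
  window-outside n₀ (suc i) n (inj₂ le) | yes ≡.refl = ⊥-elim (ℕ.n≮n _ (≡.subst (ℕ._≤ n) (ℕ.+-suc n₀ i) le))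
  window-outside n₀ (suc i) n (inj₁ n<n₀) | no _ = trans (+-identityˡ _) (window-outside n₀ i n (inj₁ n<n₀))
  window-outside n₀ (suc i) n (inj₂ le) | no _ = trans (+-identityˡ _) (window-outside n₀ i n (inj₂ (ℕ.≤-trans (ℕ.n≤1+n _) (≡.subst (ℕ._≤ n) (ℕ.+-suc n₀ i) le))))

  window-inside : ∀ n₀ i n → n₀ ℕ.≤ n → n ℕ.< n₀ ℕ.+ i → window n₀ i n ≈ 1#
  window-inside n₀ zero n n₀≤n n< = ⊥-elim (ℕ.n≮n _ (ℕ.<-≤-trans (≡.subst (n ℕ.<_) (ℕ.+-identityʳ n₀) n<) n₀≤n))
  window-inside n₀ (suc i) n n₀≤n n< with n ℕ.≟ n₀ ℕ.+ i
  ... | yes ≡.refl = trans (+-congˡ (window-outside n₀ i n (inj₂ ℕ.≤-refl))) (+-identityʳ _)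
  ... | no n≢ = trans (+-identityˡ _) (window-inside n₀ i n n₀≤n (ℕ.≤∧≢⇒< (ℕ.s≤s⁻¹ (≡.subst (n ℕ.<_) (ℕ.+-suc n₀ i) n<)) n≢))

  module Payoffs (nx ny : ℕ) where

    open Simulation nx ny

    -- The payoff ε·a(x)b(y), scaled down and cut off outside a range of values of a(x)b(y).
    record Payoff (k K : ℕ) (ε : ℝ) (r : Matrix) : Set where
      field
        pay : Matrix
        simPay : Sim 2 pay
        spec : ∀ x y → (pay x y ≈ ε * (½ ^ (2 ℕ.+ K) * r x y) × ½ ^ suc k ≤ r x y × r x y ≤ 2^ (suc K))
                     ⊎ (pay x y ≈ 0# × (r x y ≤ ½ ^ k ⊎ 2^ K ≤ r x y))

    private
      -- On the slice i x + j y = n the scaled product is 2^(n+2) times two fractions, so a slice is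
      -- an equality test. The convex combination `partialSum` halves the weights from each slice to
      -- the one below, in step with 2^n; all slices therefore appear at the same scale, without a
      -- loss for their number.
      payoff′ : ∀ k K {ε} (a : X → ℝ) (b : Y → ℝ) → ε within 1# → (∀ x → 0# ≤ a x) → (∀ y → 0# ≤ b y) → Payoff k K ε λ x y → a x * b y
      payoff′ k K {ε} a b ε≤1 0≤a 0≤b = record { pay = partialSum W ; simPay = sim-partialSum W ; spec = spec }
        where
        S₀ S n₀ W : ℕ
        S₀ = proj₁ (commonScale a 0≤a) ℕ.⊔ proj₁ (commonScale b 0≤b)
        -- As 2^S · 2^S = 2^n₀ · 2^(k+1), level n₀ corresponds to products near ½^(k+1), and W
        -- levels higher they reach 2^K.
        S = S₀ ℕ.+ suc k
        n₀ = S₀ ℕ.+ S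
        W = suc k ℕ.+ K

        La : ∀ x → Dyadic (2^ S * a x)
        La x = level-of (scaled S (commonScale-mono {proj₁ (commonScale a 0≤a)} (ℕ.≤-trans (ℕ.m≤m⊔n _ _) (ℕ.m≤m+n S₀ _)) (0≤a x) (proj₂ (commonScale a 0≤a) x)))

        Lb : ∀ y → Dyadic (2^ S * b y)
        Lb y = level-of (scaled S (commonScale-mono (ℕ.≤-trans (ℕ.m≤n⊔m (proj₁ (commonScale a 0≤a)) _) (ℕ.m≤m+n S₀ _)) (0≤b y) (proj₂ (commonScale b 0≤b) y)))

        i : X → ℕ
        i x = Dyadic.level (La x)
        j : Y → ℕ
        j y = Dyadic.level (Lb y)

        φ : X → ℝ
        φ x = ε * Dyadic.fraction (La x)

        ψ : Y → ℝ
        ψ y = Dyadic.fraction (Lb y)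

        fraction-within : ∀ {z} (L : Dyadic z) → Dyadic.fraction L within 1#
        fraction-within L = fraction≤1 , ≤-trans (neg-nonPos 0≤fraction) 0≤1
          where open Dyadic L

        slice : ℕ → Matrix
        slice n x y = indicator (i x ℕ.+ j y ℕ.≟ n) * (φ x * ψ y)

        sim-slice : ∀ n → Sim 2 (slice n)
        -- The successors exclude j y > n, where truncated subtraction yields 0, which is no
        -- successor.
        sim-slice n = sim-cong (λ x y → *-congʳ (indicator-cong (suc (i x) ℕ.≟ suc n ℕ.∸ j y) (i x ℕ.+ j y ℕ.≟ n) (to (i x) (j y)) (from (i x) (j y))))
          (sim-diagonal (λ x → suc (i x)) (λ y → suc n ℕ.∸ j y) (λ x → within-product ε≤1 (fraction-within (La x))) (λ y → fraction-within (Lb y)))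
          where
          to : ∀ i j → suc i ≡ suc n ℕ.∸ j → i ℕ.+ j ≡ n
          to i j eq with j ℕ.≤? n
          ... | yes j≤n = ≡.trans (≡.cong (ℕ._+ j) (ℕ.suc-injective (≡.trans eq (ℕ.+-∸-assoc 1 j≤n)))) (ℕ.m∸n+n≡m j≤n)
          ... | no j≰n = ⊥-elim (ℕ.0≢1+n (≡.sym (≡.trans eq (ℕ.m≤n⇒m∸n≡0 (ℕ.≰⇒> j≰n)))))
          from : ∀ i j → i ℕ.+ j ≡ n → suc i ≡ suc n ℕ.∸ j
          from i j ≡.refl = ≡.sym (ℕ.m+n∸n≡m (suc i) j)

        partialSum : ℕ → Matrix
        partialSum zero x y = 0#
        partialSum (suc w) x y = ½ * slice (n₀ ℕ.+ w) x y + (1# - ½) * partialSum w x y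

        sim-partialSum : ∀ w → Sim 2 (partialSum w)
        sim-partialSum zero = sim-mono z≤n sim-0
        sim-partialSum (suc w) = sim-mix ½ 0≤½ ½≤1 (sim-slice (n₀ ℕ.+ w)) (sim-partialSum w)

        Q : Matrix
        Q x y = 2^ (2 ℕ.+ n₀) ⁻¹ * (ε * (2^ S * a x * (2^ S * b y)))

        slice≈ : ∀ w x y → slice (n₀ ℕ.+ w) x y ≈ indicator (i x ℕ.+ j y ℕ.≟ n₀ ℕ.+ w) * (½ ^ w * Q x y)
        slice≈ w x y with i x ℕ.+ j y ℕ.≟ n₀ ℕ.+ w
        ... | no _ = trans (zeroˡ _) (sym (zeroˡ _))
        ... | yes eq = *-congˡ (sym (begin
          ½ ^ w * (2^ (2 ℕ.+ n₀) ⁻¹ * (ε * (2^ S * a x * (2^ S * b y))))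
            ≈⟨ *-congˡ (*-congˡ (*-congˡ (*-cong (Dyadic.z≈ (La x)) (Dyadic.z≈ (Lb y))))) ⟩
          ½ ^ w * (2^ (2 ℕ.+ n₀) ⁻¹ * (ε * (2^ (suc (i x)) * Dyadic.fraction (La x) * (2^ (suc (j y)) * ψ y))))
            ≈⟨ solve 7 (λ h q e p f s g → h :* (q :* (e :* (p :* f :* (s :* g)))) := h :* q :* (p :* s) :* (e :* f :* g)) refl (½ ^ w) (2^ (2 ℕ.+ n₀) ⁻¹) ε (2^ (suc (i x))) (Dyadic.fraction (La x)) (2^ (suc (j y))) (ψ y) ⟩
          ½ ^ w * 2^ (2 ℕ.+ n₀) ⁻¹ * (2^ (suc (i x)) * 2^ (suc (j y))) * (φ x * ψ y)
            ≈⟨ *-congʳ (*-congˡ (trans (sym (^-homo-* (fromℕ 2) (suc (i x)) (suc (j y)))) (trans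
                 (reflexive (≡.cong 2^ (≡.trans (≡.cong suc (ℕ.+-suc (i x) (j y))) (≡.cong (2 ℕ.+_) eq)))) (^-homo-* (fromℕ 2) (2 ℕ.+ n₀) w)))) ⟩
          ½ ^ w * 2^ (2 ℕ.+ n₀) ⁻¹ * (2^ (2 ℕ.+ n₀) * 2^ w) * (φ x * ψ y)
            ≈⟨ solve 5 (λ h q p s z → h :* q :* (p :* s) :* z := p :* q :* (s :* h) :* z) refl (½ ^ w) (2^ (2 ℕ.+ n₀) ⁻¹) (2^ (2 ℕ.+ n₀)) (2^ w) (φ x * ψ y) ⟩
          2^ (2 ℕ.+ n₀) * 2^ (2 ℕ.+ n₀) ⁻¹ * (2^ w * ½ ^ w) * (φ x * ψ y)
            ≈⟨ *-congʳ (*-cong (*-inverseʳ (>⇒≉ (2^-pos (2 ℕ.+ n₀)))) (2^*½^ w)) ⟩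
          1# * 1# * (φ x * ψ y)
            ≈⟨ solve 1 (λ z → # 1 :* # 1 :* z := z) refl (φ x * ψ y) ⟩
          φ x * ψ y ∎))
          where open SetoidReasoning setoid

        partialSum≈ : ∀ w x y → partialSum w x y ≈ window n₀ w (i x ℕ.+ j y) * (½ ^ w * Q x y)
        partialSum≈ zero x y = sym (zeroˡ _)
        partialSum≈ (suc w) x y = trans (+-cong (*-congˡ (slice≈ w x y)) (*-cong (trans (+-congʳ (sym ½+½)) (solve 1 (λ h → h :+ h :- h := h) refl ½)) (partialSum≈ w x y)))
          (solve 5 (λ h a b p q → h :* (a :* (p :* q)) :+ h :* (b :* (p :* q)) := (a :+ b) :* (h :* p :* q)) refl ½ (indicator (i x ℕ.+ j y ℕ.≟ n₀ ℕ.+ w)) (window n₀ w (i x ℕ.+ j y)) (½ ^ w) (Q x y))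

        2^S² : 2^ S * 2^ S ≈ 2^ n₀ * 2^ (suc k)
        2^S² = trans (*-congʳ (^-homo-* (fromℕ 2) S₀ (suc k))) (trans (solve 3 (λ a b c → a :* b :* c := a :* c :* b) refl (2^ S₀) (2^ (suc k)) (2^ S)) (*-congʳ (sym (^-homo-* (fromℕ 2) S₀ S))))

        r : Matrix
        r x y = a x * b y

        scaled-r : ∀ x y → 2^ S * a x * (2^ S * b y) ≈ 2^ n₀ * (2^ (suc k) * r x y)
        scaled-r x y = trans (solve 3 (λ s a b → s :* a :* (s :* b) := s :* s :* (a :* b)) refl (2^ S) (a x) (b y)) (trans (*-congʳ 2^S²) (*-assoc _ _ _))

        scale : ∀ x y → ½ ^ W * Q x y ≈ ε * (½ ^ (2 ℕ.+ K) * r x y)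
        scale x y = begin
          ½ ^ (suc k ℕ.+ K) * (2^ (2 ℕ.+ n₀) ⁻¹ * (ε * (2^ S * a x * (2^ S * b y))))
            ≈⟨ *-cong (^-homo-* ½ (suc k) K) (*-congˡ (*-congˡ (scaled-r x y))) ⟩
          ½ ^ suc k * ½ ^ K * (2^ (2 ℕ.+ n₀) ⁻¹ * (ε * (2^ n₀ * (2^ (suc k) * r x y))))
            ≈⟨ solve 7 (λ h g q e n p r → h :* g :* (q :* (e :* (n :* (p :* r)))) := p :* h :* (n :* q) :* (e :* (g :* r))) refl (½ ^ suc k) (½ ^ K) (2^ (2 ℕ.+ n₀) ⁻¹) ε (2^ n₀) (2^ (suc k)) (r x y) ⟩
          2^ (suc k) * ½ ^ suc k * (2^ n₀ * 2^ (2 ℕ.+ n₀) ⁻¹) * (ε * (½ ^ K * r x y))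
            ≈⟨ *-congʳ (*-cong (2^*½^ (suc k)) quarter) ⟩
          1# * (½ * ½) * (ε * (½ ^ K * r x y))
            ≈⟨ solve 4 (λ h e g r → # 1 :* (h :* h) :* (e :* (g :* r)) := e :* (h :* (h :* g) :* r)) refl ½ ε (½ ^ K) (r x y) ⟩
          ε * (½ ^ (2 ℕ.+ K) * r x y) ∎
          where
          open SetoidReasoning setoid
          quarter : 2^ n₀ * 2^ (2 ℕ.+ n₀) ⁻¹ ≈ ½ * ½
          quarter = sym (/-unique (>⇒≉ (2^-pos (2 ℕ.+ n₀))) (trans (solve 2 (λ h p → h :* h :* (# 2 :* (# 2 :* p)) := # 2 :* h :* (# 2 :* h) :* p) refl ½ (2^ n₀))
            (trans (*-congʳ (*-cong 2*½ 2*½)) (solve 1 (λ p → # 1 :* # 1 :* p := p) refl (2^ n₀)))))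

        upper-r : ∀ x y {n} → i x ℕ.+ j y ℕ.≤ n → 2^ n₀ * (2^ (suc k) * r x y) ≤ 2^ (2 ℕ.+ n)
        upper-r x y {n} le = ≤-respˡ (scaled-r x y) (≤-trans
          (*-mono-≤ (*-nonNeg (proj₁ (2^-pos S)) (0≤a x)) (Dyadic.upper (La x)) (*-nonNeg (proj₁ (2^-pos S)) (0≤b y)) (Dyadic.upper (Lb y)))
          (≤-respˡ (^-homo-* (fromℕ 2) (suc (i x)) (suc (j y))) (2^-mono (≡.subst (ℕ._≤ 2 ℕ.+ n) (≡.cong suc (≡.sym (ℕ.+-suc (i x) (j y)))) (s≤s (s≤s le))))))

        lower-r : ∀ x y → r x y ≈ 0# ⊎ 2^ (i x ℕ.+ j y) ≤ 2^ n₀ * (2^ (suc k) * r x y)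
        lower-r x y with Dyadic.lower (La x) | Dyadic.lower (Lb y)
        ... | inj₁ z | _ = inj₁ (trans (*-congʳ (integral z (>⇒≉ (2^-pos S)))) (zeroˡ _))
        ... | inj₂ _ | inj₁ z = inj₁ (trans (*-congˡ (integral z (>⇒≉ (2^-pos S)))) (zeroʳ _))
        ... | inj₂ p | inj₂ q = inj₂ (≤-respʳ (scaled-r x y) (≤-respˡ (sym (^-homo-* (fromℕ 2) (i x) (j y))) (*-mono-≤ (proj₁ (2^-pos (i x))) p (proj₁ (2^-pos (j y))) q)))

        cancel-n₀ : ∀ {l z} → 2^ n₀ * z ≤ 2^ (n₀ ℕ.+ l) → z ≤ 2^ l
        cancel-n₀ {l} le = *-cancelˡ-≤ (2^-pos n₀) (≤-respʳ (^-homo-* (fromℕ 2) n₀ l) le)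

        cancel-n₀′ : ∀ {l z} → 2^ (n₀ ℕ.+ l) ≤ 2^ n₀ * z → 2^ l ≤ z
        cancel-n₀′ {l} le = *-cancelˡ-≤ (2^-pos n₀) (≤-respˡ (^-homo-* (fromℕ 2) n₀ l) le)

        ½-move : ∀ {k z} → 2^ k * z ≤ 1# → z ≤ ½ ^ k
        ½-move {k} le = *-cancelˡ-≤ (2^-pos k) (≤-respʳ (sym (2^*½^ k)) le)

        ½-move′ : ∀ {k z} → 1# ≤ 2^ k * z → ½ ^ k ≤ z
        ½-move′ {k} le = *-cancelˡ-≤ (2^-pos k) (≤-respˡ (sym (2^*½^ k)) le)

        spec : ∀ x y → (partialSum W x y ≈ ε * (½ ^ (2 ℕ.+ K) * r x y) × ½ ^ suc k ≤ r x y × r x y ≤ 2^ (suc K))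
                     ⊎ (partialSum W x y ≈ 0# × (r x y ≤ ½ ^ k ⊎ 2^ K ≤ r x y))
        spec x y with lower-r x y
        ... | inj₁ r≈0 = inj₂ (trans (partialSum≈ W x y) (trans (*-congˡ (trans (scale x y) (trans (*-congˡ (trans (*-congˡ r≈0) (zeroʳ _))) (zeroʳ _)))) (zeroʳ _)) ,
            inj₁ (≤-respˡ (sym r≈0) (proj₁ (½^-pos k))))
        ... | inj₂ lo with n₀ ℕ.≤? i x ℕ.+ j y | i x ℕ.+ j y ℕ.<? n₀ ℕ.+ W
        ... | no n₀≰ | _ = inj₂ (trans (partialSum≈ W x y) (trans (*-congʳ (window-outside n₀ W _ (inj₁ (ℕ.≰⇒> n₀≰)))) (zeroˡ _)) ,
            inj₁ (½-move {k} (*-cancelˡ-≤ 0<2 (≤-respˡ (*-assoc _ _ _) (cancel-n₀ {1} (≤-trans (upper-r x y (ℕ.<⇒≤pred (ℕ.≰⇒> n₀≰))) (≤-reflexive (reflexive (≡.cong 2^ (pred-lemma (ℕ.≰⇒> n₀≰)))))))))))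
          where
          pred-lemma : ∀ {m n} → m ℕ.< n → 2 ℕ.+ ℕ.pred n ≡ n ℕ.+ 1
          pred-lemma (s≤s {n = n} _) = ≡.sym (≡.cong suc (ℕ.+-comm n 1))
        ... | yes _ | no ≮ = inj₂ (trans (partialSum≈ W x y) (trans (*-congʳ (window-outside n₀ W _ (inj₂ (ℕ.≮⇒≥ ≮)))) (zeroˡ _)) ,
            inj₂ (*-cancelˡ-≤ (2^-pos (suc k)) (≤-respˡ (^-homo-* (fromℕ 2) (suc k) K) (cancel-n₀′ {W} (≤-trans (2^-mono (ℕ.≮⇒≥ ≮)) lo)))))
        ... | yes n₀≤ | yes <W = inj₁ (trans (partialSum≈ W x y) (trans (*-congʳ (window-inside n₀ W _ n₀≤ <W)) (trans (*-identityˡ _) (scale x y))) ,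
            ½-move′ {suc k} (cancel-n₀′ {0} (≤-trans (2^-mono (≡.subst (ℕ._≤ i x ℕ.+ j y) (≡.sym (ℕ.+-identityʳ n₀)) n₀≤)) lo)) ,
            *-cancelˡ-≤ (2^-pos (suc k)) (≤-respʳ (^-homo-* (fromℕ 2) (suc k) (suc K)) (cancel-n₀ {suc k ℕ.+ suc K} (≤-trans (upper-r x y (ℕ.<⇒≤pred <W)) (≤-reflexive (reflexive (≡.cong 2^ W-lemma)))))))
          where
          W-lemma : 2 ℕ.+ ℕ.pred (n₀ ℕ.+ W) ≡ n₀ ℕ.+ (suc k ℕ.+ suc K)
          W-lemma = ≡.trans (≡.cong (λ z → 2 ℕ.+ ℕ.pred z) (ℕ.+-suc n₀ (k ℕ.+ K)))
            (≡.trans (≡.cong suc (≡.sym (ℕ.+-suc n₀ (k ℕ.+ K)))) (≡.trans (≡.sym (ℕ.+-suc n₀ (suc k ℕ.+ K))) (≡.cong (n₀ ℕ.+_) (≡.sym (ℕ.+-suc (suc k) K)))))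

    opaque

      payoff : ∀ k K {ε} (a : X → ℝ) (b : Y → ℝ) → ε within 1# → (∀ x → 0# ≤ a x) → (∀ y → 0# ≤ b y) → Payoff k K ε λ x y → a x * b y
      payoff = payoff′

  -- The correlation of the payoff with f

  sgn : ℝ → ℝ
  sgn z with total 0# z
  ... | inj₁ _ = 1#
  ... | inj₂ _ = - 1#

  sgn-within : ∀ z → sgn z within 1#
  sgn-within z with total 0# z
  ... | inj₁ _ = sign-within 0
  ... | inj₂ _ = within-neg (sign-within 0)

  sgn-* : ∀ z → sgn z * z ≈ ∣ z ∣
  sgn-* z with total 0# z
  ... | inj₁ _ = *-identityˡ z
  ... | inj₂ _ = solve 1 (λ z → :- # 1 :* z := :- z) refl z

  ∣∣-nonNeg : ∀ z → 0# ≤ ∣ z ∣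
  ∣∣-nonNeg z with total 0# z
  ... | inj₁ 0≤z = 0≤z
  ... | inj₂ z≤0 = nonPos-neg z≤0

  ∣∣-within : ∀ {z e} → z within e → ∣ z ∣ ≤ e
  ∣∣-within {z} (z≤e , -z≤e) with total 0# z
  ... | inj₁ _ = z≤e
  ... | inj₂ _ = -z≤e

  ∣∣-zero : ∀ {z} → ∣ z ∣ ≈ 0# → z ≈ 0#
  ∣∣-zero {z} ∣z∣≈0 with total 0# z
  ... | inj₁ _ = ∣z∣≈0
  ... | inj₂ _ = trans (sym (-‿involutive z)) (trans (-‿cong ∣z∣≈0) -0#≈0#)

  module Gain (nx ny : ℕ) {n : ℕ} (ms : Vec ℕ n) where

    open Marginals nx ny public

    at : Weights ms → Transcript ms → Matrix
    at P m x y = P x y m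

    ΣΣᵀ : (g : X → Y → Transcript ms → ℝ) → whole (mass g) ≈ ∑ᵀ ms λ m → whole (at g m)
    ΣΣᵀ g = trans (∑-cong λ x → ∑-∑ᵀ ms (g x)) (∑-∑ᵀ ms λ x m → ∑ λ y → g x y m)

    module Correlation (P Q : Weights ms) (0≤P : ∀ x y m → 0# ≤ P x y m) (0≤Q : ∀ x y m → 0# ≤ Q x y m)
      (ΣP : whole (mass P) ≈ 1#) (ΣQ : whole (mass Q) ≈ 1#)
      (s : Matrix) (s≤1 : ∀ x y → s x y within 1#)
      (r : Weights ms) (rP≈Q : ∀ x y m → r x y m * P x y m ≈ Q x y m) (K : ℕ) where

      μ : Matrix
      μ = mass P

      0≤μ : ∀ x y → 0# ≤ μ x y
      0≤μ x y = ∑ᵀ-nonNeg ms (0≤P x y)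

      pm qm bias β : Transcript ms → ℝ
      pm m = whole (at P m)
      qm m = whole (at Q m)
      bias m = ∑ λ x → ∑ λ y → Q x y m / qm m * s x y
      β m = ∣ bias m ∣

      0≤pm : ∀ m → 0# ≤ pm m
      0≤pm m = whole-nonNeg λ x y → 0≤P x y m

      0≤qm : ∀ m → 0# ≤ qm m
      0≤qm m = whole-nonNeg λ x y → 0≤Q x y m

      Q-zero : ∀ {m} → qm m ≈ 0# → ∀ x y → Q x y m ≈ 0#
      Q-zero {m} qm≈0 x y = ∑-zero⇒ (λ y → 0≤Q x y m) (∑-zero⇒ (λ x → ∑-nonNeg λ y → 0≤Q x y m) qm≈0 x) y

      Q≉0⇒qm>0 : ∀ {x y m} → ¬ Q x y m ≈ 0# → 0# < qm m
      Q≉0⇒qm>0 {x} {y} {m} Q≉0 = nonNeg≉⇒> (0≤qm m) λ qm≈0 → Q≉0 (Q-zero qm≈0 x y)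

      qm*bias : ∀ m → qm m * bias m ≈ ∑ λ x → ∑ λ y → Q x y m * s x y
      qm*bias m = trans (∑∑-*ˡ (qm m) _) (∑∑-cong λ x y → entry x y)
        where
        entry : ∀ x y → qm m * (Q x y m / qm m * s x y) ≈ Q x y m * s x y
        entry x y with dec (qm m ≈ 0#)
        ... | yes qm≈0 = trans (*-congʳ qm≈0) (trans (zeroˡ _) (sym (trans (*-congʳ (Q-zero qm≈0 x y)) (zeroˡ _))))
        ... | no qm≉0 = trans (solve 4 (λ q z i s → q :* (z :* i :* s) := z :* i :* q :* s) refl (qm m) (Q x y m) (qm m ⁻¹) (s x y)) (*-congʳ (/-cancel qm≉0))

      β≤1 : ∀ m → β m ≤ 1#
      β≤1 m with dec (qm m ≈ 0#)
      ... | yes qm≈0 = ∣∣-within (within-cong (sym (∑-zero λ x → ∑-zero λ y → trans (*-congʳ (trans (*-congʳ (Q-zero qm≈0 x y)) (zeroˡ _))) (zeroˡ _))) (within-0 0≤1))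
      ... | no qm≉0 = ∣∣-within (within-mono
        (≤-reflexive (trans (∑∑-cong λ x y → trans (*-identityʳ _) (*-comm _ _)) (trans (sym (∑∑-*ˡ (qm m ⁻¹) _)) (x⁻¹*x≈1 qm≉0))))
        (within-∑ λ x → within-∑ λ y → within-* (Q x y m / qm m) (/-nonNeg (0≤Q x y m) (0≤qm m)) (s≤1 x y)))

      -- Inputs this rare given m carry at most a fraction β/16 of the weight of m, because μ sums
      -- to 1; their loss is small compared with the bias.
      Likely : X → Y → Transcript ms → Set
      Likely x y m = 2^ 4 * Q x y m ≤ β m * (qm m * μ x y)

      module _ (dichotomy : ∀ x y m → ¬ Q x y m ≈ 0# → Likely x y m ⊎ r x y m ≤ 2^ K * β m) where

        0≤β : ∀ m → 0# ≤ β m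
        0≤β m = ∣∣-nonNeg (bias m)

        ½⁴ : ℝ
        ½⁴ = ½ ^ 4

        likely⇒ : ∀ {x y m} → Likely x y m → Q x y m ≤ ½⁴ * (β m * (qm m * μ x y))
        likely⇒ {x} {y} {m} le = ≤-respˡ (trans (sym (*-assoc _ _ _)) (trans (*-congʳ (trans (*-comm _ _) (2^*½^ 4))) (*-identityˡ _)))
          (*-monoˡ-≤ ½⁴ (proj₁ (½^-pos 4)) le)

        0≤unlikely : ∀ x y m → 0# ≤ ½⁴ * (β m * (qm m * μ x y))
        0≤unlikely x y m = *-nonNeg (proj₁ (½^-pos 4)) (*-nonNeg (0≤β m) (*-nonNeg (0≤qm m) (0≤μ x y)))

        Σ-unlikely : ∀ m → whole (λ x y → ½⁴ * (β m * (qm m * μ x y))) ≈ ½⁴ * (β m * qm m)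
        Σ-unlikely m = trans (∑∑-cong λ x y → solve 4 (λ h b q u → h :* (b :* (q :* u)) := h :* (b :* q) :* u) refl ½⁴ (β m) (qm m) (μ x y))
          (trans (sym (∑∑-*ˡ (½⁴ * (β m * qm m)) μ)) (trans (*-congˡ ΣP) (*-identityʳ _)))

        entry≤ : ∀ x y m → Q x y m ≤ 2^ K * β m * P x y m + ½⁴ * (β m * (qm m * μ x y))
        entry≤ x y m with dec (Q x y m ≈ 0#)
        ... | yes Q≈0 = ≤-respˡ (sym Q≈0) (+-nonNeg (*-nonNeg (*-nonNeg (proj₁ (2^-pos K)) (0≤β m)) (0≤P x y m)) (0≤unlikely x y m))
        ... | no Q≉0 with dichotomy x y m Q≉0
        ... | inj₁ likely = ≤-trans (likely⇒ likely) (≤-via (*-nonNeg (*-nonNeg (proj₁ (2^-pos K)) (0≤β m)) (0≤P x y m)) (+-comm _ _))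
        ... | inj₂ r≤ = ≤-trans (≤-respˡ (rP≈Q x y m) (*-monoʳ-≤ _ (0≤P x y m) r≤)) (≤-via (0≤unlikely x y m) refl)

        D : ℝ
        D = 2^ (suc K)

        ½⁴≤½ : ½⁴ ≤ ½
        ½⁴≤½ = ≤-respʳ (*-identityʳ ½) (*-monoˡ-≤ ½ 0≤½ (½^≤1 3))

        -- Summing `entry≤` gives q ≤ 2^K β p + q/16; one half of q absorbs the last term, which
        -- doubles the constant to `D`.
        qm≤ : ∀ m → qm m ≤ D * β m * pm m
        qm≤ m = *-cancelˡ-≤ 0<½ (≤-via (+-nonNeg (0≤diff bound) (+-nonNeg (*-nonNeg (proj₁ (½^-pos 4)) (*-nonNeg (0≤qm m) (0≤diff (β≤1 m)))) (*-nonNeg (0≤qm m) (0≤diff ½⁴≤½))))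
          (trans (trans (solve 4 (λ h k b p → h :* (# 2 :* k :* b :* p) := # 2 :* h :* (k :* b :* p)) refl ½ (2^ K) (β m) (pm m)) (*-congʳ 2*½))
            (trans (solve 5 (λ z g b h q → # 1 :* z := (# 1 :- h) :* q :+ (z :+ g :* (b :* q) :- q :+ (g :* (q :* (# 1 :- b)) :+ q :* (h :- g)))) refl (2^ K * β m * pm m) ½⁴ (β m) ½ (qm m))
              (+-congʳ (*-congʳ (trans (+-congʳ (sym ½+½)) (solve 1 (λ h → h :+ h :- h := h) refl ½)))))))
          where
          bound : qm m ≤ 2^ K * β m * pm m + ½⁴ * (β m * qm m)
          bound = ≤-trans (∑∑-mono λ x y → entry≤ x y m)
            (≤-reflexive (trans (∑∑-+ _ _) (+-cong (sym (∑∑-*ˡ (2^ K * β m) λ x y → P x y m)) (Σ-unlikely m))))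

        τ : ℝ
        τ = ½ ^ suc K

        Dτ : D * τ ≈ 1#
        Dτ = 2^*½^ (suc K)

        -- (β - τ)² ≥ 0 with weight q/β ≤ D p.
        qβ≥ : ∀ m → fromℕ 2 * τ * qm m - τ * pm m ≤ qm m * β m
        qβ≥ m with dec (β m ≈ 0#)
        ... | yes β≈0 = ≤-trans (≤-via (*-nonNeg (proj₁ (½^-pos (suc K))) (0≤pm m)) (solve 3 (λ t q p → # 2 :* t :* q := # 2 :* t :* q :- t :* p :+ t :* p) refl τ (qm m) (pm m)))
          (≤-reflexive (trans (*-congˡ qm≈0) (trans (zeroʳ _) (sym (trans (*-congˡ β≈0) (zeroʳ _))))))
          where
          qm≈0 : qm m ≈ 0#
          qm≈0 = antisym (≤-respʳ (trans (*-congʳ (trans (*-congˡ β≈0) (zeroʳ D))) (zeroˡ _)) (qm≤ m)) (0≤qm m)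
        ... | no β≉0 = *-cancelˡ-≤ (nonNeg≉⇒> (0≤β m) β≉0)
          (≤-via (+-nonNeg (*-nonNeg (0≤qm m) (square-nonNeg (β m - τ))) (*-nonNeg (square-nonNeg τ) (0≤diff (qm≤ m))))
            (trans (solve 5 (λ b t q p d → b :* (q :* b) := b :* (# 2 :* t :* q) :- d :* t :* b :* t :* p :+ (q :* ((b :- t) :* (b :- t)) :+ t :* t :* (d :* b :* p :- q))) refl (β m) τ (qm m) (pm m) D)
              (+-congʳ (trans (+-congˡ (-‿cong (*-congʳ (*-congʳ (*-congʳ Dτ))))) (solve 4 (λ b t q p → b :* (# 2 :* t :* q) :- # 1 :* b :* t :* p := b :* (# 2 :* t :* q :- t :* p)) refl (β m) τ (qm m) (pm m))))))

        -- Cauchy-Schwarz in linear form: 1 = (Σ q)² ≤ Σ qβ · Σ q/β with q/β ≤ D p. The tangent at τ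
        -- = 1/D avoids the quotient, and Σ q = Σ p = 1 leaves 2τ - τ.
        Σqβ : τ ≤ ∑ᵀ ms λ m → qm m * β m
        Σqβ = ≤-respˡ lhs (∑ᵀ-mono ms qβ≥)
          where
          lhs : (∑ᵀ ms λ m → fromℕ 2 * τ * qm m - τ * pm m) ≈ τ
          lhs = trans (∑ᵀ-cong ms λ m → +-congˡ (-‿distribˡ-* τ (pm m)))
            (trans (∑ᵀ-+ ms _ _) (trans (+-cong (sym (*-∑ᵀ ms (fromℕ 2 * τ) qm)) (sym (*-∑ᵀ ms (- τ) pm)))
              (trans (+-cong (*-congˡ (trans (sym (ΣΣᵀ Q)) ΣQ)) (*-congˡ (trans (sym (ΣΣᵀ P)) ΣP))) (solve 1 (λ t → # 2 :* t :* # 1 :+ :- t :* # 1 := t) refl τ))))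

        Truncated : (k : ℕ) → ℝ → ℝ → ℝ → ℝ → Set
        Truncated k c ε pay r = (pay ≈ ε * (c * r)) ⊎ (pay ≈ 0# × (r ≤ ½ ^ k ⊎ 2^ (suc K) ≤ r))

        module _ (c : ℝ) (0≤c : 0# ≤ c) (pay : Transcript ms → Matrix)
          (spec : ∀ x y m → Truncated (3 ℕ.+ K) c (sgn (bias m)) (pay m x y) (r x y m)) where

          ½ᵏ : ℝ
          ½ᵏ = ½ ^ (3 ℕ.+ K)

          lost : Weights ms
          lost x y m = ½ᵏ * P x y m + ½⁴ * (β m * (qm m * μ x y))

          0≤½ᵏP : ∀ x y m → 0# ≤ ½ᵏ * P x y m
          0≤½ᵏP x y m = *-nonNeg (proj₁ (½^-pos (3 ℕ.+ K))) (0≤P x y m)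

          ideal : Weights ms
          ideal x y m = sgn (bias m) * (Q x y m * s x y)

          ideal≤Q : ∀ x y m → ideal x y m ≤ Q x y m
          ideal≤Q x y m = ≤-respˡ (solve 3 (λ q e s → q :* (e :* s) := e :* (q :* s)) refl (Q x y m) (sgn (bias m)) (s x y))
            (≤-respʳ (*-identityʳ _) (*-monoˡ-≤ _ (0≤Q x y m) (proj₁ (within-product (sgn-within (bias m)) (s≤1 x y)))))

          -- A small ratio is charged to P by Q = r P. A ratio of 2^(K+1) or more violates r ≤ 2^K β
          -- with β ≤ 1, so the entry is a rare one.
          truncated-Q≤ : ∀ x y m → r x y m ≤ ½ᵏ ⊎ 2^ (suc K) ≤ r x y m → Q x y m ≤ lost x y m
          truncated-Q≤ x y m (inj₁ r≤) = ≤-trans (≤-respˡ (rP≈Q x y m) (*-monoʳ-≤ _ (0≤P x y m) r≤)) (≤-via (0≤unlikely x y m) refl)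
          truncated-Q≤ x y m (inj₂ r≥) with dec (Q x y m ≈ 0#)
          ... | yes Q≈0 = ≤-respˡ (sym Q≈0) (+-nonNeg (0≤½ᵏP x y m) (0≤unlikely x y m))
          ... | no Q≉0 with dichotomy x y m Q≉0
          ... | inj₁ likely = ≤-trans (likely⇒ likely) (≤-via (0≤½ᵏP x y m) (+-comm _ _))
          ... | inj₂ r≤ = ⊥-elim (<⇒≱ (2^-pos K) (≤-via (+-nonNeg (0≤diff (≤-trans r≥ r≤)) (*-nonNeg (proj₁ (2^-pos K)) (0≤diff (β≤1 m))))
            (solve 2 (λ p b → # 0 := p :+ (p :* b :- # 2 :* p :+ p :* (# 1 :- b))) refl (2^ K) (β m))))

          entry-gain : ∀ x y m → c * (ideal x y m - lost x y m) ≤ P x y m * pay m x y * s x y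
          entry-gain x y m with spec x y m
          ... | inj₁ pay≈ = ≤-trans (*-monoˡ-≤ c 0≤c (≤-via (+-nonNeg (0≤½ᵏP x y m) (0≤unlikely x y m)) (solve 2 (λ i l → i := i :- l :+ l) refl (ideal x y m) (lost x y m))))
            (≤-reflexive (trans (*-congˡ (*-congˡ (*-congʳ (sym (rP≈Q x y m))))) (trans (solve 5 (λ c e r p s → c :* (e :* (r :* p :* s)) := p :* (e :* (c :* r)) :* s) refl c (sgn (bias m)) (r x y m) (P x y m) (s x y))
              (*-congʳ (*-congˡ (sym pay≈))))))
          ... | inj₂ (pay≈0 , out) = ≤-trans (*-monoˡ-≤ c 0≤c (≤-via (0≤diff (≤-trans (ideal≤Q x y m) (truncated-Q≤ x y m out))) (solve 2 (λ i l → # 0 := i :- l :+ (l :- i)) refl (ideal x y m) (lost x y m))))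
            (≤-reflexive (trans (zeroʳ c) (sym (trans (*-congʳ (trans (*-congˡ pay≈0) (zeroʳ _))) (zeroˡ _)))))

          Σ-ideal : ∀ m → whole (at ideal m) ≈ qm m * β m
          Σ-ideal m = trans (sym (∑∑-*ˡ (sgn (bias m)) _)) (trans (*-congˡ (sym (qm*bias m))) (trans (solve 3 (λ e q b → e :* (q :* b) := q :* (e :* b)) refl (sgn (bias m)) (qm m) (bias m)) (*-congˡ (sgn-* (bias m)))))

          round-gain : ∀ m → c * (qm m * β m - ½ᵏ * pm m - ½⁴ * (β m * qm m)) ≤ whole λ x y → P x y m * pay m x y * s x y
          round-gain m = ≤-respˡ (trans (sym (∑∑-*ˡ c _)) (*-congˡ (trans (∑∑-cong λ x y → solve 3 (λ i a b → i :- (a :+ b) := i :+ (:- # 1 :* a :+ :- # 1 :* b)) refl (ideal x y m) (½ᵏ * P x y m) (½⁴ * (β m * (qm m * μ x y))))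
              (trans (∑∑-+ _ _) (trans (+-cong (Σ-ideal m) (trans (∑∑-+ _ _) (+-cong (trans (sym (∑∑-*ˡ (- 1#) _)) (*-congˡ (sym (∑∑-*ˡ ½ᵏ λ x y → P x y m)))) (trans (sym (∑∑-*ˡ (- 1#) _)) (*-congˡ (Σ-unlikely m))))))
                (solve 3 (λ i a b → i :+ (:- # 1 :* a :+ :- # 1 :* b) := i :- a :- b) refl (qm m * β m) (½ᵏ * pm m) (½⁴ * (β m * qm m))))))))
            (∑∑-mono λ x y → entry-gain x y m)

          -- `Σqβ` provides τ; rare entries cost a sixteenth, and ratios too small to be paid cost
          -- ½ᵏ = τ/4.
          gain : c * (½ * τ) ≤ ∑ᵀ ms λ m → whole λ x y → P x y m * pay m x y * s x y
          gain = ≤-trans (*-monoˡ-≤ c 0≤c final) (≤-respˡ (sym (trans (*-congˡ sum≈) (*-∑ᵀ ms c _))) (∑ᵀ-mono ms round-gain))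
            where
            Z : ℝ
            Z = ∑ᵀ ms λ m → qm m * β m
            sum≈ : (1# - ½⁴) * Z - ½ᵏ ≈ ∑ᵀ ms λ m → qm m * β m - ½ᵏ * pm m - ½⁴ * (β m * qm m)
            sum≈ = sym (trans (∑ᵀ-cong ms λ m → solve 5 (λ q b k p h → q :* b :- k :* p :- h :* (b :* q) := (# 1 :- h) :* (q :* b) :+ :- k :* p) refl (qm m) (β m) ½ᵏ (pm m) ½⁴)
              (trans (∑ᵀ-+ ms _ _) (+-cong (sym (*-∑ᵀ ms (1# - ½⁴) _)) (trans (sym (*-∑ᵀ ms (- ½ᵏ) pm)) (trans (*-congˡ (trans (sym (ΣΣᵀ P)) ΣP)) (*-identityʳ _))))))
            ½ᵏ≈ : ½ᵏ ≈ ½ * ½ * τ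
            ½ᵏ≈ = sym (*-assoc _ _ _)
            -- 1 - 1/16 - 1/4 ≥ 1/2
            final : ½ * τ ≤ (1# - ½⁴) * Z - ½ᵏ
            final = ≤-via (+-nonNeg (*-nonNeg (0≤diff (≤-trans ½⁴≤½ ½≤1)) (0≤diff Σqβ)) (*-nonNeg (proj₁ (½^-pos (suc K))) (*-nonNeg (*-nonNeg 0≤½ 0≤½) (0≤diff (*-mono-≤ 0≤½ ½≤1 0≤½ ½≤1)))))
              (trans (+-congˡ (-‿cong ½ᵏ≈)) (trans (solve 4 (λ h g z t → (# 1 :- g) :* z :- h :* h :* t := (# 1 :- g :- h :* h) :* t :+ (# 1 :- g) :* (z :- t)) refl ½ ½⁴ Z τ)
                (trans (+-congʳ (trans (*-congʳ lemma) (solve 3 (λ h t o → (h :+ h :* h :* (o :* o :- h :* h)) :* t := h :* t :+ t :* (h :* h :* (o :* o :- h :* h))) refl ½ τ 1#)))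
                  (solve 3 (λ a b c → a :+ b :+ c := a :+ (c :+ b)) refl (½ * τ) (τ * (½ * ½ * (1# * 1# - ½ * ½))) ((1# - ½⁴) * (Z - τ))))))
              where
              lemma : 1# - ½⁴ - ½ * ½ ≈ ½ + ½ * ½ * (1# * 1# - ½ * ½)
              lemma = trans (sym (+-zero (diff≈0 (½ + 1#) 2*½)))
                (solve 1 (λ h → # 1 :- h :* (h :* (h :* (h :* # 1))) :- h :* h :+ (h :+ # 1) :* (# 2 :* h :- # 1) := h :+ h :* h :* (# 1 :* # 1 :- h :* h)) refl ½)

  -- Suprema and infima in the extended reals

  ≤∞-trans : ∀ {d e f} → d ≤∞ e → e ≤∞ f → d ≤∞ f
  ≤∞-trans -∞≤ _ = -∞≤
  ≤∞-trans _ ≤+∞ = ≤+∞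
  ≤∞-trans [ x≤y ]≤ [ y≤z ]≤ = [ ≤-trans x≤y y≤z ]≤

  ⨆-least : ∀ {J : Set} {F : J → ℝ∞} {u} → (∀ j → F j ≤∞ [ u ]) → ⨆ F ≤∞ [ u ]
  ⨆-least {F = F} {u} F≤u with em {∃ λ u → ∀ j → F j ≤∞ [ u ]} | em {∃ λ j → ∃ λ x → F j ≡ [ x ]}
  ... | no unbounded | _ = ⊥-elim (unbounded (u , F≤u))
  ... | yes _ | no _ = -∞≤
  ... | yes _ | yes (j , x , Fj≡x) = [ sup-least (x , j , Fj≡x) (u , upper) upper ]≤
    where
    upper : ∀ {y} → (∃ λ j → F j ≡ [ y ]) → y ≤ u
    upper {y} (j , Fj≡y) with F j | F≤u j
    upper (j , ≡.refl) | _ | [ y≤u ]≤ = y≤u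

  ⨆-upper : ∀ {J : Set} (F : J → ℝ∞) j → F j ≤∞ ⨆ F
  ⨆-upper F j with em {∃ λ u → ∀ j → F j ≤∞ [ u ]} | em {∃ λ j → ∃ λ x → F j ≡ [ x ]}
  ... | no _ | _ = ≤+∞
  ... | yes (u , F≤u) | no none = below (F j) ≡.refl (F≤u j)
    where
    below : ∀ e → F j ≡ e → e ≤∞ [ u ] → e ≤∞ -∞
    below -∞ _ _ = -∞≤
    below +∞ _ ()
    below [ x ] Fj≡x _ = ⊥-elim (none (j , x , Fj≡x))
  ... | yes (u , F≤u) | yes some = below (F j) ≡.refl (F≤u j)
    where
    upper : ∀ {y} → (∃ λ j → F j ≡ [ y ]) → y ≤ u
    upper {y} (j , Fj≡y) with F j | F≤u j
    upper (j , ≡.refl) | _ | [ y≤u ]≤ = y≤u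
    below : ∀ e → F j ≡ e → e ≤∞ [ u ] → e ≤∞ [ sup (λ x → ∃ λ j → F j ≡ [ x ]) ]
    below -∞ _ _ = -∞≤
    below +∞ _ ()
    below [ x ] Fj≡x _ = [ sup-upper (let i , z , eq = some in z , i , eq) (u , upper) (j , Fj≡x) ]≤

  -- The infimum need not be attained, so a strictly larger bound is conceded; this is why `κ` is α
  -- + 1.
  ⨅-near : ∀ {J : Set} (F : J → ℝ∞) {z z′} → z < z′ → ⨅ F ≤∞ [ z ] → ∃ λ j → F j ≤∞ [ z′ ]
  ⨅-near F {z} {z′} z<z′ ⨅≤z with dec (∃ λ j → F j ≤∞ [ z′ ])
  ... | yes p = p
  ... | no none = ⊥-elim (contradictory (⨆ λ j → neg (F j)) (⨆-least λ j → neg≤ (F j) λ F≤ → none (j , F≤)) ⨅≤z)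
    where
    neg≤ : ∀ e → ¬ e ≤∞ [ z′ ] → neg e ≤∞ [ - z′ ]
    neg≤ -∞ ≰ = ⊥-elim (≰ -∞≤)
    neg≤ +∞ ≰ = -∞≤
    neg≤ [ x ] ≰ = [ neg-mono-≤ (≰⇒≥ λ x≤z′ → ≰ [ x≤z′ ]≤) ]≤
    contradictory : ∀ e → e ≤∞ [ - z′ ] → neg e ≤∞ [ z ] → ⊥
    contradictory -∞ _ ()
    contradictory [ x ] [ x≤-z′ ]≤ [ -x≤z ]≤ = <⇒≱ z<z′ (≤-trans (≤-respˡ (-‿involutive z′) (neg-mono-≤ x≤-z′)) -x≤z)

  ∣∣-cong : ∀ {x y} → x ≈ y → ∣ x ∣ ≈ ∣ y ∣
  ∣∣-cong {x} {y} x≈y with total 0# x | total 0# y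
  ... | inj₁ _ | inj₁ _ = x≈y
  ... | inj₂ _ | inj₂ _ = -‿cong x≈y
  ... | inj₁ 0≤x | inj₂ y≤0 = trans (antisym (≤-respˡ (sym x≈y) y≤0) 0≤x) (sym (trans (-‿cong (antisym y≤0 (≤-respʳ x≈y 0≤x))) -0#≈0#))
  ... | inj₂ x≤0 | inj₁ 0≤y = trans (trans (-‿cong (antisym x≤0 (≤-respʳ (sym x≈y) 0≤y))) -0#≈0#) (sym (antisym (≤-respˡ x≈y x≤0) 0≤y))

  opposite-nonNeg : ∀ {z w Q} → z ≈ - w → Q ≈ w → 0# ≤ Q → 0# ≤ z → z ≈ Q
  opposite-nonNeg z≈ Q≈ 0≤Q 0≤z = antisym (≤-trans (≤-respˡ (sym (trans z≈ (-‿cong (sym Q≈)))) (neg-nonPos 0≤Q)) 0≤Q)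
    (≤-trans (≤-respˡ (trans (-‿cong z≈) (trans (-‿involutive _) (sym Q≈))) (neg-nonPos 0≤z)) 0≤z)

  -- The factors of a rectangular distribution may be negative. With opposite signs, Q and its
  -- negative are both nonnegative, hence 0; absolute values are therefore admissible throughout.
  ∣∣*∣∣ : ∀ {μ Q} A B → 0# ≤ μ → 0# ≤ Q → Q ≈ μ * A * B → μ * (∣ A ∣ * ∣ B ∣) ≈ Q
  ∣∣*∣∣ {μ} {Q} A B 0≤μ 0≤Q Q≈ with total 0# A | total 0# B
  ... | inj₁ _ | inj₁ _ = trans (sym (*-assoc _ _ _)) (sym Q≈)
  ... | inj₂ _ | inj₂ _ = trans (solve 3 (λ m a b → m :* (:- a :* :- b) := m :* a :* b) refl μ A B) (sym Q≈)
  ... | inj₁ 0≤A | inj₂ B≤0 = opposite-nonNeg (solve 3 (λ m a b → m :* (a :* :- b) := :- (m :* a :* b)) refl μ A B) Q≈ 0≤Q (*-nonNeg 0≤μ (*-nonNeg 0≤A (nonPos-neg B≤0)))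
  ... | inj₂ A≤0 | inj₁ 0≤B = opposite-nonNeg (solve 3 (λ m a b → m :* (:- a :* b) := :- (m :* a :* b)) refl μ A B) Q≈ 0≤Q (*-nonNeg 0≤μ (*-nonNeg (nonPos-neg A≤0) 0≤B))

  -- Likelihood ratio and conditional density of a rectangular distribution of small cost

  module Extraction (nx ny : ℕ) {C : ℕ} (k₀ : ℕ) (ks : Vec ℕ C) (p : Joint.Ω nx ny (k₀ ∷ ks) → ℝ)
    (isP : Joint.IsProtocolDistribution nx ny (k₀ ∷ ks) p) (f : Fin nx → Fin ny → Bit) {I α : ℝ} (1≤I : 1# ≤ I) where

    open ProtocolFactors nx ny k₀ ks p public
    module G = Gain nx ny (k₀ ∷ ks)

    κ : ℝ
    κ = α + 1#

    s : Matrix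
    s x y = sign (toℕ (f x y))

    s≤1 : ∀ x y → s x y within 1#
    s≤1 x y = sign-within (toℕ (f x y))

    0≤P : ∀ x y m → 0# ≤ P x y m
    0≤P x y m = J.IsJointDistribution.nonNeg (J.IsProtocolDistribution.isJointDistribution isP) (x , y , m)

    ΣP : whole (mass P) ≈ 1#
    ΣP = trans (sym (sumΩ≈ p)) (J.IsJointDistribution.sums-to1 (J.IsProtocolDistribution.isJointDistribution isP))

    module _ (q : J.Ω → ℝ) (isQ : J.IsJointDistribution q) (A : X → J.M → ℝ) (B : Y → J.M → ℝ)
      (rect : ∀ x y m → q (x , y , m) ≈ J.Prxy p x y * A x m * B y m)
      (finite : ∀ ω → ¬ q ω ≈ 0# → J.logCost I p f q ω ≤∞ [ κ * I ]) where

      Q : Weights (k₀ ∷ ks)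
      Q x y m = q (x , y , m)

      0≤Q : ∀ x y m → 0# ≤ Q x y m
      0≤Q x y m = J.IsJointDistribution.nonNeg isQ (x , y , m)

      ΣQ : whole (mass Q) ≈ 1#
      ΣQ = trans (sym (sumΩ≈ q)) (J.IsJointDistribution.sums-to1 isQ)

      0≤μ : ∀ x y → 0# ≤ μ x y
      0≤μ x y = ∑ᵀ-nonNeg (k₀ ∷ ks) (0≤P x y)

      E : ℝ
      E = fromℕ 12 * I / J.δ

      E≈ : E ≈ fromℕ 180 * I
      E≈ = trans (*-congˡ δ⁻¹) (solve 1 (λ i → # 12 :* i :* # 15 := # 180 :* i) refl I)
        where
        0<15 : ¬ fromℕ 15 ≈ 0#
        0<15 = >⇒≉ (fromℕ-pos 14)
        δ⁻¹ : J.δ ⁻¹ ≈ fromℕ 15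
        δ⁻¹ = *-cancelˡ (*-nonZero (>⇒≉ 0<1) (⁻¹-nonZero 0<15)) (trans (*-inverseʳ (*-nonZero (>⇒≉ 0<1) (⁻¹-nonZero 0<15)))
          (sym (trans (*-congʳ (*-identityˡ _)) (x⁻¹*x≈1 0<15))))

      cost-at : ∀ x y m → ¬ Q x y m ≈ 0# → ¬ (J.Prxy p x y ≈ 0# ⊎ P x y m ≈ 0# ⊎ J.bias f q m ≈ 0#)
        × log₂ (J.cond q (x , y , m) / J.Prxy p x y * (Q x y m / P x y m) ^ʳ I * ∣ J.bias f q m ∣ ^ʳ (- E)) ≤ κ * I
      cost-at x y m Q≉0 with em {J.Prxy p x y ≈ 0# ⊎ P x y m ≈ 0# ⊎ J.bias f q m ≈ 0#} | finite (x , y , m) Q≉0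
      ... | no ok | [ le ]≤ = ok , le

      P-zero⇒Q-zero : ∀ {x y m} → P x y m ≈ 0# → Q x y m ≈ 0#
      P-zero⇒Q-zero {x} {y} {m} P≈0 with dec (Q x y m ≈ 0#)
      ... | yes Q≈0 = Q≈0
      ... | no Q≉0 = ⊥-elim (proj₁ (cost-at x y m Q≉0) (inj₂ (inj₁ P≈0)))

      PA : X → J.M → ℝ
      PA x (i ∷ m) = ownFactors ks aliceSide aliceSide (fix i P) x m

      PB : Y → J.M → ℝ
      PB y (i ∷ m) = whole (mass (fix i P)) * ownFactors ks bobSide aliceSide (fix i P) y m

      P≈ : ∀ x y m → P x y m ≈ μ x y * (PA x m * PB y m)
      P≈ x y (i ∷ m) = trans (factorization isP x y i m) (trans (*-congˡ (factors-split ks aliceSide (fix i P) x y m))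
        (solve 4 (λ u w a b → u :* w :* (a :* b) := u :* (a :* (w :* b))) refl _ _ _ _))

      0≤fix : ∀ i x y m → 0# ≤ fix i P x y m
      0≤fix i x y m = 0≤P x y (i ∷ m)

      ownFactors-nonNeg : ∀ {n} (ks : Vec ℕ n) t s (R : Weights ks) → (∀ x y m → 0# ≤ R x y m) → ∀ z m → 0# ≤ ownFactors ks t s R z m
      ownFactors-nonNeg [] t s R 0≤R z [] = 0≤1
      ownFactors-nonNeg (k ∷ ks) aliceSide aliceSide R 0≤R z (i ∷ m) = *-nonNeg
        (/-nonNeg (given-nonNeg aliceSide (λ x y → ∑ᵀ-nonNeg ks λ m → 0≤R x y (i ∷ m)) z) (given-nonNeg aliceSide (λ x y → ∑ᵀ-nonNeg (k ∷ ks) (0≤R x y)) z))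
        (ownFactors-nonNeg ks aliceSide bobSide (fix i R) (λ x y m → 0≤R x y (i ∷ m)) z m)
      ownFactors-nonNeg (k ∷ ks) bobSide bobSide R 0≤R z (i ∷ m) = *-nonNeg
        (/-nonNeg (given-nonNeg bobSide (λ x y → ∑ᵀ-nonNeg ks λ m → 0≤R x y (i ∷ m)) z) (given-nonNeg bobSide (λ x y → ∑ᵀ-nonNeg (k ∷ ks) (0≤R x y)) z))
        (ownFactors-nonNeg ks bobSide aliceSide (fix i R) (λ x y m → 0≤R x y (i ∷ m)) z m)
      ownFactors-nonNeg (k ∷ ks) aliceSide bobSide R 0≤R z (i ∷ m) = ownFactors-nonNeg ks aliceSide aliceSide (fix i R) (λ x y m → 0≤R x y (i ∷ m)) z m
      ownFactors-nonNeg (k ∷ ks) bobSide aliceSide R 0≤R z (i ∷ m) = ownFactors-nonNeg ks bobSide bobSide (fix i R) (λ x y m → 0≤R x y (i ∷ m)) z m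

      0≤PA : ∀ x m → 0# ≤ PA x m
      0≤PA x (i ∷ m) = ownFactors-nonNeg ks aliceSide aliceSide (fix i P) (0≤fix i) x m

      0≤PB : ∀ y m → 0# ≤ PB y m
      0≤PB y (i ∷ m) = *-nonNeg (whole-nonNeg λ x y → ∑ᵀ-nonNeg ks (0≤fix i x y)) (ownFactors-nonNeg ks bobSide aliceSide (fix i P) (0≤fix i) y m)

      -- Both distributions contain the factor μ, so q/p is the product of `a` and `b`. Where a
      -- denominator vanishes so does p, and then q because the cost is finite.
      a : J.M → X → ℝ
      a m x = ∣ A x m ∣ / PA x m

      b : J.M → Y → ℝ
      b m y = ∣ B y m ∣ / PB y m

      0≤a : ∀ m x → 0# ≤ a m x
      0≤a m x = /-nonNeg (∣∣-nonNeg _) (0≤PA x m)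

      0≤b : ∀ m y → 0# ≤ b m y
      0≤b m y = /-nonNeg (∣∣-nonNeg _) (0≤PB y m)

      r : Weights (k₀ ∷ ks)
      r x y m = a m x * b m y

      rP≈Q : ∀ x y m → r x y m * P x y m ≈ Q x y m
      rP≈Q x y m with dec (P x y m ≈ 0#)
      ... | yes P≈0 = trans (*-congˡ P≈0) (trans (zeroʳ _) (sym (P-zero⇒Q-zero P≈0)))
      ... | no P≉0 = trans (*-congˡ (P≈ x y m)) (trans (solve 7 (λ A i B j u p q → A :* i :* (B :* j) :* (u :* (p :* q)) := u :* (A :* i :* p :* (B :* j :* q))) refl (∣ A x m ∣) (PA x m ⁻¹) (∣ B y m ∣) (PB y m ⁻¹) (μ x y) (PA x m) (PB y m))
        (trans (*-congˡ (*-cong (/-cancel PA≉0) (/-cancel PB≉0)))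
          (∣∣*∣∣ (A x m) (B y m) (0≤μ x y) (0≤Q x y m) (trans (rect x y m) (*-congʳ (*-congʳ (Prxy≈μ x y)))))))
        where
        PA≉0 : ¬ PA x m ≈ 0#
        PA≉0 PA≈0 = P≉0 (trans (P≈ x y m) (trans (*-congˡ (trans (*-congʳ PA≈0) (zeroˡ _))) (zeroʳ _)))
        PB≉0 : ¬ PB y m ≈ 0#
        PB≉0 PB≈0 = P≉0 (trans (P≈ x y m) (trans (*-congˡ (trans (*-congˡ PB≈0) (zeroʳ _))) (zeroʳ _)))

      -- The convention 0⁻¹ = 0 makes the ratio, and with it the payoff, vanish on impossible
      -- transcripts, as `Supported` demands.
      r-zero : ∀ x y i m → factors ks aliceSide (fix i P) x y m ≈ 0# → r x y (i ∷ m) ≈ 0#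
      r-zero x y i m F≈0 with dec (ownFactors ks aliceSide aliceSide (fix i P) x m ≈ 0#)
      ... | yes fA≈0 = trans (*-congʳ (trans (*-congˡ (⁻¹-zero fA≈0)) (zeroʳ _))) (zeroˡ _)
      ... | no fA≉0 = trans (*-congˡ (trans (*-congˡ (⁻¹-zero (trans (*-congˡ (integral (trans (sym (factors-split ks aliceSide (fix i P) x y m)) F≈0) fA≉0)) (zeroʳ _)))) (zeroʳ _))) (zeroʳ _)

      q̂ : J.M → ℝ
      q̂ = G.Correlation.qm P Q 0≤P 0≤Q ΣP ΣQ s s≤1 r rP≈Q 0

      β̂ : J.M → ℝ
      β̂ = G.Correlation.β P Q 0≤P 0≤Q ΣP ΣQ s s≤1 r rP≈Q 0

      Prm≈q̂ : ∀ m → J.Prm q m ≈ q̂ m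
      Prm≈q̂ m = trans (sum≈∑ _) (∑-cong λ x → sum≈∑ _)

      bias≈β̂ : ∀ m → ∣ J.bias f q m ∣ ≈ β̂ m
      bias≈β̂ m = ∣∣-cong (trans (trans (sum≈∑ _) (∑-cong λ x → sum≈∑ _)) (∑∑-cong λ x y → *-congʳ (/-cong refl (Prm≈q̂ m))))

      module AtSupport (x : X) (y : Y) (m : J.M) (Q≉0 : ¬ Q x y m ≈ 0#) where

        0<Q : 0# < Q x y m
        0<Q = nonNeg≉⇒> (0≤Q x y m) Q≉0

        0<q̂ : 0# < q̂ m
        0<q̂ = G.Correlation.Q≉0⇒qm>0 P Q 0≤P 0≤Q ΣP ΣQ s s≤1 r rP≈Q 0 Q≉0

        0<P : 0# < P x y m
        0<P = nonNeg≉⇒> (0≤P x y m) λ P≈0 → proj₁ (cost-at x y m Q≉0) (inj₂ (inj₁ P≈0))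

        0<μ : 0# < μ x y
        0<μ = nonNeg≉⇒> (0≤μ x y) λ μ≈0 → proj₁ (cost-at x y m Q≉0) (inj₁ (trans (Prxy≈μ x y) μ≈0))

        c ĉ r̂ : ℝ
        c = J.cond q (x , y , m) / J.Prxy p x y
        ĉ = Q x y m / q̂ m / μ x y
        r̂ = Q x y m / P x y m

        c≈ĉ : c ≈ ĉ
        c≈ĉ = /-cong (/-cong refl (Prm≈q̂ m)) (Prxy≈μ x y)

        r̂≈r : r̂ ≈ r x y m
        r̂≈r = sym (/-unique (>⇒≉ 0<P) (rP≈Q x y m))

        0<c : 0# < c
        0<c = <-respʳ (sym c≈ĉ) (*-pos (*-pos 0<Q (⁻¹-pos 0<q̂)) (⁻¹-pos 0<μ))

        0<r̂ : 0# < r̂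
        0<r̂ = *-pos 0<Q (⁻¹-pos 0<P)

        0<bias : 0# < ∣ J.bias f q m ∣
        0<bias = nonNeg≉⇒> (∣∣-nonNeg _) λ b≈0 → proj₁ (cost-at x y m Q≉0) (inj₂ (inj₂ (∣∣-zero b≈0)))

        bias≤1 : ∣ J.bias f q m ∣ ≤ 1#
        bias≤1 = ≤-respˡ (sym (bias≈β̂ m)) (G.Correlation.β≤1 P Q 0≤P 0≤Q ΣP ΣQ s s≤1 r rP≈Q 0 m)

        log-cost : log₂ c + I * log₂ r̂ + - E * log₂ ∣ J.bias f q m ∣ ≤ κ * I
        log-cost = ≤-trans (+-mono-≤ (≤-trans (+-monoʳ-≤ _ (log-^ʳ I)) (log-super 0<c (exp-pos _))) (log-^ʳ (- E)))
          (≤-trans (log-super (*-pos 0<c (exp-pos _)) (exp-pos _)) (proj₂ (cost-at x y m Q≉0)))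

        open CostBounds 1≤I 0<c 0<r̂ 0<bias bias≤1 E≈ log-cost

        ĉ*q̂*μ : ĉ * (q̂ m * μ x y) ≈ Q x y m
        ĉ*q̂*μ = trans (solve 5 (λ z i j q u → z :* i :* j :* (q :* u) := z :* (q :* i) :* (u :* j)) refl (Q x y m) (q̂ m ⁻¹) (μ x y ⁻¹) (q̂ m) (μ x y))
          (trans (*-cong (*-congˡ (*-inverseʳ (>⇒≉ 0<q̂))) (*-inverseʳ (>⇒≉ 0<μ))) (solve 1 (λ z → z :* # 1 :* # 1 := z) refl (Q x y m)))

        -- If the first alternative fails, β̂ is at most 16 q(xy|m)/p(xy), which is the hypothesis
        -- of `ratio≤`.
        dichotomy : ∀ K₀ → κ + fromℕ 4 ≤ fromℕ K₀ → 2^ 4 * Q x y m ≤ β̂ m * (q̂ m * μ x y) ⊎ r x y m ≤ 2^ (suc K₀) * β̂ m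
        dichotomy K₀ κ≤ with total (2^ 4 * Q x y m) (β̂ m * (q̂ m * μ x y))
        ... | inj₁ likely = inj₁ likely
        ... | inj₂ unlikely = inj₂ (≤-respˡ r̂≈r (≤-respʳ (*-congˡ (bias≈β̂ m)) (ratio≤ K₀ κ≤
            (≤-respˡ (sym (bias≈β̂ m)) (≤-respʳ (*-congˡ (sym c≈ĉ)) (*-cancelʳ-≤ (*-pos 0<q̂ 0<μ) (≤-respʳ (sym (trans (*-assoc _ _ _) (*-congˡ ĉ*q̂*μ))) unlikely)))))))

        -- Payoffs vanish for ratios below the window, so the density has to be bounded only for
        -- ratios of at least ½^k.
        Q≤ : ∀ k M → (κ + fromℕ k) * I ≤ fromℕ M → ½ ^ k ≤ r x y m → Q x y m ≤ 2^ (suc M) * (q̂ m * μ x y)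
        Q≤ k M M≥ ½ᵏ≤r = ≤-respˡ ĉ*q̂*μ (*-monoʳ-≤ _ (*-nonNeg (proj₁ 0<q̂) (proj₁ 0<μ))
          (≤-respˡ c≈ĉ (conditional≤ k M M≥ (≤-respʳ (sym r̂≈r) ½ᵏ≤r))))

  -- The compressed protocol

  module NatSolver = NatSolvers.+-*-Solver

  cost≡ : ∀ nx ny T₀ ℓ J → PriorTrees.cost nx ny T₀ ℓ J ≡ T₀ ℕ.+ J ℕ.* (ℓ ℕ.+ (ℓ ℕ.+ 2))
  cost≡ nx ny T₀ ℓ zero = ≡.sym (ℕ.+-identityʳ T₀)
  cost≡ nx ny T₀ ℓ (suc J) = ≡.trans (≡.cong (λ c → ℓ ℕ.+ (ℓ ℕ.+ (2 ℕ.+ c))) (cost≡ nx ny T₀ ℓ J))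
    (NatSolver.solve 3 (λ t l z → l NatSolver.:+ (l NatSolver.:+ (NatSolver.con 2 NatSolver.:+ (t NatSolver.:+ z)))
      NatSolver.:= t NatSolver.:+ ((l NatSolver.:+ (l NatSolver.:+ NatSolver.con 2)) NatSolver.:+ z)) ≡.refl T₀ ℓ (J ℕ.* (ℓ ℕ.+ (ℓ ℕ.+ 2))))

  ≤½^ : ∀ {z} k → z * 2^ k ≤ 1# → z ≤ ½ ^ k
  ≤½^ k le = *-cancelʳ-≤ (2^-pos k) (≤-respʳ (sym (trans (*-comm _ _) (2^*½^ k))) le)

  halving : ∀ n → fromℕ n * rate ≈ 1# → ρ ^ n ≤ ½ ^ 1
  halving n eq = ≤½^ 1 (≤-trans (*-monoˡ-≤ _ (^-nonNeg n 0≤ρ) (≤-reflexive (trans (solve 0 (# 2 :* # 1 := # 1 :+ # 1) refl) (+-congˡ (sym eq))))) (decay n 0≤rate rate≤1))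

  -- Opaque, so that 768 attempts are never unfolded.
  opaque

    attemptRate : ℕ
    attemptRate = 768

    rounds : ℕ → ℕ
    rounds t = attemptRate ℕ.* t

    rounds≡ : ∀ t → rounds t ≡ attemptRate ℕ.* t
    rounds≡ t = ≡.refl

    ρ^rounds : ∀ t → ρ ^ rounds t ≤ ½ ^ t
    ρ^rounds t = ≤-respˡ (^-assocʳ ρ 768 t) (≤-trans (^-mono-≤ t (^-nonNeg 768 0≤ρ) (halving 768 768*rate))
      (≤-reflexive (trans (^-assocʳ ½ 1 t) (reflexive (≡.cong (½ ^_) (ℕ.*-identityˡ t))))))

    trials : ℕ → ℕ
    trials a = 2 ℕ.^ a

    fromℕ-trials : ∀ a → fromℕ (trials a) ≈ 2^ a
    fromℕ-trials = fromℕ-2^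

    trials≤ : ∀ a → suc (trials a ℕ.* 2) ℕ.≤ 2 ℕ.^ (2 ℕ.+ a)
    trials≤ a = ℕ.≤-trans (ℕ.+-monoˡ-≤ (2 ℕ.^ a ℕ.* 2) (ℕ.≤-trans (ℕ.m^n>0 2 a) (ℕ.m≤m*n (2 ℕ.^ a) 2)))
      (ℕ.≤-reflexive (NatSolver.solve 1 (λ z → z NatSolver.:* NatSolver.con 2 NatSolver.:+ z NatSolver.:* NatSolver.con 2
        NatSolver.:= NatSolver.con 2 NatSolver.:* (NatSolver.con 2 NatSolver.:* z)) ≡.refl (2 ℕ.^ a)))

  ½^*2^ : ∀ a b → ½ ^ (a ℕ.+ b) * 2^ a ≈ ½ ^ b
  ½^*2^ a b = trans (*-congʳ (^-homo-* ½ a b)) (trans (solve 3 (λ h g p → h :* g :* p := p :* h :* g) refl (½ ^ a) (½ ^ b) (2^ a)) (trans (*-congʳ (2^*½^ a)) (*-identityˡ _)))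

  module Assembly (nx ny k₀ k₁ : ℕ) {n : ℕ} (bits : Vec ℕ n) (bs : VecAll (_≡ 2) bits)
    (p : Joint.Ω nx ny (k₀ ∷ k₁ ∷ bits) → ℝ) (isP : Joint.IsProtocolDistribution nx ny (k₀ ∷ k₁ ∷ bits) p)
    (f : Fin nx → Fin ny → Bit) {I α : ℝ} (1≤I : 1# ≤ I)
    (K₀ : ℕ) (κ≤K₀ : α + 1# + fromℕ 4 ≤ fromℕ K₀) (N : ℕ) (I≤N : I ≤ fromℕ N) (k : ℕ) (n<2^k : suc n ℕ.< 2 ℕ.^ k) where

    open Extraction nx ny k₀ (k₁ ∷ bits) p isP f {I} {α} 1≤I renaming (a to aᴿ; b to bᴿ)
    open Payoffs nx ny using (Payoff; payoff)
    module FR = FirstRound nx ny k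

    -- The exact payoff gains c · ½ · ½^(K+1) = ½^Γ, and each of three errors is to be at most
    -- ½^(2+Γ). `M` bounds (κ + 4 + K) I. In `b`, the summand M + 1 comes from `Q≤`, K + 1 from
    -- `qm≤`, and 1 from smoothing. The choice of `t` brings 2^b ρ^J and 2^b/2^e down to ½^(2+Γ).
    -- The tree has height at most n (k + 1) < 2^k · 2^k, hence `ℓ`. The expected number of
    -- successful trials is 2^(2+Γ).
    K Γ M b t e ℓ J ℓ′ trialCount : ℕ
    K = suc K₀
    Γ = (3 ℕ.+ K) ℕ.+ (2 ℕ.+ K)
    M = (K₀ ℕ.+ (4 ℕ.+ K)) ℕ.* N
    b = suc (suc M ℕ.+ suc K)
    t = b ℕ.+ (2 ℕ.+ Γ)
    e = t
    ℓ = k ℕ.+ k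
    J = rounds t
    trialCount = trials (suc (e ℕ.+ e) ℕ.+ (2 ℕ.+ Γ))
    ℓ′ = 2 ℕ.+ (suc (e ℕ.+ e) ℕ.+ (2 ℕ.+ Γ))

    B c γ : ℝ
    B = 2^ b
    c = ½ ^ (3 ℕ.+ K)
    γ = ½ ^ suc (e ℕ.+ e)

    M≥ : (κ + fromℕ (4 ℕ.+ K)) * I ≤ fromℕ M
    M≥ = ≤-respʳ (sym (fromℕ-homo-* (K₀ ℕ.+ (4 ℕ.+ K)) N)) (scale-≤ {v = K₀ ℕ.+ (4 ℕ.+ K)}
      (≤-respʳ (sym (fromℕ-homo-+ K₀ (4 ℕ.+ K))) (+-monoˡ-≤ _ (≤-trans (≤-via (fromℕ-nonNeg 4) refl) κ≤K₀))))
      where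
      scale-≤ : ∀ {u v} → u ≤ fromℕ v → u * I ≤ fromℕ v * fromℕ N
      scale-≤ {u} {v} u≤v = ≤-trans (*-monoʳ-≤ I (≤-trans 0≤1 1≤I) u≤v) (*-monoˡ-≤ (fromℕ v) (fromℕ-nonNeg v) I≤N)

    module _ (q : J.Ω → ℝ) (isQ : J.IsJointDistribution q) (A : X → J.M → ℝ) (B′ : Y → J.M → ℝ)
      (rect : ∀ x y m → q (x , y , m) ≈ J.Prxy p x y * A x m * B′ y m)
      (finite : ∀ ω → ¬ q ω ≈ 0# → J.logCost I p f q ω ≤∞ [ κ * I ]) where

      module Support = AtSupport q isQ A B′ rect finite

      Q′ r′ : Weights (k₀ ∷ k₁ ∷ bits)
      Q′ = Q q isQ A B′ rect finite
      r′ = r q isQ A B′ rect finite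

      0≤Q′ : ∀ x y m → 0# ≤ Q′ x y m
      0≤Q′ = 0≤Q q isQ A B′ rect finite

      ΣQ′ : whole (mass Q′) ≈ 1#
      ΣQ′ = ΣQ q isQ A B′ rect finite

      rP : ∀ x y m → r′ x y m * P x y m ≈ Q′ x y m
      rP = rP≈Q q isQ A B′ rect finite

      module GQ = G.Correlation P Q′ 0≤P 0≤Q′ ΣP ΣQ′ s s≤1 r′ rP K

      dich : ∀ x y m → ¬ Q′ x y m ≈ 0# → GQ.Likely x y m ⊎ r′ x y m ≤ 2^ K * GQ.β m
      dich x y m Q≉0 = Support.dichotomy x y m Q≉0 K₀ κ≤K₀

      po : ∀ m → Payoff (3 ℕ.+ K) (suc K) (sgn (GQ.bias m)) (λ x y → r′ x y m)
      po m = payoff (3 ℕ.+ K) (suc K) (aᴿ q isQ A B′ rect finite m) (bᴿ q isQ A B′ rect finite m) (sgn-within (GQ.bias m))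
        (0≤a q isQ A B′ rect finite m) (0≤b q isQ A B′ rect finite m)

      pay : J.M → Matrix
      pay m = Payoff.pay (po m)

      total-gain : c * (½ * ½ ^ suc K) ≤ ∑ᵀ (k₀ ∷ k₁ ∷ bits) λ m → whole λ x y → P x y m * pay m x y * s x y
      total-gain = GQ.gain dich c (proj₁ (½^-pos (3 ℕ.+ K))) pay truncated
        where
        truncated : ∀ x y m → GQ.Truncated dich (3 ℕ.+ K) c (sgn (GQ.bias m)) (pay m x y) (r′ x y m)
        truncated x y m = map₁ proj₁ (Payoff.spec (po m) x y)

      pay-zero : ∀ {x y m} → r′ x y m ≈ 0# → pay m x y ≈ 0#
      pay-zero {x} {y} {m} r≈0 = [ (λ (pay≈ , _) → trans pay≈ (trans (*-congˡ (trans (*-congˡ r≈0) (zeroʳ _))) (zeroʳ _))) , proj₁ ]′ (Payoff.spec (po m) x y)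

      0≤retained : 0# ≤ (1# - ½ ^ suc k) ^ n - ½
      0≤retained = 0≤diff (≤-trans (≤-via (0≤diff nη≤½) (trans (+-congʳ (sym ½+½)) (solve 2 (λ h m → h :+ h :- m := h :+ (h :- m)) refl ½ (fromℕ n * ½ ^ suc k)))) (bernoulli⁻ n (proj₁ (½^-pos (suc k))) (½^≤1 (suc k))))
        where
        nη≤½ : fromℕ n * ½ ^ suc k ≤ ½
        nη≤½ = ≤-trans (*-monoʳ-≤ _ (proj₁ (½^-pos (suc k))) (≤-respʳ (fromℕ-2^ k) (fromℕ-mono (ℕ.≤-trans (ℕ.n≤1+n n) (ℕ.<⇒≤ n<2^k)))))
          (≤-reflexive (trans (solve 3 (λ p h g → p :* (h :* g) := p :* g :* h) refl (2^ k) ½ (½ ^ k)) (trans (*-congʳ (2^*½^ k)) (*-identityˡ ½))))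

      Bound : X → Y → J.M → Set
      Bound x y m = P x y m * (pay m x y * pay m x y) ≤ 2^ (suc M) * GQ.qm m * μ x y

      pay²-zero : ∀ x y m → pay m x y ≈ 0# → Bound x y m
      pay²-zero x y m pay≈0 = ≤-respˡ (sym (trans (*-congˡ (trans (*-congʳ pay≈0) (zeroˡ _))) (zeroʳ _)))
        (*-nonNeg (*-nonNeg (proj₁ (2^-pos (suc M))) (GQ.0≤qm m)) (GQ.0≤μ x y))

      window-Q≤ : ∀ x y m → ½ ^ (4 ℕ.+ K) ≤ r′ x y m → Dec (Q′ x y m ≈ 0#) → Q′ x y m ≤ 2^ (suc M) * GQ.qm m * μ x y
      window-Q≤ x y m r≥ (yes Q≈0) = ≤-respˡ (sym Q≈0) (*-nonNeg (*-nonNeg (proj₁ (2^-pos (suc M))) (GQ.0≤qm m)) (GQ.0≤μ x y))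
      window-Q≤ x y m r≥ (no Q≉0) = ≤-respʳ (sym (*-assoc _ _ _)) (Support.Q≤ x y m Q≉0 (4 ℕ.+ K) M M≥ r≥)

      -- Since the payoff is at most c r ≤ 1 in absolute value and c ≤ 1, its square is at most r,
      -- so P · pay² ≤ r P = Q: bounding Q bounds the likelihood ratio as far as it is paid.
      pay²-window : ∀ x y m → pay m x y ≈ sgn (GQ.bias m) * (c * r′ x y m) × ½ ^ (4 ℕ.+ K) ≤ r′ x y m × r′ x y m ≤ 2^ (2 ℕ.+ K) → Bound x y m
      pay²-window x y m (pay≈ , r≥ , r≤) = ≤-trans (≤-trans (*-monoˡ-≤ _ (0≤P x y m) square≤r) (≤-reflexive (trans (*-comm _ _) (rP x y m)))) Q≤′
        where
        R : ℝ
        R = r′ x y m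
        0≤R : 0# ≤ R
        0≤R = ≤-trans (proj₁ (½^-pos (4 ℕ.+ K))) r≥
        cr≤1 : c * R ≤ 1#
        cr≤1 = ≤-trans (*-monoˡ-≤ c (proj₁ (½^-pos (3 ℕ.+ K))) r≤)
          (≤-respˡ (trans (solve 3 (λ h g p → h :* (g :* p) := h :* (p :* g)) refl ½ (2^ (2 ℕ.+ K)) (½ ^ (2 ℕ.+ K))) (sym (*-assoc _ _ _))) (≤-respˡ (sym (trans (*-congˡ (2^*½^ (2 ℕ.+ K))) (*-identityʳ ½))) ½≤1))
        ε² : sgn (GQ.bias m) * sgn (GQ.bias m) ≤ 1#
        ε² = proj₁ (within-product (sgn-within (GQ.bias m)) (sgn-within (GQ.bias m)))
        square≤r : pay m x y * pay m x y ≤ R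
        square≤r = ≤-trans (≤-reflexive (trans (*-cong pay≈ pay≈) (solve 2 (λ e z → e :* z :* (e :* z) := e :* e :* (z :* z)) refl (sgn (GQ.bias m)) (c * R))))
          (≤-trans (≤-respʳ (*-identityˡ _) (*-monoʳ-≤ _ (square-nonNeg _) ε²))
            (≤-trans (≤-respʳ (*-identityʳ _) (*-monoˡ-≤ _ 0≤cR cr≤1)) (≤-respʳ (*-identityˡ _) (*-monoʳ-≤ _ 0≤R (½^≤1 (3 ℕ.+ K))))))
          where
          0≤cR : 0# ≤ c * R
          0≤cR = *-nonNeg (proj₁ (½^-pos (3 ℕ.+ K))) 0≤R
        Q≤′ : Q′ x y m ≤ 2^ (suc M) * GQ.qm m * μ x y
        Q≤′ = window-Q≤ x y m r≥ (dec (Q′ x y m ≈ 0#))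

      pay² : ∀ x y m → Bound x y m
      pay² x y m = [ pay²-window x y m , (λ (pay≈0 , _) → pay²-zero x y m pay≈0) ]′ (Payoff.spec (po m) x y)

      F : ∀ i → X → Y → Transcript (k₁ ∷ bits) → ℝ
      F i = factors (k₁ ∷ bits) aliceSide (fix i P)

      w₀ : Fin k₀ → ℝ
      w₀ i = whole (mass (fix i P))

      -- Dividing by μ leaves a bound in terms of q(m), which `qm≤` turns into one in terms of p(m);
      -- the last factor 2 in `B` pays for (1 - η)^n ≥ 1/2.
      bounded-hyp : ∀ i x y → ¬ μ x y ≈ 0# → ∀ m →
        F i x y m * (pay (i ∷ m) x y * pay (i ∷ m) x y) * w₀ i ≤ B * ((1# - ½ ^ suc k) ^ n * whole λ x y → P x y (i ∷ m))
      bounded-hyp i x y μ≉0 m = ≤-trans (*-cancelʳ-≤ 0<μ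
          (≤-respˡ (trans (*-congʳ (factorization isP x y i m)) (solve 4 (λ u w f h → u :* w :* f :* h := f :* h :* w :* u) refl (μ x y) (w₀ i) (F i x y m) (pay (i ∷ m) x y * pay (i ∷ m) x y))) (pay² x y (i ∷ m))))
        (≤-trans (*-monoˡ-≤ _ (proj₁ (2^-pos (suc M))) (≤-trans (GQ.qm≤ dich (i ∷ m)) (≤-trans (*-monoʳ-≤ _ (GQ.0≤pm (i ∷ m)) (*-monoˡ-≤ _ (proj₁ (2^-pos (suc K))) (GQ.β≤1 (i ∷ m)))) (≤-reflexive (*-congʳ (*-identityʳ _))))))
          (≤-trans (≤-reflexive halve) (*-monoˡ-≤ B (proj₁ (2^-pos b)) (*-monoʳ-≤ _ (GQ.0≤pm (i ∷ m)) (≤-via 0≤retained (solve 2 (λ z h → z := h :+ (z :- h)) refl ((1# - ½ ^ suc k) ^ n) ½))))))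
        where
        0<μ : 0# < μ x y
        0<μ = nonNeg≉⇒> (GQ.0≤μ x y) μ≉0
        halve : 2^ (suc M) * (2^ (suc K) * GQ.pm (i ∷ m)) ≈ B * (½ * GQ.pm (i ∷ m))
        halve = trans (sym (*-assoc _ _ _)) (trans (*-congʳ (sym (^-homo-* (fromℕ 2) (suc M) (suc K))))
          (sym (trans (solve 3 (λ p h z → # 2 :* p :* (h :* z) := # 2 :* h :* p :* z) refl (2^ (suc M ℕ.+ suc K)) ½ (GQ.pm (i ∷ m))) (*-congʳ (trans (*-congʳ 2*½) (*-identityˡ _))))))

      supported : ∀ i x y m → F i x y m ≈ 0# → pay (i ∷ m) x y ≈ 0#
      supported i x y m F≈0 = pay-zero (r-zero q isQ A B′ rect finite x y i m F≈0)

      module Round (i : Fin k₀) (w≉0 : ¬ w₀ i ≈ 0#) where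

        private
          g : Transcript (k₁ ∷ bits) → Matrix
          g m = pay (i ∷ m)
          simg : ∀ m → Sim 2 (g m)
          simg m = Payoff.simPay (po (i ∷ m))
          0≤Pi : ∀ x y m → 0# ≤ fix i P x y m
          0≤Pi x y m = 0≤P x y (i ∷ m)

        N< : n ℕ.* suc k ℕ.< 2 ℕ.^ ℓ
        N< = ≡.subst (n ℕ.* suc k ℕ.<_) (≡.sym (ℕ.^-distribˡ-+-* 2 k k)) (ℕ.≤-<-trans (ℕ.*-monoʳ-≤ n (suc≤2^ k)) (ℕ.*-monoˡ-< (2 ℕ.^ k) ⦃ ℕ.>-nonZero (ℕ.m^n>0 2 k) ⦄ (ℕ.<-trans (ℕ.n<1+n n) n<2^k)))
          where
          suc≤2^ : ∀ k → suc k ℕ.≤ 2 ℕ.^ k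
          suc≤2^ zero = s≤s z≤n
          suc≤2^ (suc k) = ℕ.≤-trans (ℕ.+-mono-≤ (ℕ.m^n>0 2 k) (suc≤2^ k)) (ℕ.≤-reflexive (≡.cong (2 ℕ.^ k ℕ.+_) (≡.sym (ℕ.+-identityʳ _))))

        H : Matrix
        H x y = (1# - (1# - γ) ^ trialCount) * FR.S bs (fix i P) 0≤Pi w≉0 g simg J e x y

        sim-H : Sim (ℓ′ ℕ.+ PriorTrees.cost nx ny 2 ℓ J) H
        sim-H = FR.sim-first bs (fix i P) 0≤Pi w≉0 g simg J e {ℓ} N< (proj₁ (½^-pos (suc (e ℕ.+ e)))) γL≤1 trialCount ℓ′ count≤
          where
          γL≤1 : γ * (2^ e * 2^ e + 1#) ≤ 1#
          γL≤1 = ≤-respʳ (trans (*-comm _ _) (2^*½^ (suc (e ℕ.+ e)))) (*-monoˡ-≤ γ (proj₁ (½^-pos (suc (e ℕ.+ e))))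
            (≤-respˡ (+-congʳ (^-homo-* (fromℕ 2) e e)) (≤-respʳ (solve 1 (λ z → z :+ z := # 2 :* z) refl (2^ (e ℕ.+ e))) (+-monoʳ-≤ _ (1≤2^ (e ℕ.+ e))))))
          count≤ : suc (trialCount ℕ.* 2) ℕ.≤ 2 ℕ.^ ℓ′
          count≤ = trials≤ (suc (e ℕ.+ e) ℕ.+ (2 ℕ.+ Γ))

        ½ᵉ : ℝ
        ½ᵉ = ½ ^ (2 ℕ.+ Γ)

        error≤ : ρ ^ J * B + B / 2^ e + (1# - γ) ^ trialCount ≤ ½ᵉ + ½ᵉ + ½ᵉ
        error≤ = +-mono-≤ (+-mono-≤ first second) third
          where
          first : ρ ^ J * B ≤ ½ᵉ
          first = ≤-trans (*-monoʳ-≤ B (proj₁ (2^-pos b)) (ρ^rounds t)) (≤-reflexive (½^*2^ b (2 ℕ.+ Γ)))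
          second : B / 2^ e ≤ ½ᵉ
          second = /≤ (2^-pos e) (≤-reflexive (sym (trans (*-congˡ (^-homo-* (fromℕ 2) b (2 ℕ.+ Γ))) (trans (solve 3 (λ h p g → h :* (p :* g) := g :* h :* p) refl ½ᵉ (2^ b) (2^ (2 ℕ.+ Γ))) (trans (*-congʳ (2^*½^ (2 ℕ.+ Γ))) (*-identityˡ _))))))
          third : (1# - γ) ^ trialCount ≤ ½ᵉ
          third = ≤½^ (2 ℕ.+ Γ) (≤-trans (*-monoˡ-≤ _ (^-nonNeg trialCount (0≤diff γ≤1)) (≤-via 0≤1 (trans (+-congˡ count*γ) (+-comm _ _)))) (decay trialCount (proj₁ (½^-pos (suc (e ℕ.+ e)))) γ≤1))
            where
            γ≤1 : γ ≤ 1#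
            γ≤1 = ½^≤1 (suc (e ℕ.+ e))
            count*γ : fromℕ trialCount * γ ≈ 2^ (2 ℕ.+ Γ)
            count*γ = trans (*-congʳ (trans (fromℕ-trials (suc (e ℕ.+ e) ℕ.+ (2 ℕ.+ Γ))) (^-homo-* (fromℕ 2) (suc (e ℕ.+ e)) (2 ℕ.+ Γ))))
              (trans (solve 3 (λ p g h → p :* g :* h := p :* h :* g) refl (2^ (suc (e ℕ.+ e))) (2^ (2 ℕ.+ Γ)) γ) (trans (*-congʳ (2^*½^ (suc (e ℕ.+ e)))) (*-identityˡ _)))

        round-error : ∀ x y → ¬ μ x y ≈ 0# → ((∑ᵀ (k₁ ∷ bits) λ m → F i x y m * g m x y) - H x y) within ½ᵉ + ½ᵉ + ½ᵉ
        round-error x y μ≉0 = within-cong (+-congʳ (FR.truth≈ bs (fix i P) 0≤Pi w≉0 g simg J e x y (supported i x y)))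
          (within-mono error≤ (FR.first-error bs (fix i P) 0≤Pi w≉0 g simg J e {ℓ} N< (2^-pos b) (proj₁ (2^-pos b)) B≤ x y (supported i x y) (bounded-hyp i x y μ≉0) (½^≤1 (suc (e ℕ.+ e))) trialCount))
          where
          -- At the root the ratio is 1 and β = B serves for √B, as B ≥ 1; this only costs a
          -- constant factor in the number of attempts.
          B≤ : B ≤ 1# * (B * B)
          B≤ = ≤-respʳ (sym (*-identityˡ _)) (≤-respˡ (*-identityʳ B) (*-monoˡ-≤ B (proj₁ (2^-pos b)) (1≤2^ b)))

      T : ℕ
      T = ℓ′ ℕ.+ PriorTrees.cost nx ny 2 ℓ J

      roundValue : ∀ i → Dec (w₀ i ≈ 0#) → Matrix
      roundValue i (yes _) = λ _ _ → 0#
      roundValue i (no w≉0) = Round.H i w≉0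

      sim-roundValue : ∀ i d → Sim T (roundValue i d)
      sim-roundValue i (yes _) = sim-mono z≤n sim-0
      sim-roundValue i (no w≉0) = Round.sim-H i w≉0

      compressed : Fin k₀ → Matrix
      compressed i = roundValue i (dec (w₀ i ≈ 0#))

      sim-compressed : ∀ i → Sim T (compressed i)
      sim-compressed i = sim-roundValue i (dec (w₀ i ≈ 0#))

      err : ℝ
      err = ½ ^ (2 ℕ.+ Γ) + ½ ^ (2 ℕ.+ Γ) + ½ ^ (2 ℕ.+ Γ)

      0≤err : 0# ≤ err
      0≤err = +-nonNeg (+-nonNeg (proj₁ (½^-pos (2 ℕ.+ Γ))) (proj₁ (½^-pos (2 ℕ.+ Γ)))) (proj₁ (½^-pos (2 ℕ.+ Γ)))

      exact : Fin k₀ → Matrix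
      exact i x y = ∑ᵀ (k₁ ∷ bits) λ m → F i x y m * pay (i ∷ m) x y

      0≤w₀ : ∀ i → 0# ≤ w₀ i
      0≤w₀ i = whole-nonNeg λ x y → ∑ᵀ-nonNeg (k₁ ∷ bits) λ m → 0≤P x y (i ∷ m)

      roundValue-error : ∀ i d x y → ¬ μ x y ≈ 0# → (w₀ i * (exact i x y - roundValue i d x y)) within w₀ i * err
      roundValue-error i (yes w≈0) x y μ≉0 = within-cong (sym (trans (*-congʳ w≈0) (zeroˡ _))) (within-0 (*-nonNeg (0≤w₀ i) 0≤err))
      roundValue-error i (no w≉0) x y μ≉0 = within-* (w₀ i) (0≤w₀ i) (Round.round-error i w≉0 x y μ≉0)

      average exactAverage w : Matrix
      average x y = ∑ λ i → w₀ i * compressed i x y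
      exactAverage x y = ∑ λ i → w₀ i * exact i x y
      w x y = μ x y * s x y

      Σw₀ : ∑ w₀ ≈ 1#
      Σw₀ = trans (sym (whole-∑ λ i → mass (fix i P))) ΣP

      sim-overall : Sim T average
      sim-overall = sim-average w₀ compressed 0≤w₀ Σw₀ sim-compressed

      exact-value : ⟨ w , exactAverage ⟩ ≈ ∑ᵀ (k₀ ∷ k₁ ∷ bits) λ m → whole λ x y → P x y m * pay m x y * s x y
      exact-value = trans (∑∑-cong entry) (G.ΣΣᵀ λ x y m → P x y m * pay m x y * s x y)
        where
        entry : ∀ x y → w x y * exactAverage x y ≈ mass (λ x y m → P x y m * pay m x y * s x y) x y
        entry x y = trans (*-∑ˡ (w x y) _) (∑-cong λ i → trans (sym (*-assoc _ _ _)) (trans (*-∑ᵀ (k₁ ∷ bits) (w x y * w₀ i) λ m → F i x y m * pay (i ∷ m) x y)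
          (∑ᵀ-cong (k₁ ∷ bits) λ m → trans (solve 5 (λ u s w f h → u :* s :* w :* (f :* h) := u :* w :* f :* h :* s) refl (μ x y) (s x y) (w₀ i) (F i x y m) (pay (i ∷ m) x y))
            (*-congʳ (*-congʳ (sym (factorization isP x y i m)))))))

      entry-error : ∀ x y → w x y * exactAverage x y ≤ w x y * average x y + μ x y * err
      entry-error x y with dec (μ x y ≈ 0#)
      ... | yes μ≈0 = ≤-reflexive (trans (trans (*-congʳ (trans (*-congʳ μ≈0) (zeroˡ _))) (zeroˡ _))
        (sym (trans (+-cong (trans (*-congʳ (trans (*-congʳ μ≈0) (zeroˡ _))) (zeroˡ _)) (trans (*-congʳ μ≈0) (zeroˡ _))) (+-identityˡ 0#))))
      ... | no μ≉0 = ≤-via (*-nonNeg (GQ.0≤μ x y) (0≤diff s*diff≤)) (solve 5 (λ u s g h e → u :* s :* h :+ u :* e := u :* s :* g :+ u :* (e :- s :* (g :- h))) refl (μ x y) (s x y) (exactAverage x y) (average x y) err)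
        where
        diff-within : (exactAverage x y - average x y) within err
        diff-within = within-cong (trans (∑-cong λ i → solve 3 (λ w g h → w :* (g :- h) := w :* g :+ :- (w :* h)) refl (w₀ i) (exact i x y) (compressed i x y)) (trans (∑-+ _ _) (+-congˡ (sym (∑-neg _)))))
          (within-mono (≤-reflexive (trans (sym (*-∑ʳ err w₀)) (trans (*-congʳ Σw₀) (*-identityˡ _)))) (within-∑ λ i → roundValue-error i (dec (w₀ i ≈ 0#)) x y μ≉0))
        s*diff≤ : s x y * (exactAverage x y - average x y) ≤ err
        s*diff≤ = sign-* (f x y) diff-within
          where
          sign-* : ∀ (z : Bit) {d} → d within err → sign (toℕ z) * d ≤ err
          sign-* zero (p , _) = ≤-respˡ (sym (*-identityˡ _)) p
          sign-* (suc zero) {d} (_ , p) = ≤-respˡ (solve 1 (λ d → :- d := :- # 1 :* # 1 :* d) refl d) p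

      -- The gain ½^Γ is four times ½^(2+Γ), and the errors consume three of these.
      advantage : ½ ^ (2 ℕ.+ Γ) ≤ ⟨ w , average ⟩
      advantage = ≤-via (+-nonNeg (0≤diff (≤-respˡ gain≈ (≤-respʳ (sym exact-value) total-gain))) (0≤diff sum≤))
        (solve 3 (λ v x z → v := z :+ (x :- (z :+ (z :+ z :+ z)) :+ (v :+ (z :+ z :+ z) :- x))) refl (⟨ w , average ⟩) (⟨ w , exactAverage ⟩) (½ ^ (2 ℕ.+ Γ)))
        where
        sum≤ : ⟨ w , exactAverage ⟩ ≤ ⟨ w , average ⟩ + err
        sum≤ = ≤-trans (∑∑-mono entry-error) (≤-reflexive (trans (∑∑-+ _ _) (+-congˡ (trans (∑-cong λ x → sym (*-∑ʳ err (μ x))) (trans (sym (*-∑ʳ err _)) (trans (*-congʳ ΣP) (*-identityˡ _)))))))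
        gain≈ : c * (½ * ½ ^ suc K) ≈ ½ ^ (2 ℕ.+ Γ) + (½ ^ (2 ℕ.+ Γ) + ½ ^ (2 ℕ.+ Γ) + ½ ^ (2 ℕ.+ Γ))
        gain≈ = trans (sym (^-homo-* ½ (3 ℕ.+ K) (2 ℕ.+ K))) (sym (trans (solve 2 (λ h g → h :* (h :* g) :+ (h :* (h :* g) :+ h :* (h :* g) :+ h :* (h :* g)) := # 2 :* h :* (# 2 :* h) :* g) refl ½ (½ ^ Γ))
          (trans (*-congʳ (*-cong 2*½ 2*½)) (solve 1 (λ g → # 1 :* # 1 :* g := g) refl (½ ^ Γ)))))

  -- The communication bound

  ceiling : ∀ N {x} → 0# ≤ x → x ≤ fromℕ N → ∃ λ n → x ≤ fromℕ n × fromℕ n ≤ x + 1#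
  ceiling zero 0≤x x≤0 = 0 , x≤0 , +-nonNeg 0≤x 0≤1
  ceiling (suc N) {x} 0≤x x≤ with dec (x ≤ fromℕ N)
  ... | yes x≤N = ceiling N 0≤x x≤N
  ... | no x≰N = suc N , x≤ , ≤-respʳ (+-comm 1# x) (+-monoʳ-≤ 1# (≰⇒≥ x≰N))

  -- The lower bound keeps L below log₂ C in the final estimate; the upper bound makes L + 1 an
  -- admissible `k`.
  floorLog : ∀ C → ∃ λ L → 2 ℕ.^ L ℕ.≤ suc C × suc C ℕ.< 2 ℕ.^ suc L
  floorLog zero = 0 , s≤s z≤n , s≤s (s≤s z≤n)
  floorLog (suc C) with floorLog C
  ... | L , lo , hi with suc (suc C) ℕ.<? 2 ℕ.^ suc L
  ... | yes lt = L , ℕ.m≤n⇒m≤1+n lo , lt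
  ... | no ≮ = suc L , ℕ.≮⇒≥ ≮ , ℕ.≤-<-trans hi (ℕ.m<m+n (2 ℕ.^ suc L) (ℕ.≤-trans (ℕ.m^n>0 2 (suc L)) (ℕ.≤-reflexive (≡.sym (ℕ.+-identityʳ _)))))

  module _ where

    open ℕ.≤-Reasoning

    -- One attempt takes two announcements of 2 (L + 1) bits and two acceptance bits, that is 4L + 6
    -- ≤ 10L; hence the factor 10.
    cost-bound : ∀ q t t₁ Γ N L → t ℕ.≤ t₁ ℕ.* N → 1 ℕ.≤ N → 1 ℕ.≤ L →
      (2 ℕ.+ (suc (t ℕ.+ t) ℕ.+ (2 ℕ.+ Γ))) ℕ.+ (2 ℕ.+ q ℕ.* t ℕ.* ((suc L ℕ.+ suc L) ℕ.+ ((suc L ℕ.+ suc L) ℕ.+ 2)))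
        ℕ.≤ (2 ℕ.* t₁ ℕ.+ (7 ℕ.+ Γ) ℕ.+ q ℕ.* t₁ ℕ.* 10) ℕ.* (N ℕ.* L)
    cost-bound q t t₁ Γ N L t≤ 1≤N 1≤L = begin
      (2 ℕ.+ (suc (t ℕ.+ t) ℕ.+ (2 ℕ.+ Γ))) ℕ.+ (2 ℕ.+ q ℕ.* t ℕ.* ((suc L ℕ.+ suc L) ℕ.+ ((suc L ℕ.+ suc L) ℕ.+ 2)))
        ≡⟨ NatSolver.solve 4 (λ q t g l → (NatSolver.con 2 :⊕ ((NatSolver.con 1 :⊕ (t :⊕ t)) :⊕ (NatSolver.con 2 :⊕ g))) :⊕ (NatSolver.con 2 :⊕ q :⊗ t :⊗ (((NatSolver.con 1 :⊕ l) :⊕ (NatSolver.con 1 :⊕ l)) :⊕ (((NatSolver.con 1 :⊕ l) :⊕ (NatSolver.con 1 :⊕ l)) :⊕ NatSolver.con 2)))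
             NatSolver.:= NatSolver.con 2 :⊗ t :⊕ (NatSolver.con 7 :⊕ g) :⊕ q :⊗ (t :⊗ (NatSolver.con 4 :⊗ l :⊕ NatSolver.con 6))) ≡.refl q t Γ L ⟩
      2 ℕ.* t ℕ.+ (7 ℕ.+ Γ) ℕ.+ q ℕ.* (t ℕ.* (4 ℕ.* L ℕ.+ 6))
        ≤⟨ ℕ.+-mono-≤ (ℕ.+-mono-≤ (ℕ.*-monoʳ-≤ 2 (ℕ.≤-trans t≤ (ℕ.*-monoʳ-≤ t₁ N≤P))) (ℕ.≤-trans (ℕ.≤-reflexive (≡.sym (ℕ.*-identityʳ (7 ℕ.+ Γ)))) (ℕ.*-monoʳ-≤ (7 ℕ.+ Γ) 1≤P)))
             (ℕ.*-monoʳ-≤ q (ℕ.*-mono-≤ t≤ (ℕ.+-monoʳ-≤ (4 ℕ.* L) (ℕ.*-monoʳ-≤ 6 1≤L)))) ⟩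
      2 ℕ.* (t₁ ℕ.* (N ℕ.* L)) ℕ.+ (7 ℕ.+ Γ) ℕ.* (N ℕ.* L) ℕ.+ q ℕ.* (t₁ ℕ.* N ℕ.* (4 ℕ.* L ℕ.+ 6 ℕ.* L))
        ≡⟨ NatSolver.solve 5 (λ q t g n l → NatSolver.con 2 :⊗ (t :⊗ (n :⊗ l)) :⊕ (NatSolver.con 7 :⊕ g) :⊗ (n :⊗ l) :⊕ q :⊗ (t :⊗ n :⊗ (NatSolver.con 4 :⊗ l :⊕ NatSolver.con 6 :⊗ l))
             NatSolver.:= (NatSolver.con 2 :⊗ t :⊕ (NatSolver.con 7 :⊕ g) :⊕ q :⊗ t :⊗ NatSolver.con 10) :⊗ (n :⊗ l)) ≡.refl q t₁ Γ N L ⟩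
      (2 ℕ.* t₁ ℕ.+ (7 ℕ.+ Γ) ℕ.+ q ℕ.* t₁ ℕ.* 10) ℕ.* (N ℕ.* L) ∎
      where
      open NatSolver using () renaming (_:+_ to infixl 7 _:⊕_; _:*_ to infixl 8 _:⊗_)
      N≤P : N ℕ.≤ N ℕ.* L
      N≤P = ℕ.≤-trans (ℕ.≤-reflexive (≡.sym (ℕ.*-identityʳ N))) (ℕ.*-monoʳ-≤ N 1≤L)
      1≤P : 1 ℕ.≤ N ℕ.* L
      1≤P = ℕ.*-mono-≤ 1≤N 1≤L

  -- From dominated functions to the advantage of protocols

  module Advantage (nx ny : ℕ) where

    open Simulation nx ny

    certain : IsDistribution {1} λ _ → 1#
    certain = record { nonNeg = λ _ → 0≤1 ; sums-to1 = +-identityʳ 1# }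

    deterministic : DetTree → Protocol nx ny
    deterministic t = record { nPub = 1 ; nA = 1 ; nB = 1 ; pubCoins = λ _ → 1# ; aliceCoins = λ _ → 1# ; bobCoins = λ _ → 1#
      ; pub-dist = certain ; alice-dist = certain ; bob-dist = certain ; tree = λ _ → t }

    correlation-deterministic : ∀ t μ f → Protocol.correlation (deterministic t) μ f ≈ ⟨ (λ x y → μ x y * sign (toℕ (f x y))) , val t ⟩
    correlation-deterministic t μ f = trans (sum≈∑ _) (∑-cong λ x → trans (sum≈∑ _) (∑-cong λ y →
      trans (product-cong₀ (^-homo-* (- 1#) (toℕ (run t (x , zero) (y , zero))) (toℕ (f x y))))
        (solve 3 (λ m v s → m :* (# 1 :* (# 1 :* # 1)) :* (v :* s) :+ # 0 :+ # 0 :+ # 0 := m :* s :* v) refl (μ x y) (val t x y) (sign (toℕ (f x y))))))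
      where
      product-cong₀ : ∀ {m z z′} → z ≈ z′ → m * z + 0# + 0# + 0# ≈ m * z′ + 0# + 0# + 0#
      product-cong₀ z≈z′ = +-congʳ (+-congʳ (+-congʳ (*-congˡ z≈z′)))

    adv-≥ : ∀ {T g z R} (μ : Matrix) f → Sim T g → z ≤ ⟨ (λ x y → μ x y * sign (toℕ (f x y))) , g ⟩ → fromℕ T ≤ R → [ z ] ≤∞ adv μ R f
    adv-≥ {T} {g} {z} {R} μ f sim z≤ T≤R =
      let t , d , le = sim (λ x y → μ x y * sign (toℕ (f x y)))
          depth≤ = ≤-trans (fromℕ-mono (ℕ.≤-trans (ℕ.≤-reflexive (ℕ.⊔-identityʳ (depth t))) d)) T≤R
      in ≤∞-trans [ ≤-trans z≤ (≤-respʳ (sym (correlation-deterministic t μ f)) le) ]≤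
           (⨆-upper {Σ (Protocol nx ny) λ π → fromℕ (Protocol.‖_‖ π) ≤ R} (λ (π , _) → [ Protocol.correlation π μ f ]) (deterministic t , depth≤))

  module Constants {α : ℝ} (0<α : 0# < α) where

    K₀ Γ t₁ Z : ℕ
    K₀ = proj₁ (archimedean (α + 1# + fromℕ 4))
    Γ = (3 ℕ.+ suc K₀) ℕ.+ (2 ℕ.+ suc K₀)
    t₁ = (K₀ ℕ.+ (4 ℕ.+ suc K₀)) ℕ.+ ((3 ℕ.+ suc K₀) ℕ.+ (2 ℕ.+ Γ))
    Z = 2 ℕ.* t₁ ℕ.+ (7 ℕ.+ Γ) ℕ.+ attemptRate ℕ.* t₁ ℕ.* 10

    -- The first summand meets the communication bound, with 2 from N ≤ I + 1 ≤ 2 I; the second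
    -- meets the advantage.
    Δ : ℝ
    Δ = fromℕ 2 * fromℕ Z + 2^ (2 ℕ.+ Γ)

    0<Δ : 0# < Δ
    0<Δ = <-respʳ (+-comm _ _) (+-pos (2^-pos (2 ℕ.+ Γ)) (*-nonNeg (proj₁ 0<2) (fromℕ-nonNeg Z)))

    1/Δ≤ : 1# / Δ ≤ ½ ^ (2 ℕ.+ Γ)
    1/Δ≤ = /≤ 0<Δ (≤-respˡ (trans (*-comm _ _) (2^*½^ (2 ℕ.+ Γ)))
      (*-monoˡ-≤ _ (proj₁ (½^-pos (2 ℕ.+ Γ))) (≤-via (*-nonNeg (proj₁ 0<2) (fromℕ-nonNeg Z)) (+-comm _ _))))

    -- The protocol takes O(I log C) bits; as log C ≥ 1, the square of the logarithm bounds this.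
    budget : ∀ {T N L I l} → T ℕ.≤ Z ℕ.* (N ℕ.* L) → 1# ≤ I → fromℕ N ≤ I + 1# → fromℕ L ≤ l → 1# ≤ l → fromℕ T ≤ Δ * I * l ^ 2
    budget {T} {N} {L} {I} {l} T≤ 1≤I N≤ L≤ 1≤l = begin
      fromℕ T                               ≤⟨ fromℕ-mono T≤ ⟩
      fromℕ (Z ℕ.* (N ℕ.* L))               ≈⟨ trans (fromℕ-homo-* Z (N ℕ.* L)) (*-congˡ (fromℕ-homo-* N L)) ⟩
      fromℕ Z * (fromℕ N * fromℕ L)         ≤⟨ *-monoˡ-≤ _ (fromℕ-nonNeg Z) (*-mono-≤ (fromℕ-nonNeg N) (≤-trans N≤ (≤-respʳ (solve 1 (λ i → i :+ i := # 2 :* i) refl I) (+-monoʳ-≤ I 1≤I))) (fromℕ-nonNeg L) (≤-trans L≤ l≤l²)) ⟩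
      fromℕ Z * (fromℕ 2 * I * (l * l))     ≈⟨ solve 3 (λ z i l → z :* (# 2 :* i :* l) := # 2 :* z :* (i :* l)) refl (fromℕ Z) I (l * l) ⟩
      fromℕ 2 * fromℕ Z * (I * (l * l))     ≤⟨ *-monoʳ-≤ _ (*-nonNeg (≤-trans 0≤1 1≤I) (square-nonNeg l)) (≤-via (proj₁ (2^-pos (2 ℕ.+ Γ))) refl) ⟩
      Δ * (I * (l * l))                     ≈⟨ solve 3 (λ d i l → d :* (i :* (l :* l)) := d :* i :* (l :* (l :* # 1))) refl Δ I l ⟩
      Δ * I * l ^ 2                         ∎
      where
      open ≤R
      l≤l² : l ≤ l * l
      l≤l² = ≤-respˡ (*-identityʳ l) (*-monoˡ-≤ l (≤-trans 0≤1 1≤l) 1≤l)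

  compression : {α : ℝ} (0<α : 0# < α) {I : ℝ} → 1# ≤ I → ∀ nx ny (f : Fin nx → Fin ny → Bit) n → 1 ℕ.≤ n →
    (k₀ k₁ : ℕ) (bits : Vec ℕ n) → VecAll (_≡ 2) bits → (p : Joint.Ω nx ny (k₀ ∷ k₁ ∷ bits) → ℝ) →
    Joint.IsProtocolDistribution nx ny (k₀ ∷ k₁ ∷ bits) p → Joint.Mext nx ny (k₀ ∷ k₁ ∷ bits) I p f ≤∞ [ α * I ] →
    let open Constants 0<α in [ 1# / Δ ] ≤∞ adv (Joint.Prxy nx ny (k₀ ∷ k₁ ∷ bits) p) (Δ * I * log₂ (fromℕ (suc n)) ^ 2) f
  compression {α} 0<α {I} 1≤I nx ny f n 1≤n k₀ k₁ bits bs p isP Mext≤ =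
    let (q , isQ , A , B , rect) , near = ⨅-near _ αI<κI Mext≤
        finite = λ ω q≉0 → ≤∞-trans (⨆-upper (λ (ω , _) → J.logCost I p f q ω) (ω , q≉0)) near
    in ≤∞-trans [ 1/Δ≤ ]≤ (adv-≥ (J.Prxy p) f (sim-overall q isQ A B rect finite)
         (≤-trans (advantage q isQ A B rect finite) (≤-reflexive (∑∑-cong λ x y → *-congʳ (*-congʳ (sym (PF.Prxy≈μ x y))))))
         (budget {N = N} {L} (T≤ q isQ A B rect finite) 1≤I (proj₂ (proj₂ ceil)) L≤log 1≤log))
    where
    open Constants 0<α
    open Advantage nx ny using (adv-≥)
    module J = Joint nx ny (k₀ ∷ k₁ ∷ bits)
    module PF = ProtocolFactors nx ny k₀ (k₁ ∷ bits) p
    ceil : ∃ λ N → I ≤ fromℕ N × fromℕ N ≤ I + 1#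
    ceil = ceiling (proj₁ (archimedean I)) (≤-trans 0≤1 1≤I) (proj₂ (archimedean I))
    N L : ℕ
    N = proj₁ ceil
    L = proj₁ (floorLog n)
    open Assembly nx ny k₀ k₁ bits bs p isP f {I} {α} 1≤I K₀ (proj₂ (archimedean _)) N (proj₁ (proj₂ ceil)) (suc L) (proj₂ (proj₂ (floorLog n))) using (sim-overall; advantage; T; ℓ; t)
    αI<κI : α * I < (α + 1#) * I
    αI<κI = ≤-via (≤-trans 0≤1 1≤I) (solve 2 (λ a i → (a :+ # 1) :* i := a :* i :+ i) refl α I) ,
      λ eq → <⇒≱ 0<1 (≤-trans 1≤I (≤-reflexive (trans (solve 2 (λ a i → i := (a :+ # 1) :* i :- a :* i) refl α I) (trans (+-congʳ (sym eq)) (-‿inverseʳ _)))))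
    1≤N : 1 ℕ.≤ N
    1≤N = positive N (≤-trans 1≤I (proj₁ (proj₂ ceil)))
      where
      positive : ∀ N → 1# ≤ fromℕ N → 1 ℕ.≤ N
      positive zero 1≤0 = ⊥-elim (<⇒≱ 0<1 1≤0)
      positive (suc _) _ = s≤s z≤n
    1≤L : 1 ℕ.≤ L
    1≤L = positive L (proj₂ (proj₂ (floorLog n)))
      where
      positive : ∀ L → suc n ℕ.< 2 ℕ.^ suc L → 1 ℕ.≤ L
      positive zero lt = ⊥-elim (ℕ.<⇒≱ lt (s≤s 1≤n))
      positive (suc _) _ = s≤s z≤n
    0<C : 0# < fromℕ (suc n)
    0<C = fromℕ-pos n
    L≤log : fromℕ L ≤ log₂ (fromℕ (suc n))
    L≤log = ≤-respˡ (solve 1 (λ l → l :- # 0 := l) refl (fromℕ L)) (log-lower L 0 0<C (≤-respʳ (sym (*-identityˡ _)) (≤-respˡ (fromℕ-2^ L) (fromℕ-mono (proj₁ (proj₂ (floorLog n)))))))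
    1≤log : 1# ≤ log₂ (fromℕ (suc n))
    1≤log = ≤-trans (≤-respˡ fromℕ-1 (fromℕ-mono 1≤L)) L≤log
    T≤ : ∀ q isQ A B rect finite → T q isQ A B rect finite ℕ.≤ Z ℕ.* (N ℕ.* L)
    T≤ q isQ A B rect finite = ℕ.≤-trans
      (ℕ.≤-reflexive (≡.cong (ℕ._+_ _) (≡.trans (cost≡ nx ny 2 ℓ (rounds t)) (≡.cong (λ J → 2 ℕ.+ J ℕ.* (ℓ ℕ.+ (ℓ ℕ.+ 2))) (rounds≡ t)))))
      (cost-bound attemptRate t t₁ Γ N L t≤ 1≤N 1≤L)
      where
      t≤ : t ℕ.≤ t₁ ℕ.* N
      t≤ = ℕ.≤-trans (ℕ.≤-reflexive (NatSolver.solve 3 (λ m k g → (NatSolver.con 1 NatSolver.:+ (NatSolver.con 1 NatSolver.:+ m NatSolver.:+ (NatSolver.con 1 NatSolver.:+ k))) NatSolver.:+ (NatSolver.con 2 NatSolver.:+ g)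
          NatSolver.:= m NatSolver.:+ ((NatSolver.con 3 NatSolver.:+ k) NatSolver.:+ (NatSolver.con 2 NatSolver.:+ g))) ≡.refl (R ℕ.* N) (suc K₀) Γ))
        (ℕ.≤-trans (ℕ.+-monoʳ-≤ (R ℕ.* N) (ℕ.≤-trans (ℕ.≤-reflexive (≡.sym (ℕ.*-identityʳ S))) (ℕ.*-monoʳ-≤ S 1≤N))) (ℕ.≤-reflexive (≡.sym (ℕ.*-distribʳ-+ N R S))))
        where
        R S : ℕ
        R = K₀ ℕ.+ (4 ℕ.+ suc K₀)
        S = (3 ℕ.+ suc K₀) ℕ.+ (2 ℕ.+ Γ)

theorem8 : (em : ExcludedMiddle 0ℓ) (ℝ : CompleteOrderedField) →
  let open Analysis em ℝ
      open Joint
  in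
  (α : Carrier) → 0# < α →
  ∃ λ (Δ : Carrier) → 0# < Δ ×
    ((I : Carrier) → 1# ≤ I →
     (nx ny : ℕ) (f : Fin nx → Fin ny → Bit) →
     (C : ℕ) → 2 ℕ.≤ C →
     (ks : Vec ℕ (ℕ.suc C)) →
     (p : Ω nx ny ks → Carrier) →
     IsProtocolDistribution nx ny ks p →
     Mext nx ny ks I p f ≤∞ [ α * I ] →
     ((i : Fin (ℕ.suc C)) → 2 ℕ.≤ toℕ i → lookup ks i ≡ 2) →
     [ 1# / Δ ] ≤∞ adv (Prxy nx ny ks p) (Δ * I * log₂ (fromℕ C) ^ 2) f)
theorem8 em ℝ α 0<α = Δ , 0<Δ , λ where
    -- With C = n + 1, `k₀` belongs to the public randomness, `k₁` to the unrestricted first message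
    -- and `bits` to the n messages m₂, ..., m_C.
    I 1≤I nx ny f (suc n) (s≤s 1≤n) (k₀ ∷ k₁ ∷ bits) p isP Mext≤ binary →
      Compression.compression em ℝ 0<α 1≤I nx ny f n 1≤n k₀ k₁ bits
        (lookup⁻ λ i → binary (suc (suc i)) (s≤s (s≤s z≤n))) p isP Mext≤
  where open Compression.Constants em ℝ 0<α
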